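{- Let $w$ be a permutation avoiding the pattern $1423$. Then $c_w(\beta)=d_w(\beta)$.
   Context: Words. $S_n$ is the set of permutations of $\{1,\dots,n\}$ in one-line notation. A word is a finite sequence of distinct positive integers, $|u|$ its length; a subword of $w=w(1)\cdots w(n)$ is $w(i_1)\cdots w(i_m)$ with $i_1<\cdots<i_m$ (including the empty word); $v\le w$ means $v$ is a subword of $w$. $\mathrm{perm}(u)$ is the permutation with the same relative order as $u$, $\mathrm{perm}(\emptyset)=\emptyset$. $w$ avoids $1423$ if there are no $i_1<i_2<i_3<i_4$ with $w(i_1)<w(i_3)<w(i_4)<w(i_2)$. Grothendieck specialization. For $w\in S_n$, $\mathfrak{G}^{(\beta)}_w\in\mathbb{Z}[\beta][x_1,\dots,x_n]$ is defined by $\mathfrak{G}^{(\beta)}_{w_0}=x_1^{n-1}\cdots x_{n-1}$ ($w_0=n\cdots21$) and $\mathfrak{G}^{(\beta)}_w=\pi_i\mathfrak{G}^{(\beta)}_{ws_i}$ when $w(i)<w(i+1)$, with $ws_i$ swapping positions $i,i+1$, $\pi_if=\partial_i((1+\beta x_{i+1})f)$, $\partial_if=(f-s_if)/(x_i-x_{i+1})$. $\Upsilon_w(\beta)=\mathfrak{G}^{(\beta)}_w(1,\dots,1)$, $\Upsilon_\emptyset(\beta)=1$, and $c_w(\beta)=\sum_{\emptyset\le v\le w}(-1)^{|w|-|v|}\Upsilon_{\mathrm{perm}(v)}(\beta)$ (sum over all subwords of $w$). Pipe dreams. For a permutation $w\in S_n$, the staircase of rank $n$ consists of cells $(i,k)$,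 $i+k\le n+1$ (row $i$ from the top, column $k$ from the left). Fill each cell with a crossing tile (vertical segment top-to-bottom crossing a horizontal segment right-to-left) or a bumping tile (one arc joining top edge to left edge, another joining right edge to bottom edge), cells with $i+k=n+1$ being bumping. Pipe $k$ enters at the top of column $k$ and follows the segments down and left to the left boundary. It is a reduced pipe dream of $w$ if any two pipes meet in at most one crossing tile and the labels read on the left boundary from top to bottom form $w$. A marked reduced pipe dream is a reduced pipe dream with a set of marked bumping tiles, where a bumping tile in row $i$ may be marked only if its two pipes cross at a crossing tile in a row strictly above row $i$; $\mathrm{mbt}(P)$ is the number of marked tiles. (Known, Fomin–Kirillov: $\Upsilon_w(\beta)=\sum_P\beta^{\mathrm{mbt}(P)}$ over all marked reduced pipe dreams of $w$.) Pipe $j$ of $P$ is removable if: (i) the column where pipe $j$ enters consists, from top to bottom, of crossing tiles all traversed by pipe $j$ followed by unmarked bumping tiles only; (ii) for each crossing tile traversed by pipe $j$, the tile directly above it (if any) is not an unmarked bumping tile; (iii) pipe $j$ traverses no marked bumping tile. $P$ is a core if no pipe is removable. $d_w(\beta)=\sum_P\beta^{\mathrm{mbt}(P)}$ over all core marked reduced pipe dreams $P$ of $w$ (for $w=\emptyset$, $d_\emptyset(\beta)=1$). -}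

module Defs where

open import Data.Nat using (ℕ; zero; suc; _+_; _*_; _∸_; _<_; _≡ᵇ_; _<ᵇ_)
open import Data.Bool using (Bool; true; false; _∧_; _∨_; not; if_then_else_)
open import Data.List using (List; []; _∷_; map; length; _++_; concatMap)
open import Data.Bool.ListAction using (any; all)
open import Data.Maybe using (Maybe; just; nothing)
open import Data.Product using (_×_; _,_; proj₁; proj₂)
open import Data.Integer using (ℤ) renaming (+_ to ℤ+_; -_ to ℤ-_; _+_ to _+ℤ_)
open import Data.Empty using (⊥)

at : List ℕ → ℕ → ℕ
at [] _ = 0
at (x ∷ xs) zero = x
at (x ∷ xs) (suc i) = at xs i

range : ℕ → ℕ → List ℕ
range a zero = []
range a (suc l) = a ∷ range (suc a) l

oneTo : ℕ → List ℕ
oneTo n = range 1 n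

count : {A : Set} → (A → Bool) → List A → ℕ
count p [] = 0
count p (x ∷ xs) = if p x then suc (count p xs) else count p xs

sumℤ : List ℤ → ℤ
sumℤ [] = ℤ+ 0
sumℤ (x ∷ xs) = x +ℤ sumℤ xs

negPow : ℕ → ℤ → ℤ
negPow zero z = z
negPow (suc m) z = ℤ- (negPow m z)

listEqᵇ : List ℕ → List ℕ → Bool
listEqᵇ [] [] = true
listEqᵇ (x ∷ xs) (y ∷ ys) = (x ≡ᵇ y) ∧ listEqᵇ xs ys
listEqᵇ _ _ = false

subwords : List ℕ → List (List ℕ)
subwords [] = [] ∷ []
subwords (x ∷ xs) = subwords xs ++ map (x ∷_) (subwords xs)

perm : List ℕ → List ℕ
perm u = map (λ x → suc (count (λ y → y <ᵇ x) u)) u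

Avoids1423 : List ℕ → Set
Avoids1423 w = ∀ i₁ i₂ i₃ i₄ → i₁ < i₂ → i₂ < i₃ → i₃ < i₄ → i₄ < length w →
  at w i₁ < at w i₃ → at w i₃ < at w i₄ → at w i₄ < at w i₂ → ⊥

-- Polynomials in ℤ[β][x₁,x₂,...]: formal sums of terms  c · β^b · x^a
-- (a = exponent list, a at index i-1 is the exponent of x_i)

record Term : Set where
  constructor term
  field
    coeff : ℤ
    bexp  : ℕ
    xexp  : List ℕ

Poly : Set
Poly = List Term

setAt : List ℕ → ℕ → ℕ → List ℕ
setAt [] zero v = v ∷ []
setAt [] (suc i) v = 0 ∷ setAt [] i v
setAt (x ∷ xs) zero v = v ∷ xs
setAt (x ∷ xs) (suc i) v = x ∷ setAt xs i v

mulβx : ℕ → Term → Term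
mulβx j (term c b a) = term c (suc b) (setAt a (j ∸ 1) (suc (at a (j ∸ 1))))

setPQ : List ℕ → ℕ → ℕ → ℕ → List ℕ
setPQ a i p' q' = setAt (setAt a (i ∸ 1) p') i q'

-- divided difference ∂_i on a monomial c β^b x^a, with p = a_i, q = a_{i+1}:
--   (x_i^p x_{i+1}^q - x_i^q x_{i+1}^p)/(x_i - x_{i+1})
--   = Σ_{t<p-q} x_i^{q+t} x_{i+1}^{p-1-t}             if p > q
--   = - Σ_{t<q-p} x_i^{p+t} x_{i+1}^{q-1-t}           if p < q
--   = 0                                                if p = q
-- (times the remaining variables, which are symmetric under s_i)
∂Term : ℕ → Term → Poly
∂Term i (term c b a) =
  let p = at a (i ∸ 1) ; q = at a i in
  if q <ᵇ p
  then map (λ t → term c b (setPQ a i (q + t) (p ∸ 1 ∸ t))) (range 0 (p ∸ q))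
  else (if p <ᵇ q
        then map (λ t → term (ℤ- c) b (setPQ a i (p + t) (q ∸ 1 ∸ t))) (range 0 (q ∸ p))
        else [])

∂ : ℕ → Poly → Poly
∂ i P = concatMap (∂Term i) P

πop : ℕ → Poly → Poly
πop i P = ∂ i (P ++ map (mulβx (suc i)) P)

Gw₀ : ℕ → Poly
Gw₀ n = term (ℤ+ 1) 0 (map (λ i → n ∸ i) (oneTo n)) ∷ []

firstAscent : List ℕ → Maybe ℕ
firstAscent w = go 1 w
  where
  go : ℕ → List ℕ → Maybe ℕ
  go i (x ∷ y ∷ r) = if x <ᵇ y then just i else go (suc i) (y ∷ r)
  go i _ = nothing

swap0 : ℕ → List ℕ → List ℕ
swap0 zero (x ∷ y ∷ r) = y ∷ x ∷ r
swap0 (suc i) (x ∷ r) = x ∷ swap0 i r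
swap0 _ w = w

swapAt : ℕ → List ℕ → List ℕ
swapAt i w = swap0 (i ∸ 1) w

-- G_w = π_i G_{w s_i} for the first ascent i of w; G_{w₀} at the top.
-- Fuel n*n exceeds the number of steps (at most n(n-1)/2).
grothFuel : ℕ → ℕ → List ℕ → Poly
grothFuel n zero w = Gw₀ n
grothFuel n (suc f) w with firstAscent w
... | nothing = Gw₀ n
... | just i = πop i (grothFuel n f (swapAt i w))

groth : List ℕ → Poly
groth w = grothFuel (length w) (length w * length w) w

-- coefficient of β^k after setting all x_i = 1
coeffβ : Poly → ℕ → ℤ
coeffβ [] k = ℤ+ 0
coeffβ (term c b a ∷ P) k = if b ≡ᵇ k then c +ℤ coeffβ P k else coeffβ P k

-- coefficient of β^k in Υ_w(β) = G_w(1,...,1); Υ_∅ = 1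
Υ : List ℕ → ℕ → ℤ
Υ [] zero = ℤ+ 1
Υ [] (suc k) = ℤ+ 0
Υ w@(_ ∷ _) k = coeffβ (groth w) k

cCoeff : List ℕ → ℕ → ℤ
cCoeff w k = sumℤ (map (λ v → negPow (length w ∸ length v) (Υ (perm v) k)) (subwords w))

-- cross = crossing tile, bump = unmarked bumping tile, mbump = marked bumping tile
data Tile : Set where
  cross bump mbump : Tile

isCross isBump isMbump : Tile → Bool
isCross cross = true
isCross _ = false
isBump bump = true
isBump _ = false
isMbump mbump = true
isMbump _ = false

-- free cells (i,k) with i + k ≤ n, row by row; cells with i + k = n + 1 are bumping
cells : ℕ → List (ℕ × ℕ)
cells n = concatMap (λ i → map (λ k → (i , k)) (oneTo (n ∸ i))) (oneTo n)

tileLists : ℕ → List (List Tile)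
tileLists zero = [] ∷ []
tileLists (suc m) = concatMap (λ F → (cross ∷ F) ∷ (bump ∷ F) ∷ (mbump ∷ F) ∷ []) (tileLists m)

fillings : ℕ → List (List Tile)
fillings n = tileLists (length (cells n))

lookupTile : List (ℕ × ℕ) → List Tile → ℕ → ℕ → Tile
lookupTile ((i' , k') ∷ cs) (t ∷ ts) i k = if (i' ≡ᵇ i) ∧ (k' ≡ᵇ k) then t else lookupTile cs ts i k
lookupTile _ _ i k = bump

-- tile at (i,k); diagonal cells (i + k = n + 1) are (unmarked) bumping tiles
tileAt : ℕ → List Tile → ℕ → ℕ → Tile
tileAt n F i k = lookupTile (cells n) F i k

data Dir : Set where
  fromTop fromRight : Dir

trace : ℕ → List Tile → ℕ → ℕ → ℕ → Dir → List (ℕ × ℕ) × ℕ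
trace n F zero i k d = ([] , 0)
trace n F (suc f) i zero d = ([] , i)
trace n F (suc f) i (suc k') d = step (tileAt n F i (suc k')) d
  where
  add : List (ℕ × ℕ) × ℕ → List (ℕ × ℕ) × ℕ
  add (p , e) = ((i , suc k') ∷ p , e)
  step : Tile → Dir → List (ℕ × ℕ) × ℕ
  step cross fromTop = add (trace n F f (suc i) (suc k') fromTop)
  step cross fromRight = add (trace n F f i k' fromRight)
  step _ fromTop = add (trace n F f i k' fromRight)
  step _ fromRight = add (trace n F f (suc i) (suc k') fromTop)

pipe : ℕ → List Tile → ℕ → List (ℕ × ℕ) × ℕ
pipe n F j = trace n F (suc (suc (n + n))) 1 j fromTop

exitRow : ℕ → List Tile → ℕ → ℕ
exitRow n F j = proj₂ (pipe n F j)

visits : ℕ → List Tile → ℕ → ℕ → ℕ → Bool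
visits n F j i k = any (λ c → (proj₁ c ≡ᵇ i) ∧ (proj₂ c ≡ᵇ k)) (proj₁ (pipe n F j))

firstOr0 : List ℕ → ℕ
firstOr0 [] = 0
firstOr0 (x ∷ _) = x

labels : ℕ → List Tile → List ℕ
labels n F = map (λ i → firstOr0 (concatMap (λ j → if exitRow n F j ≡ᵇ i then j ∷ [] else []) (oneTo n))) (oneTo n)

crossAt : ℕ → List Tile → ℕ → ℕ → ℕ × ℕ → Bool
crossAt n F j l (i , k) = isCross (tileAt n F i k) ∧ visits n F j i k ∧ visits n F l i k

reducedᵇ : ℕ → List Tile → Bool
reducedᵇ n F = all (λ j → all (λ l → (j ≡ᵇ l) ∨ (count (crossAt n F j l) (cells n) <ᵇ 2)) (oneTo n)) (oneTo n)

markOKᵇ : ℕ → List Tile → Bool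
markOKᵇ n F = all ok (cells n)
  where
  ok : ℕ × ℕ → Bool
  ok (i , k) = not (isMbump (tileAt n F i k)) ∨
    any (λ j → any (λ l → not (j ≡ᵇ l) ∧ visits n F j i k ∧ visits n F l i k ∧
                          any (λ c → (proj₁ c <ᵇ i) ∧ crossAt n F j l c) (cells n))
                   (oneTo n)) (oneTo n)

isMRPDᵇ : List ℕ → List Tile → Bool
isMRPDᵇ w F = listEqᵇ (labels (length w) F) w ∧ reducedᵇ (length w) F ∧ markOKᵇ (length w) F

mbt : List Tile → ℕ
mbt F = count isMbump F

-- (i): column j, top to bottom: crossing tiles traversed by j, then unmarked bumping tiles
colPattern : List (Tile × Bool) → Bool
colPattern ((cross , true) ∷ r) = colPattern r
colPattern r = all (λ tb → isBump (proj₁ tb)) r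

removableᵇ : ℕ → List Tile → ℕ → Bool
removableᵇ n F j =
  colPattern (map (λ i → (tileAt n F i j , visits n F j i j)) (oneTo ((suc n) ∸ j))) ∧
  all (λ c → not (isCross (tileAt n F (proj₁ c) (proj₂ c)) ∧ visits n F j (proj₁ c) (proj₂ c)) ∨
             (proj₁ c ≡ᵇ 1) ∨ not (isBump (tileAt n F (proj₁ c ∸ 1) (proj₂ c)))) (cells n) ∧
  all (λ c → not (isMbump (tileAt n F (proj₁ c) (proj₂ c)) ∧ visits n F j (proj₁ c) (proj₂ c))) (cells n)

isCoreᵇ : ℕ → List Tile → Bool
isCoreᵇ n F = not (any (removableᵇ n F) (oneTo n))

dCoeff : List ℕ → ℕ → ℤ
dCoeff w k = ℤ+ (count (λ F → isMRPDᵇ w F ∧ isCoreᵇ (length w) F ∧ (mbt F ≡ᵇ k)) (fillings (length w)))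

{-# OPTIONS --safe #-}

-- Reading a filling column by column (or row by row), each cell meets a label
-- from the top and one from the right. The filling is a marked reduced pipe dream
-- iff every cross has top < right and every marked bump has top > right: two pipes
-- are in the wrong order exactly when they have already crossed.
--
-- Each cell then acts by 1 + x u in the 0-Hecke algebra u² = β u, and the Yang–Baxter
-- equation gives (1 + β x_{i+1}) G_w − s_i ((1 + β x_{i+1}) G_w) = (x_i − x_{i+1}) G_{w s_i}
-- for a descent i of w, hence the Fomin–Kirillov formula for Υ.
--
-- A removable pipe can be erased, and an erased pipe has exactly one way back: going
-- from its exit to the right, it must rise below an unmarked bump and go straight
-- otherwise. An illegal crossing on this path would create a pattern 1423 in w.
-- Erasing a pipe does not change the removability of the others, so the number of
-- pipe dreams of w in which given pipes are removable is counted by Υ of a subword,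
-- and inclusion–exclusion over the set of removable pipes gives c_w = d_w.

module Submission where

open import Defs
open import Data.Bool using (Bool; true; false; _∧_; _∨_; not; if_then_else_; T)
open import Data.Bool.ListAction using (any; all)
open import Data.Bool.Properties using (∧-comm; ∧-zeroʳ; ∧-identityʳ)
open import Data.Empty using (⊥; ⊥-elim)
open import Data.Integer using (ℤ) renaming (+_ to ℤ+_; -_ to ℤ-_; _+_ to _+ℤ_; _*_ to _*ℤ_)
import Data.Integer.Properties as ℤₚ
open import Algebra.Properties.AbelianGroup ℤₚ.+-0-abelianGroup using (identityˡ-unique)
import Data.Integer.Tactic.RingSolver as ℤSolver
open import Data.List using (List; []; _∷_; map; length; _++_; concatMap; drop; take; replicate)
open import Data.List.Membership.Propositional using (_∈_; _∉_)
open import Data.List.Membership.Propositional.Properties using (∈-∃++; ∈-++⁺ˡ; ∈-++⁺ʳ; ∈-++⁻; ∈-map⁺; ∈-map⁻)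
open import Data.List.Properties using (∷-injectiveˡ; ∷-injectiveʳ; length-++; length-map; ++-assoc; map-++; map-∘; map-cong)
open import Data.List.Relation.Binary.Permutation.Propositional using (_↭_; ↭-refl; ↭-sym; ↭-trans; prep; swap; ↭-reflexive; ↭⇒↭ₛ)
import Data.List.Relation.Binary.Permutation.Propositional as Perm
open import Data.List.Relation.Binary.Permutation.Propositional.Properties using (↭-length; ∷↭∷ʳ; All-resp-↭; ∈-resp-↭; drop-mid) renaming (map⁺ to ↭-map⁺)
open import Data.List.Relation.Binary.Pointwise using (Pointwise-≡⇒≡)
open import Data.List.Relation.Unary.All using (All; []; _∷_)
import Data.List.Relation.Unary.All as All
open import Data.List.Relation.Unary.All.Properties using () renaming (++⁺ to All-++⁺; map⁺ to All-map⁺)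
open import Data.List.Relation.Unary.AllPairs using ([]; _∷_)
open import Data.List.Relation.Unary.Any using (here; there)
open import Data.List.Relation.Unary.Linked using (Linked; []; [-]; _∷_)
open import Data.List.Relation.Unary.Sorted.TotalOrder.Properties using (↗↭↗⇒≋)
open import Data.List.Relation.Unary.Unique.Propositional using (Unique)
import Data.List.Relation.Unary.Unique.Propositional.Properties as Uniqueₚ
open import Data.Maybe using (Maybe; just; nothing; _>>=_; is-just)
import Data.Maybe as Maybe
open import Data.Maybe.Properties using (just-injective)
open import Data.Nat using (ℕ; zero; suc; _+_; _*_; _∸_; _≤_; _<_; _≥_; z≤n; s≤s; _≡ᵇ_; _<ᵇ_)
open import Data.Nat.Properties
import Data.Nat.Tactic.RingSolver as ℕSolver
open import Data.List.Membership.DecPropositional _≟_ using (_∈?_)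
open import Data.Product using (_×_; _,_; proj₁; proj₂; ∃; ∃₂; Σ-syntax)
open import Data.Sum using (_⊎_; inj₁; inj₂)
open import Data.Unit using (⊤; tt)
open import Data.Vec using (Vec; []; _∷_; toList; _∷ʳ_)
import Data.Vec as Vec
open import Data.Vec.Properties using (length-toList; toList-map)
open import Data.Vec.Relation.Unary.All using ([]; _∷_) renaming (All to Allⱽ)
open import Data.Vec.Relation.Unary.All.Properties using (toList⁺)
open import Function using (id)
import Relation.Binary.Construct.Flip.EqAndOrd as Flip
open import Relation.Binary.Definitions using (tri<; tri≈; tri>)
open import Relation.Binary.PropositionalEquality
open import Relation.Nullary using (¬_; yes; no)
open import Data.List.Relation.Binary.Permutation.Setoid.Properties (setoid ℕ) using (Unique-resp-↭)

-- Two obstacles shape the proof. `groth` yields an unreduced list of terms, without equality of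
-- polynomials or division by x_i - x_{i+1}. So everything is dualised: a polynomial is known by its
-- pairings, π_i is replaced by its adjoint, and the division becomes the recursion of `antidiff`.
-- The variables are set to 1 only after the symmetry in them has been used, by taking test
-- functions that ignore the exponents. Erasing a pipe leaves a gap in the labels. So pipe dreams
-- are run on an arbitrary increasing vector of top labels, and `rank` restores 1, ..., n only where
-- Υ is evaluated. The triangle is needed in two readings: by rows, which carry one variable each,
-- and by columns, since erasing a pipe deletes its own column, takes one tile from each column on
-- the left, and leaves those on the right alone. Avoidance of 1423 enters at a single place,
-- through `removes-valid⁻¹`: reinserting a pipe may create an illegal crossing, while erasing one
-- never breaks validity.

-- A pipe dream of rank n is stored by columns: the first column has n ∸ 1 free
-- tiles, and the bumping tile on the diagonal is implicit.
data PD : ℕ → Set where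
  []  : PD 0
  _∷_ : ∀ {n} → Vec Tile n → PD n → PD (suc n)

leftOf botOf : Tile → ℕ → ℕ → ℕ
leftOf cross t r = r
leftOf _     t r = t
botOf cross t r = t
botOf _     t r = r

okTile : Tile → ℕ → ℕ → Bool
okTile cross t r = t <ᵇ r
okTile bump  t r = true
okTile mbump t r = not (t <ᵇ r)

isM : Tile → ℕ
isM mbump = 1
isM _     = 0

-- `c` is the label coming down, the vector holds the labels arriving from the right. The diagonal
-- tile is a bump and turns the last carried label to the left, so a column adds one label.
colStep : ∀ {n} → ℕ → Vec ℕ n → Vec Tile n → Vec ℕ (suc n)
colStep c []       []      = c ∷ []
colStep c (r ∷ rs) (x ∷ τ) = leftOf x c r ∷ colStep (botOf x c r) rs τ

colOK : ∀ {n} → ℕ → Vec ℕ n → Vec Tile n → Bool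
colOK c []       []      = true
colOK c (r ∷ rs) (x ∷ τ) = okTile x c r ∧ colOK (botOf x c r) rs τ

run : ∀ {n} → Vec ℕ n → PD n → Vec ℕ n
run []       []      = []
run (t ∷ ts) (τ ∷ P) = colStep t (run ts P) τ

valid : ∀ {n} → Vec ℕ n → PD n → Bool
valid []       []      = true
valid (t ∷ ts) (τ ∷ P) = colOK t (run ts P) τ ∧ valid ts P

marksV : ∀ {n} → Vec Tile n → ℕ
marksV []      = 0
marksV (x ∷ τ) = isM x + marksV τ

marks : ∀ {n} → PD n → ℕ
marks []      = 0
marks (τ ∷ P) = marksV τ + marks P

rowH : ∀ {n} → Vec ℕ (suc n) → Vec Tile n → ℕ
rowH (t ∷ ts) []      = t
rowH (t ∷ ts) (x ∷ τ) = leftOf x t (rowH ts τ)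

rowU : ∀ {n} → Vec ℕ (suc n) → Vec Tile n → Vec ℕ n
rowU (t ∷ ts) []      = []
rowU (t ∷ ts) (x ∷ τ) = botOf x t (rowH ts τ) ∷ rowU ts τ

rowOK : ∀ {n} → Vec ℕ (suc n) → Vec Tile n → Bool
rowOK (t ∷ ts) []      = true
rowOK (t ∷ ts) (x ∷ τ) = okTile x t (rowH ts τ) ∧ rowOK ts τ

consRow : ∀ {n} → Vec Tile n → PD n → PD (suc n)
consRow []      []      = [] ∷ []
consRow (x ∷ ρ) (τ ∷ P) = (x ∷ τ) ∷ consRow ρ P

-- Both sides send the labels through the same tiles, and nothing flows from a lower row into the
-- top one, so that row may be done first. Together with `valid-consRow` this is the passage between
-- the column reading and the row reading.
run-consRow : ∀ {n} (ts : Vec ℕ (suc n)) (ρ : Vec Tile n) (P : PD n) →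
  run ts (consRow ρ P) ≡ rowH ts ρ ∷ run (rowU ts ρ) P
run-consRow (t ∷ []) [] [] = refl
run-consRow (t ∷ ts) (x ∷ ρ) (τ ∷ P) rewrite run-consRow ts ρ P = refl

∧-interchange : ∀ a b c d → (a ∧ b) ∧ (c ∧ d) ≡ (a ∧ c) ∧ (b ∧ d)
∧-interchange true  true  c d = refl
∧-interchange true  false true  d = refl
∧-interchange true  false false d = refl
∧-interchange false b c d = refl

valid-consRow : ∀ {n} (ts : Vec ℕ (suc n)) (ρ : Vec Tile n) (P : PD n) →
  valid ts (consRow ρ P) ≡ rowOK ts ρ ∧ valid (rowU ts ρ) P
valid-consRow (t ∷ []) [] [] = refl
valid-consRow (t ∷ ts) (x ∷ ρ) (τ ∷ P)
  rewrite run-consRow ts ρ P | valid-consRow ts ρ P =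
  ∧-interchange (okTile x t (rowH ts ρ)) _ (rowOK ts ρ) _

marks-consRow : ∀ {n} (ρ : Vec Tile n) (P : PD n) →
  marks (consRow ρ P) ≡ marksV ρ + marks P
marks-consRow [] [] = refl
marks-consRow (x ∷ ρ) (τ ∷ P) rewrite marks-consRow ρ P =
  lem (isM x) (marksV τ) (marksV ρ) (marks P)
  where
  lem : ∀ a b c d → a + b + (c + d) ≡ a + c + (b + d)
  lem = ℕSolver.solve-∀

-- A list that is too short is padded with `bump`, the default of `lookupTile`; hence `tileAt≡` asks
-- nothing of the length of `F`.
rowFrom : (n : ℕ) → List Tile → Vec Tile n
rowFrom zero    F       = []
rowFrom (suc n) []      = bump ∷ rowFrom n []
rowFrom (suc n) (x ∷ F) = x ∷ rowFrom n F

toPD : (n : ℕ) → List Tile → PD n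
toPD zero    F = []
toPD (suc n) F = consRow (rowFrom n F) (toPD n (drop n F))

rangeV : ℕ → (n : ℕ) → Vec ℕ n
rangeV a zero    = []
rangeV a (suc n) = a ∷ rangeV (suc a) n

toList-rangeV : ∀ a n → toList (rangeV a n) ≡ range a n
toList-rangeV a zero    = refl
toList-rangeV a (suc n) = cong (a ∷_) (toList-rangeV (suc a) n)

-- Fomin–Kirillov formula

at-setAt : ∀ a i v → at (setAt a i v) i ≡ v
at-setAt []      zero    v = refl
at-setAt []      (suc i) v = at-setAt [] i v
at-setAt (x ∷ a) zero    v = refl
at-setAt (x ∷ a) (suc i) v = at-setAt a i v

at-setAt-≢ : ∀ a i j v → i ≢ j → at (setAt a i v) j ≡ at a j
at-setAt-≢ a zero zero v i≢j = ⊥-elim (i≢j refl)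
at-setAt-≢ []      zero    (suc j) v i≢j = refl
at-setAt-≢ (x ∷ a) zero    (suc j) v i≢j = refl
at-setAt-≢ []      (suc i) zero    v i≢j = refl
at-setAt-≢ (x ∷ a) (suc i) zero    v i≢j = refl
at-setAt-≢ []      (suc i) (suc j) v i≢j = at-setAt-≢ [] i j v (λ e → i≢j (cong suc e))
at-setAt-≢ (x ∷ a) (suc i) (suc j) v i≢j = at-setAt-≢ a i j v (λ e → i≢j (cong suc e))

setAt-setAt : ∀ a i u v → setAt (setAt a i u) i v ≡ setAt a i v
setAt-setAt []      zero    u v = refl
setAt-setAt []      (suc i) u v = cong (0 ∷_) (setAt-setAt [] i u v)
setAt-setAt (x ∷ a) zero    u v = refl
setAt-setAt (x ∷ a) (suc i) u v = cong (x ∷_) (setAt-setAt a i u v)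

setAt-comm : ∀ a i j u v → i ≢ j → setAt (setAt a i u) j v ≡ setAt (setAt a j v) i u
setAt-comm a zero zero u v i≢j = ⊥-elim (i≢j refl)
setAt-comm []      zero    (suc j) u v i≢j = refl
setAt-comm (x ∷ a) zero    (suc j) u v i≢j = refl
setAt-comm []      (suc i) zero    u v i≢j = refl
setAt-comm (x ∷ a) (suc i) zero    u v i≢j = refl
setAt-comm []      (suc i) (suc j) u v i≢j = cong (0 ∷_) (setAt-comm [] i j u v (λ e → i≢j (cong suc e)))
setAt-comm (x ∷ a) (suc i) (suc j) u v i≢j = cong (x ∷_) (setAt-comm a i j u v (λ e → i≢j (cong suc e)))

inc : ℕ → List ℕ → List ℕ
inc i a = setAt a i (suc (at a i))

inc-comm : ∀ i j a → inc i (inc j a) ≡ inc j (inc i a)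
inc-comm i j a with i ≟ j
... | yes refl = refl
... | no i≢j rewrite at-setAt-≢ a j i (suc (at a j)) (λ e → i≢j (sym e)) | at-setAt-≢ a i j (suc (at a i)) i≢j =
  setAt-comm a j i _ _ (λ e → i≢j (sym e))

-- A polynomial in β and x is handled through its pairings with all functions
-- on monomials β^b x^a; multiplication by a variable becomes a shift of (b , a).
K : Set
K = ℕ → List ℕ → ℤ

-- Linearity over ℤ[β][x] in dual form: multiplication by β or by a variable is a shift of the
-- monomial, so scalars become shifts that `F` commutes with. `F-cong` stands in for function
-- extensionality.
record Linear {J : Set} (F : (J → K) → K) : Set where
  field
    F-cong : ∀ {Φ Ψ} → (∀ j b a → Φ j b a ≡ Ψ j b a) → ∀ b a → F Φ b a ≡ F Ψ b a
    F-+    : ∀ Φ Ψ b a → F (λ j b a → Φ j b a +ℤ Ψ j b a) b a ≡ F Φ b a +ℤ F Ψ b a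
    F-neg  : ∀ Φ b a → F (λ j b a → ℤ- Φ j b a) b a ≡ ℤ- F Φ b a
    F-β    : ∀ Φ b a → F (λ j b a → Φ j (suc b) a) b a ≡ F Φ (suc b) a
    F-x    : ∀ i Φ b a → F (λ j b a → Φ j b (inc i a)) b a ≡ F Φ b (inc i a)

  F-H : ∀ i Φ Ψ b a →
    F (λ j b a → Φ j b a +ℤ Ψ j b (inc i a)) b a ≡ F Φ b a +ℤ F Ψ b (inc i a)
  F-H i Φ Ψ b a = trans (F-+ Φ (λ j b a → Ψ j b (inc i a)) b a) (cong (F Φ b a +ℤ_) (F-x i Ψ b a))

  F-βx : ∀ i Φ b a → F (λ j b a → Φ j (suc b) (inc i a)) b a ≡ F Φ (suc b) (inc i a)
  F-βx i Φ b a = trans (F-x i (λ j b a → Φ j (suc b) a) b a) (F-β Φ b (inc i a))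

  F-R : ∀ i i' Φ Ψ b a →
    F (λ j b a → (Φ j b a +ℤ Φ j (suc b) (inc i a)) +ℤ (Ψ j b (inc i' a) +ℤ ℤ- Ψ j b (inc i a))) b a ≡
    (F Φ b a +ℤ F Φ (suc b) (inc i a)) +ℤ (F Ψ b (inc i' a) +ℤ ℤ- F Ψ b (inc i a))
  F-R i i' Φ Ψ b a =
    trans (F-+ (λ j b a → Φ j b a +ℤ Φ j (suc b) (inc i a)) (λ j b a → Ψ j b (inc i' a) +ℤ ℤ- Ψ j b (inc i a)) b a)
      (cong₂ _+ℤ_
        (trans (F-+ Φ (λ j b a → Φ j (suc b) (inc i a)) b a) (cong (F Φ b a +ℤ_) (F-βx i Φ b a)))
        (trans (F-+ (λ j b a → Ψ j b (inc i' a)) (λ j b a → ℤ- Ψ j b (inc i a)) b a)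
          (cong₂ _+ℤ_ (F-x i' Ψ b a)
            (trans (F-neg (λ j b a → Ψ j b (inc i a)) b a) (cong ℤ-_ (F-x i Ψ b a))))))

open Linear

-- The generator u_p of the 0-Hecke algebra (u_p² = β u_p) acting on words.
U : ∀ {n} → ℕ → (Vec ℕ n → K) → Vec ℕ n → K
U zero    Φ []          b a = ℤ+ 0
U zero    Φ (x ∷ [])    b a = ℤ+ 0
U zero    Φ (x ∷ y ∷ w) b a = if x <ᵇ y then Φ (y ∷ x ∷ w) b a else Φ (x ∷ y ∷ w) (suc b) a
U (suc p) Φ []          b a = ℤ+ 0
U (suc p) Φ (x ∷ w)     b a = U p (λ v → Φ (x ∷ v)) w b a

U-linear : ∀ {n} p (w : Vec ℕ n) → Linear (λ Φ → U p Φ w)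
U-linear zero    []          = record
  { F-cong = λ _ _ _ → refl ; F-+ = λ _ _ _ _ → refl ; F-neg = λ _ _ _ → refl
  ; F-β = λ _ _ _ → refl ; F-x = λ _ _ _ _ → refl }
U-linear zero    (x ∷ [])    = record
  { F-cong = λ _ _ _ → refl ; F-+ = λ _ _ _ _ → refl ; F-neg = λ _ _ _ → refl
  ; F-β = λ _ _ _ → refl ; F-x = λ _ _ _ _ → refl }
U-linear zero    (x ∷ y ∷ w) with x <ᵇ y
... | true = record
  { F-cong = λ e b a → e _ _ _ ; F-+ = λ _ _ _ _ → refl ; F-neg = λ _ _ _ → refl
  ; F-β = λ _ _ _ → refl ; F-x = λ _ _ _ _ → refl }
... | false = record
  { F-cong = λ e b a → e _ _ _ ; F-+ = λ _ _ _ _ → refl ; F-neg = λ _ _ _ → refl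
  ; F-β = λ _ _ _ → refl ; F-x = λ _ _ _ _ → refl }
U-linear (suc p) []          = record
  { F-cong = λ _ _ _ → refl ; F-+ = λ _ _ _ _ → refl ; F-neg = λ _ _ _ → refl
  ; F-β = λ _ _ _ → refl ; F-x = λ _ _ _ _ → refl }
U-linear (suc p) (x ∷ w)     = record
  { F-cong = λ e → F-cong L (λ v → e (x ∷ v)) ; F-+ = λ Φ Ψ → F-+ L (λ v → Φ (x ∷ v)) (λ v → Ψ (x ∷ v))
  ; F-neg = λ Φ → F-neg L (λ v → Φ (x ∷ v))
  ; F-β = λ Φ → F-β L (λ v → Φ (x ∷ v)) ; F-x = λ i Φ → F-x L i (λ v → Φ (x ∷ v)) }
  where L = U-linear p w

<ᵇ-true : ∀ {x y} → x < y → (x <ᵇ y) ≡ true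
<ᵇ-true {x} {y} x<y with x <ᵇ y | <⇒<ᵇ x<y
... | true | _ = refl

<ᵇ-false : ∀ {x y} → ¬ x < y → (x <ᵇ y) ≡ false
<ᵇ-false {x} {y} x≮y with x <ᵇ y in eq
... | false = refl
... | true = ⊥-elim (x≮y (<ᵇ⇒< x y (subst T (sym eq) _)))

U² : ∀ {n} (w : Vec ℕ n) Φ b a → U 0 (U 0 Φ) w b a ≡ U 0 Φ w (suc b) a
U² [] Φ b a = refl
U² (x ∷ []) Φ b a = refl
U² (x ∷ y ∷ w) Φ b a with x <? y
... | yes p rewrite <ᵇ-true p | <ᵇ-false (<-asym p) = refl
... | no p  rewrite <ᵇ-false p = refl

-- Either product sorts the first three letters into decreasing order, with a factor β for each step
-- that finds no ascent.
U-braid : ∀ {n} (w : Vec ℕ n) Φ b a → U 0 (U 1 (U 0 Φ)) w b a ≡ U 1 (U 0 (U 1 Φ)) w b a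
U-braid [] Φ b a = refl
U-braid (x ∷ []) Φ b a = refl
U-braid (x ∷ y ∷ []) Φ b a with x <ᵇ y
... | true = refl
... | false = refl
U-braid (x ∷ y ∷ z ∷ w) Φ b a with x <? y | y <? z | x <? z
... | yes p | yes q | _     rewrite <ᵇ-true p | <ᵇ-true q | <ᵇ-true (<-trans p q) = refl
... | yes p | no q  | yes r rewrite <ᵇ-true p | <ᵇ-false q | <ᵇ-true r = refl
... | yes p | no q  | no r  rewrite <ᵇ-true p | <ᵇ-false q | <ᵇ-false r | <ᵇ-false (<-asym p) = refl
... | no p  | yes q | yes r rewrite <ᵇ-false p | <ᵇ-true q | <ᵇ-true r = refl
... | no p  | yes q | no r  rewrite <ᵇ-false p | <ᵇ-true q | <ᵇ-false r | <ᵇ-false (<-asym q) = refl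
... | no p  | no q  | _     rewrite <ᵇ-false p | <ᵇ-false q = refl

H : ∀ {n} → ℕ → ℕ → (Vec ℕ n → K) → Vec ℕ n → K
H p i Φ w b a = Φ w b a +ℤ U p Φ w b (inc i a)

-- With h_p(z) = 1 + z u_p this is (1 + β x_i) h_p(x_{i'} ⊖ x_i), where y ⊖ x = (y - x)/(1 + β x);
-- the factor in front clears the denominator. `H-R` then expresses h(x) h(y ⊖ x) = h(y).
R : ∀ {n} → ℕ → ℕ → ℕ → (Vec ℕ n → K) → Vec ℕ n → K
R p i i' Φ w b a =
  (Φ w b a +ℤ Φ w (suc b) (inc i a)) +ℤ (U p Φ w b (inc i' a) +ℤ ℤ- U p Φ w b (inc i a))

H-R : ∀ {n} i i' Φ (w : Vec ℕ n) b a →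
  H 0 i (R 0 i i' Φ) w b a ≡ H 0 i' Φ w b a +ℤ H 0 i' Φ w (suc b) (inc i a)
H-R i i' Φ w b a
  rewrite F-R (U-linear 0 w) i i' Φ (U 0 Φ) b (inc i a)
        | U² w Φ b (inc i' (inc i a)) | U² w Φ b (inc i (inc i a)) =
  lem (Φ w b a) _ _ _ _ _
  where
  lem : ∀ p q r s t u → ((p +ℤ q) +ℤ (r +ℤ ℤ- s)) +ℤ ((s +ℤ t) +ℤ (u +ℤ ℤ- t)) ≡ (p +ℤ r) +ℤ (q +ℤ u)
  lem = ℤSolver.solve-∀

-- For x = x_i and y = x_{i'} this is h_0(x) h_1(y) h_0(y ⊖ x) = h_1(y ⊖ x) h_0(y) h_1(x),
-- multiplied by 1 + β x. Both sides are expanded into words in `U 0` and `U 1` and reduced by the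
-- quadratic and braid relations; what remains is an identity between integers.
yang-baxter : ∀ {n} i i' Φ (w : Vec ℕ n) b a →
  H 0 i (H 1 i' (R 0 i i' Φ)) w b a ≡ R 1 i i' (H 0 i' (H 1 i Φ)) w b a
yang-baxter {n} i i' Φ w b a = trans lhs (sym rhs)
  where
  x y : List ℕ → List ℕ
  x = inc i
  y = inc i'
  U1R : ∀ w b a → U 1 (R 0 i i' Φ) w b a ≡
    (U 1 Φ w b a +ℤ U 1 Φ w (suc b) (x a)) +ℤ (U 1 (U 0 Φ) w b (y a) +ℤ ℤ- U 1 (U 0 Φ) w b (x a))
  U1R w b a = F-R (U-linear 1 w) i i' Φ (U 0 Φ) b a
  U0R : ∀ b a → U 0 (R 0 i i' Φ) w b a ≡
    (U 0 Φ w b a +ℤ U 0 Φ w (suc b) (x a)) +ℤ (U 0 Φ w (suc b) (y a) +ℤ ℤ- U 0 Φ w (suc b) (x a))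
  U0R b a = trans (F-R (U-linear 0 w) i i' Φ (U 0 Φ) b a)
    (cong₂ (λ p q → (U 0 Φ w b a +ℤ U 0 Φ w (suc b) (x a)) +ℤ (p +ℤ ℤ- q)) (U² w Φ b (y a)) (U² w Φ b (x a)))
  U0U1R : ∀ b a → U 0 (U 1 (R 0 i i' Φ)) w b a ≡
    (U 0 (U 1 Φ) w b a +ℤ U 0 (U 1 Φ) w (suc b) (x a)) +ℤ
    (U 0 (U 1 (U 0 Φ)) w b (y a) +ℤ ℤ- U 0 (U 1 (U 0 Φ)) w b (x a))
  U0U1R b a = trans (F-cong (U-linear 0 w) U1R b a) (F-R (U-linear 0 w) i i' (U 1 Φ) (U 1 (U 0 Φ)) b a)
  U²₁ : ∀ w b a → U 1 (U 1 Φ) w b a ≡ U 1 Φ w (suc b) a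
  U²₁ [] b a = refl
  U²₁ (z ∷ w) b a = U² w (λ v → Φ (z ∷ v)) b a
  D : Vec ℕ n → K
  D = H 0 i' (H 1 i Φ)
  D≡ : ∀ w b a → D w b a ≡ (Φ w b a +ℤ U 1 Φ w b (x a)) +ℤ (U 0 Φ w b (y a) +ℤ U 0 (U 1 Φ) w b (x (y a)))
  D≡ w b a = cong (H 1 i Φ w b a +ℤ_) (F-H (U-linear 0 w) i Φ (U 1 Φ) b (y a))
  U1D : ∀ b a → U 1 D w b a ≡ (U 1 Φ w b a +ℤ U 1 Φ w (suc b) (x a)) +ℤ
    (U 1 (U 0 Φ) w b (y a) +ℤ U 0 (U 1 (U 0 Φ)) w b (x (y a)))
  U1D b a = trans (F-+ (U-linear 1 w) (H 1 i Φ) (λ v b a → U 0 (H 1 i Φ) v b (y a)) b a)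
    (cong₂ _+ℤ_
      (trans (F-H (U-linear 1 w) i Φ (U 1 Φ) b a) (cong (U 1 Φ w b a +ℤ_) (U²₁ w b (x a))))
      (trans (F-x (U-linear 1 w) i' (U 0 (H 1 i Φ)) b a)
        (trans (F-cong (U-linear 1 w) (λ v b a → F-H (U-linear 0 v) i Φ (U 1 Φ) b a) b (y a))
          (trans (F-H (U-linear 1 w) i (U 0 Φ) (U 0 (U 1 Φ)) b (y a))
            (cong (U 1 (U 0 Φ) w b (y a) +ℤ_) (sym (U-braid w Φ b (x (y a)))))))))
  -- Each variable is named after its monomial: `b`, `x`, `y` stand for β, x_i, x_{i'}; `u1` and
  -- `u2` for `U 0` and `U 1`; `u21` and `u12` for their products, `t` for the braid word and `g`
  -- for the term without `U`.
  lem : ∀ g bxg yu1 xu1 yu2 bxyu2 yyu21 xyu21 bxxu1 bxyu1 xyu12 bxxyu12 xyyt xxyt xu2 bxxu2 →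
    (((g +ℤ bxg) +ℤ (yu1 +ℤ ℤ- xu1)) +ℤ ((yu2 +ℤ bxyu2) +ℤ (yyu21 +ℤ ℤ- xyu21))) +ℤ
    (((xu1 +ℤ bxxu1) +ℤ (bxyu1 +ℤ ℤ- bxxu1)) +ℤ ((xyu12 +ℤ bxxyu12) +ℤ (xyyt +ℤ ℤ- xxyt))) ≡
    ((((g +ℤ xu2) +ℤ (yu1 +ℤ xyu12)) +ℤ ((bxg +ℤ bxxu2) +ℤ (bxyu1 +ℤ bxxyu12))) +ℤ
     (((yu2 +ℤ bxyu2) +ℤ (yyu21 +ℤ xyyt)) +ℤ ℤ- ((xu2 +ℤ bxxu2) +ℤ (xyu21 +ℤ xxyt))))
  lem = ℤSolver.solve-∀
  g = Φ w b a
  N : ℤ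
  N = ((((g +ℤ U 1 Φ w b (x a)) +ℤ (U 0 Φ w b (y a) +ℤ U 0 (U 1 Φ) w b (x (y a)))) +ℤ
       ((Φ w (suc b) (x a) +ℤ U 1 Φ w (suc b) (x (x a))) +ℤ
        (U 0 Φ w (suc b) (x (y a)) +ℤ U 0 (U 1 Φ) w (suc b) (x (x (y a)))))) +ℤ
     (((U 1 Φ w b (y a) +ℤ U 1 Φ w (suc b) (x (y a))) +ℤ
       (U 1 (U 0 Φ) w b (y (y a)) +ℤ U 0 (U 1 (U 0 Φ)) w b (x (y (y a))))) +ℤ
      ℤ- ((U 1 Φ w b (x a) +ℤ U 1 Φ w (suc b) (x (x a))) +ℤ
          (U 1 (U 0 Φ) w b (x (y a)) +ℤ U 0 (U 1 (U 0 Φ)) w b (x (x (y a)))))))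
  yx : ∀ a → y (x a) ≡ x (y a)
  yx a = inc-comm i' i a
  rhs : R 1 i i' D w b a ≡ N
  rhs rewrite D≡ w b a | D≡ w (suc b) (x a) | U1D b (y a) | U1D b (x a) | yx a = refl
  lhs : H 0 i (H 1 i' (R 0 i i' Φ)) w b a ≡ N
  lhs rewrite U1R w b (y a) | F-H (U-linear 0 w) i' (R 0 i i' Φ) (U 1 (R 0 i i' Φ)) b (x a)
    | U0R b (x a) | U0U1R b (y (x a)) | yx a | yx (y a) =
      lem g (Φ w (suc b) (x a)) (U 0 Φ w b (y a)) (U 0 Φ w b (x a))
        (U 1 Φ w b (y a)) (U 1 Φ w (suc b) (x (y a)))
        (U 1 (U 0 Φ) w b (y (y a))) (U 1 (U 0 Φ) w b (x (y a)))
        (U 0 Φ w (suc b) (x (x a))) (U 0 Φ w (suc b) (x (y a)))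
        (U 0 (U 1 Φ) w b (x (y a))) (U 0 (U 1 Φ) w (suc b) (x (x (y a))))
        (U 0 (U 1 (U 0 Φ)) w b (x (y (y a)))) (U 0 (U 1 (U 0 Φ)) w b (x (x (y a))))
        (U 1 Φ w b (x a)) (U 1 Φ w (suc b) (x (x a)))

H-linear : ∀ {n} i (w : Vec ℕ n) → Linear (λ Φ → H 0 i Φ w)
H-linear i w = record
  { F-cong = λ e b a → cong₂ _+ℤ_ (e w b a) (F-cong L e b (inc i a))
  ; F-+ = λ Φ Ψ b a → trans (cong ((Φ w b a +ℤ Ψ w b a) +ℤ_) (F-+ L Φ Ψ b (inc i a)))
                        (lem (Φ w b a) (Ψ w b a) _ _)
  ; F-neg = λ Φ b a → trans (cong (ℤ- Φ w b a +ℤ_) (F-neg L Φ b (inc i a)))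
                        (sym (ℤₚ.neg-distrib-+ (Φ w b a) _))
  ; F-β = λ Φ b a → cong (Φ w (suc b) a +ℤ_) (F-β L Φ b (inc i a))
  ; F-x = λ j Φ b a → cong (Φ w b (inc j a) +ℤ_)
            (trans (F-x L j Φ b (inc i a)) (cong (U 0 Φ w b) (inc-comm j i a)))
  }
  where
  L = U-linear 0 w
  lem : ∀ p q r s → (p +ℤ q) +ℤ (r +ℤ s) ≡ (p +ℤ r) +ℤ (q +ℤ s)
  lem = ℤSolver.solve-∀

-- Φ gets the label leaving the row on the left, followed by the bottom labels.
rowSum : ∀ n → ℕ → Vec ℕ (suc n) → (Vec ℕ (suc n) → K) → K
rowSum zero    i ts       Φ = Φ ts
rowSum (suc n) i (t ∷ ts) Φ = rowSum n i ts (λ w → H 0 i Φ (t ∷ w))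

tailSum : ∀ {n} {J : Set} → (Vec ℕ n → (J → K) → K) → (ℕ → J → K) → Vec ℕ (suc n) → K
tailSum F Φ (h ∷ us) = F us (Φ h)

runSum : ∀ {n} → Vec ℕ n → Vec ℕ n → (Vec ℕ n → K) → K
runSum []       ts Φ = Φ []
runSum (i ∷ is) ts Φ = rowSum _ i ts (tailSum (runSum is) (λ h v → Φ (h ∷ v)))

reindex : ∀ {I J : Set} {F : (I → K) → K} (g : (J → K) → I → K) →
  Linear F → (∀ i → Linear (λ Φ → g Φ i)) → Linear (λ Φ → F (g Φ))
reindex {F = F} g L M = record
  { F-cong = λ e → F-cong L (λ i → F-cong (M i) e)
  ; F-+ = λ Φ Ψ b a → trans (F-cong L (λ i → F-+ (M i) Φ Ψ) b a) (F-+ L (g Φ) (g Ψ) b a)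
  ; F-neg = λ Φ b a → trans (F-cong L (λ i → F-neg (M i) Φ) b a) (F-neg L (g Φ) b a)
  ; F-β = λ Φ b a → trans (F-cong L (λ i → F-β (M i) Φ) b a) (F-β L (g Φ) b a)
  ; F-x = λ j Φ b a → trans (F-cong L (λ i → F-x (M i) j Φ) b a) (F-x L j (g Φ) b a)
  }

eval-linear : ∀ {J : Set} (j : J) → Linear (λ (Φ : J → K) → Φ j)
eval-linear j = record
  { F-cong = λ e → e j ; F-+ = λ _ _ _ _ → refl ; F-neg = λ _ _ _ → refl
  ; F-β = λ _ _ _ → refl ; F-x = λ _ _ _ _ → refl }

rowSum-linear : ∀ n i (ts : Vec ℕ (suc n)) → Linear (rowSum n i ts)
rowSum-linear zero    i ts       = eval-linear ts
rowSum-linear (suc n) i (t ∷ ts) =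
  reindex (λ Φ w → H 0 i Φ (t ∷ w)) (rowSum-linear n i ts) (λ w → H-linear i (t ∷ w))

restrict : ∀ {I J : Set} (f : I → J) {F : (I → K) → K} →
  Linear F → Linear (λ Φ → F (λ i → Φ (f i)))
restrict f L = reindex (λ Φ i → Φ (f i)) L (λ i → eval-linear (f i))

runSum-linear : ∀ {n} (is ts : Vec ℕ n) → Linear (runSum is ts)
runSum-linear []       []       = eval-linear []
runSum-linear (i ∷ is) ts = reindex (λ Φ → tailSum (runSum is) (λ h v → Φ (h ∷ v)))
  (rowSum-linear _ i ts) (λ { (h ∷ us) → restrict (h ∷_) (runSum-linear is us) })

twoRows : ∀ n → ℕ → ℕ → Vec ℕ (suc (suc n)) → (Vec ℕ (suc (suc n)) → K) → K
twoRows n i i' ts Φ = rowSum (suc n) i ts (tailSum (rowSum n i') (λ h v → Φ (h ∷ v)))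

-- Peels off the leftmost column of two rows. Its upper tile acts on the first two labels only, so
-- it moves past all of the second row to the right of that column and comes to stand next to its
-- lower tile.
twoRows-suc : ∀ n i i' t (ts : Vec ℕ (suc (suc n))) Φ b a →
  twoRows (suc n) i i' (t ∷ ts) Φ b a ≡ twoRows n i i' ts (λ w → H 0 i (H 1 i' Φ) (t ∷ w)) b a
twoRows-suc n i i' t ts Φ b a = F-cong (rowSum-linear (suc n) i ts) pull b a
  where
  S : Vec ℕ (suc (suc (suc n))) → K
  S = tailSum (rowSum (suc n) i') (λ h v → Φ (h ∷ v))
  U-pull : ∀ h us b a → U 0 S (t ∷ h ∷ us) b a ≡ rowSum n i' us (λ v → U 0 (H 1 i' Φ) (t ∷ h ∷ v)) b a
  U-pull h us b a with t <ᵇ h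
  ... | true = refl
  ... | false = sym (F-β (rowSum-linear n i' us) (λ v → H 1 i' Φ (t ∷ h ∷ v)) b a)
  pull : ∀ w b a → H 0 i S (t ∷ w) b a ≡
    tailSum (rowSum n i') (λ h v → H 0 i (H 1 i' Φ) (t ∷ h ∷ v)) w b a
  pull (h ∷ us) b a = trans
    (cong (rowSum n i' us (λ v → H 1 i' Φ (t ∷ h ∷ v)) b a +ℤ_) (U-pull h us b (inc i a)))
    (sym (F-H (rowSum-linear n i' us) i (λ v → H 1 i' Φ (t ∷ h ∷ v)) (λ v → U 0 (H 1 i' Φ) (t ∷ h ∷ v)) b a))

twoRows-linear : ∀ n i i' ts → Linear (twoRows n i i' ts)
twoRows-linear n i i' ts = reindex (λ Φ → tailSum (rowSum n i') (λ h v → Φ (h ∷ v)))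
  (rowSum-linear (suc n) i ts) (λ { (h ∷ us) → restrict (h ∷_) (rowSum-linear n i' us) })

-- The train argument: `R` enters at the left edge and moves right, one column at a time. Each
-- `yang-baxter` exchanges the variables of the two tiles of a column; the rightmost column has a
-- single free tile, which absorbs `R` by `H-R`.
twoRows-R : ∀ n i i' ts Φ b a → twoRows n i i' ts (R 0 i i' Φ) b a ≡
  twoRows n i' i ts Φ b a +ℤ twoRows n i' i ts Φ (suc b) (inc i a)
twoRows-R zero i i' (s ∷ t ∷ []) Φ b a = H-R i i' Φ (s ∷ t ∷ []) b a
twoRows-R (suc n) i i' (t ∷ ts) Φ b a = begin
  twoRows (suc n) i i' (t ∷ ts) (R 0 i i' Φ) b a
    ≡⟨ twoRows-suc n i i' t ts (R 0 i i' Φ) b a ⟩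
  twoRows n i i' ts (λ w → H 0 i (H 1 i' (R 0 i i' Φ)) (t ∷ w)) b a
    ≡⟨ F-cong (twoRows-linear n i i' ts) (λ w → yang-baxter i i' Φ (t ∷ w)) b a ⟩
  -- On words that begin with `t`, `R 1` is `R 0` on the rest, so the induction hypothesis applies.
  twoRows n i i' ts (R 0 i i' (λ w → H 0 i' (H 1 i Φ) (t ∷ w))) b a
    ≡⟨ twoRows-R n i i' ts (λ w → H 0 i' (H 1 i Φ) (t ∷ w)) b a ⟩
  _ ≡⟨ sym (cong₂ _+ℤ_ (twoRows-suc n i' i t ts Φ b a) (twoRows-suc n i' i t ts Φ (suc b) (inc i a))) ⟩
  twoRows (suc n) i' i (t ∷ ts) Φ b a +ℤ twoRows (suc n) i' i (t ∷ ts) Φ (suc b) (inc i a) ∎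
  where open ≡-Reasoning

data Adjacent : ∀ {n} → ℕ → ℕ → ℕ → Vec ℕ n → Vec ℕ n → Set where
  here  : ∀ {n i i'} {is : Vec ℕ n} → Adjacent 0 i i' (i ∷ i' ∷ is) (i' ∷ i ∷ is)
  there : ∀ {n p i i' j} {is is' : Vec ℕ n} → Adjacent p i i' is is' → Adjacent (suc p) i i' (j ∷ is) (j ∷ is')

belowTwo : ∀ {n} → Vec ℕ n → (Vec ℕ (suc (suc n)) → K) → Vec ℕ (suc (suc n)) → K
belowTwo is Φ (h ∷ h' ∷ us) = runSum is us (λ v → Φ (h ∷ h' ∷ v))

runSum-two : ∀ {n} i i' (is : Vec ℕ n) ts Φ b a →
  runSum (i ∷ i' ∷ is) ts Φ b a ≡ twoRows n i i' ts (belowTwo is Φ) b a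
runSum-two i i' is ts Φ = F-cong (rowSum-linear _ i ts)
  (λ { (h ∷ us) → F-cong (rowSum-linear _ i' us) (λ { (h' ∷ us') b a → refl }) })

-- For the generating function G this says (1 + β x) G(y , x) = G(x , y) R.
runSum-R : ∀ {n p i i'} {is is' : Vec ℕ n} → Adjacent p i i' is is' → ∀ ts Φ b a →
  runSum is ts (R p i i' Φ) b a ≡ runSum is' ts Φ b a +ℤ runSum is' ts Φ (suc b) (inc i a)
runSum-R {i = i} {i'} (here {n} {is = is}) ts Φ b a = begin
  runSum (i ∷ i' ∷ is) ts (R 0 i i' Φ) b a
    ≡⟨ runSum-two i i' is ts (R 0 i i' Φ) b a ⟩
  twoRows n i i' ts (G (R 0 i i' Φ)) b a
    ≡⟨ F-cong (twoRows-linear n i i' ts) G-R b a ⟩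
  twoRows n i i' ts (R 0 i i' (G Φ)) b a
    ≡⟨ twoRows-R n i i' ts (G Φ) b a ⟩
  twoRows n i' i ts (G Φ) b a +ℤ twoRows n i' i ts (G Φ) (suc b) (inc i a)
    ≡⟨ sym (cong₂ _+ℤ_ (runSum-two i' i is ts Φ b a) (runSum-two i' i is ts Φ (suc b) (inc i a))) ⟩
  runSum (i' ∷ i ∷ is) ts Φ b a +ℤ runSum (i' ∷ i ∷ is) ts Φ (suc b) (inc i a) ∎
  where
  open ≡-Reasoning
  G : (Vec ℕ (suc (suc n)) → K) → Vec ℕ (suc (suc n)) → K
  G = belowTwo is
  U-G : ∀ h h' us b a → runSum is us (λ v → U 0 Φ (h ∷ h' ∷ v)) b a ≡ U 0 (G Φ) (h ∷ h' ∷ us) b a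
  U-G h h' us b a with h <ᵇ h'
  ... | true = refl
  ... | false = F-β (runSum-linear is us) (λ v → Φ (h ∷ h' ∷ v)) b a
  G-R : ∀ w b a → G (R 0 i i' Φ) w b a ≡ R 0 i i' (G Φ) w b a
  G-R (h ∷ h' ∷ us) b a = trans
    (F-R (runSum-linear is us) i i' (λ v → Φ (h ∷ h' ∷ v)) (λ v → U 0 Φ (h ∷ h' ∷ v)) b a)
    (cong₂ (λ p q → (G Φ (h ∷ h' ∷ us) b a +ℤ G Φ (h ∷ h' ∷ us) (suc b) (inc i a)) +ℤ (p +ℤ ℤ- q)) (U-G h h' us b (inc i' a)) (U-G h h' us b (inc i a)))
runSum-R {p = suc p} {i} {i'} (there {n} {j = j} {is} {is'} adj) ts Φ b a = begin
  runSum (j ∷ is) ts (R (suc p) i i' Φ) b a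
    ≡⟨ F-cong (rowSum-linear _ j ts) step b a ⟩
  rowSum n j ts (λ w b a → S w b a +ℤ S w (suc b) (inc i a)) b a
    ≡⟨ trans (F-+ L S (λ w b a → S w (suc b) (inc i a)) b a)
         (cong (rowSum n j ts S b a +ℤ_) (F-βx L i S b a)) ⟩
  runSum (j ∷ is') ts Φ b a +ℤ runSum (j ∷ is') ts Φ (suc b) (inc i a) ∎
  where
  open ≡-Reasoning
  L = rowSum-linear n j ts
  S : Vec ℕ (suc n) → K
  S = tailSum (runSum is') (λ h v → Φ (h ∷ v))
  step : ∀ w b a → tailSum (runSum is) (λ h v → R (suc p) i i' Φ (h ∷ v)) w b a ≡ S w b a +ℤ S w (suc b) (inc i a)
  step (h ∷ us) = runSum-R adj us (λ v → Φ (h ∷ v))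

-- Changing variables

record Transport (β : ℕ → ℕ) (γ : List ℕ → List ℕ) (i' i : ℕ) : Set where
  field
    γ-inc : ∀ a → γ (inc i' a) ≡ inc i (γ a)
    β-suc : ∀ b → β (suc b) ≡ suc (β b)
open Transport

-- The sum moves the exponents only through `suc` on β and `inc` on x, so a map of monomials that
-- turns one variable into another passes through it. It is applied to the exchange of two
-- exponents, to padding, and to prefixing an exponent.
rowSum-transport : ∀ {β γ i' i} → Transport β γ i' i → ∀ n ts Φ b a →
  rowSum n i' ts (λ w b a → Φ w (β b) (γ a)) b a ≡ rowSum n i ts Φ (β b) (γ a)
rowSum-transport tr zero ts Φ b a = refl
rowSum-transport {β} {γ} {i'} {i} tr (suc n) (t ∷ ts) Φ b a =
  trans (F-cong (rowSum-linear n i' ts) step b a)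
    (rowSum-transport tr n ts (λ w → H 0 i Φ (t ∷ w)) b a)
  where
  step : ∀ w b a → H 0 i' (λ w b a → Φ w (β b) (γ a)) (t ∷ w) b a ≡ H 0 i Φ (t ∷ w) (β b) (γ a)
  step (h ∷ w) b a rewrite γ-inc tr a | β-suc tr b = refl

data Transports (β : ℕ → ℕ) (γ : List ℕ → List ℕ) : ∀ {n} → Vec ℕ n → Vec ℕ n → Set where
  []  : Transports β γ [] []
  _∷_ : ∀ {n i' i} {is' is : Vec ℕ n} → Transport β γ i' i → Transports β γ is' is →
        Transports β γ (i' ∷ is') (i ∷ is)

runSum-transport : ∀ {β γ n} {is' is : Vec ℕ n} → Transports β γ is' is → ∀ ts Φ b a →
  runSum is' ts (λ w b a → Φ w (β b) (γ a)) b a ≡ runSum is ts Φ (β b) (γ a)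
runSum-transport [] ts Φ b a = refl
runSum-transport {β} {γ} (_∷_ {n} {i'} {i} {is'} {is} tr trs) ts Φ b a =
  trans (F-cong (rowSum-linear n i' ts) step b a) (rowSum-transport tr n ts S b a)
  where
  S : Vec ℕ (suc n) → K
  S = tailSum (runSum is) (λ h v → Φ (h ∷ v))
  step : ∀ w b a → tailSum (runSum is') (λ h v b a → Φ (h ∷ v) (β b) (γ a)) w b a ≡ S w (β b) (γ a)
  step (h ∷ us) = runSum-transport trs us (λ v → Φ (h ∷ v))

n≢1+n : ∀ {n} → n ≢ suc n
n≢1+n ()

setPQ-at₁ : ∀ a q u v → at (setPQ a (suc q) u v) q ≡ u
setPQ-at₁ a q u v = trans (at-setAt-≢ (setAt a q u) (suc q) q v (λ e → n≢1+n (sym e))) (at-setAt a q u)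

setPQ-at₂ : ∀ a q u v → at (setPQ a (suc q) u v) (suc q) ≡ v
setPQ-at₂ a q u v = at-setAt (setAt a q u) (suc q) v

setPQ-at : ∀ a q u v j → j ≢ q → j ≢ suc q → at (setPQ a (suc q) u v) j ≡ at a j
setPQ-at a q u v j j≢q j≢q' = trans
  (at-setAt-≢ (setAt a q u) (suc q) j v (λ e → j≢q' (sym e))) (at-setAt-≢ a q j u (λ e → j≢q (sym e)))

setPQ-set₁ : ∀ a q x u v → setPQ (setAt a q x) (suc q) u v ≡ setPQ a (suc q) u v
setPQ-set₁ a q x u v = cong (λ z → setAt z (suc q) v) (setAt-setAt a q x u)

setPQ-set₂ : ∀ a q x u v → setPQ (setAt a (suc q) x) (suc q) u v ≡ setPQ a (suc q) u v
setPQ-set₂ a q x u v = trans (cong (λ z → setAt z (suc q) v) (setAt-comm a (suc q) q x u (λ e → n≢1+n (sym e))))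
  (setAt-setAt (setAt a q u) (suc q) x v)

setPQ-set : ∀ a q j x u v → j ≢ q → j ≢ suc q →
  setPQ (setAt a j x) (suc q) u v ≡ setAt (setPQ a (suc q) u v) j x
setPQ-set a q j x u v j≢q j≢q' = trans (cong (λ z → setAt z (suc q) v) (setAt-comm a j q x u j≢q))
  (setAt-comm (setAt a q u) j (suc q) x v j≢q')

set₁-setPQ : ∀ a q x u v → setAt (setPQ a (suc q) u v) q x ≡ setPQ a (suc q) x v
set₁-setPQ a q x u v = trans (setAt-comm (setAt a q u) (suc q) q v x (λ e → n≢1+n (sym e)))
  (cong (λ z → setAt z (suc q) v) (setAt-setAt a q u x))

set₂-setPQ : ∀ a q x u v → setAt (setPQ a (suc q) u v) (suc q) x ≡ setPQ a (suc q) u x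
set₂-setPQ a q x u v = setAt-setAt (setAt a q u) (suc q) v x

setPQ-setPQ : ∀ a q x y u v → setPQ (setPQ a (suc q) x y) (suc q) u v ≡ setPQ a (suc q) u v
setPQ-setPQ a q x y u v = trans (setPQ-set₂ (setAt a q x) q y u v) (setPQ-set₁ a q x u v)

inc₁-setPQ : ∀ a q u v → inc q (setPQ a (suc q) u v) ≡ setPQ a (suc q) (suc u) v
inc₁-setPQ a q u v rewrite setPQ-at₁ a q u v = set₁-setPQ a q (suc u) u v

inc₂-setPQ : ∀ a q u v → inc (suc q) (setPQ a (suc q) u v) ≡ setPQ a (suc q) u (suc v)
inc₂-setPQ a q u v rewrite setPQ-at₂ a q u v = set₂-setPQ a q (suc v) u v

inc-setPQ : ∀ a q j u v → j ≢ q → j ≢ suc q → inc j (setPQ a (suc q) u v) ≡ setPQ (inc j a) (suc q) u v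
inc-setPQ a q j u v j≢q j≢q' rewrite setPQ-at a q u v j j≢q j≢q' = sym (setPQ-set a q j _ u v j≢q j≢q')

at-inc₁ : ∀ a q → at (inc q a) q ≡ suc (at a q)
at-inc₁ a q = at-setAt a q _

at-inc : ∀ a j q → j ≢ q → at (inc j a) q ≡ at a q
at-inc a j q j≢q = at-setAt-≢ a j q _ j≢q

-- `normPQ` writes back the exponents that are already there. It appears because `setAt` extends a
-- short list, so that the result can differ from `a` by padding with zeros.
swapPQ normPQ : ℕ → List ℕ → List ℕ
swapPQ q a = setPQ a (suc q) (at a (suc q)) (at a q)
normPQ q a = setPQ a (suc q) (at a q) (at a (suc q))

swap-other : ∀ q j → j ≢ q → j ≢ suc q → Transport id (swapPQ q) j j
swap-other q j j≢q j≢q' = record { β-suc = λ _ → refl ; γ-inc = λ a →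
  trans (cong₂ (setPQ (inc j a) (suc q)) (at-inc a j (suc q) j≢q') (at-inc a j q j≢q))
    (sym (inc-setPQ a q j _ _ j≢q j≢q')) }

swap-fst : ∀ q → Transport id (swapPQ q) q (suc q)
swap-fst q = record { β-suc = λ _ → refl ; γ-inc = λ a →
  trans (cong₂ (setPQ (inc q a) (suc q)) (at-inc a q (suc q) n≢1+n) (at-inc₁ a q))
    (trans (setPQ-set₁ a q _ _ _) (sym (inc₂-setPQ a q _ _))) }

swap-snd : ∀ q → Transport id (swapPQ q) (suc q) q
swap-snd q = record { β-suc = λ _ → refl ; γ-inc = λ a →
  trans (cong₂ (setPQ (inc (suc q) a) (suc q)) (at-inc₁ a (suc q)) (at-inc a (suc q) q (λ e → n≢1+n (sym e))))
    (trans (setPQ-set₂ a q _ _ _) (sym (inc₁-setPQ a q _ _))) }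

normal : ∀ q j → Transport id (normPQ q) j j
normal q j with j ≟ q | j ≟ suc q
... | yes refl | _ = record { β-suc = λ _ → refl ; γ-inc = λ a →
  trans (cong₂ (setPQ (inc q a) (suc q)) (at-inc₁ a q) (at-inc a q (suc q) n≢1+n))
    (trans (setPQ-set₁ a q _ _ _) (sym (inc₁-setPQ a q _ _))) }
... | no _ | yes refl = record { β-suc = λ _ → refl ; γ-inc = λ a →
  trans (cong₂ (setPQ (inc (suc q) a) (suc q)) (at-inc a (suc q) q (λ e → n≢1+n (sym e))) (at-inc₁ a (suc q)))
    (trans (setPQ-set₂ a q _ _ _) (sym (inc₂-setPQ a q _ _))) }
... | no j≢q | no j≢q' = record { β-suc = λ _ → refl ; γ-inc = λ a →
  trans (cong₂ (setPQ (inc j a) (suc q)) (at-inc a j q j≢q) (at-inc a j (suc q) j≢q'))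
    (sym (inc-setPQ a q j _ _ j≢q j≢q')) }

normals : ∀ q {n} (is : Vec ℕ n) → Transports id (normPQ q) is is
normals q []       = []
normals q (j ∷ is) = normal q j ∷ normals q is

swaps-above : ∀ q a n → suc q < a → Transports id (swapPQ q) (rangeV a n) (rangeV a n)
swaps-above q a zero    q<a = []
swaps-above q a (suc n) q<a =
  swap-other q a (λ { refl → <-irrefl refl (<-trans (n<1+n _) q<a) }) (λ { refl → <-irrefl refl q<a })
  ∷ swaps-above q (suc a) n (<-trans q<a (n<1+n a))

swapped-range : ∀ a p q n → a + p ≡ q → suc p < n → Σ[ is' ∈ Vec ℕ n ]
  Adjacent p q (suc q) (rangeV a n) is' × Transports id (swapPQ q) (rangeV a n) is'
swapped-range a zero q (suc (suc n)) e p<n rewrite +-identityʳ a | e =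
  _ , here , swap-fst q ∷ swap-snd q ∷ swaps-above q (suc (suc q)) n ≤-refl
swapped-range a zero q (suc zero) e (s≤s ())
swapped-range a (suc p) q (suc n) e (s≤s p<n) with swapped-range (suc a) p q n (trans (sym (+-suc a p)) e) p<n
... | is' , adj , trs = a ∷ is' , there adj ,
  swap-other q a (λ e' → <⇒≢ a<q e') (λ e' → <⇒≢ (<-trans a<q (n<1+n q)) e') ∷ trs
  where
  a<q : a < q
  a<q = subst (a <_) e (subst (a <_) (sym (+-suc a p)) (s≤s (m≤m+n a p)))

-- The coefficient of a single word

ind : ∀ {n} → List ℕ → K → Vec ℕ n → K
ind w φ v b a = if listEqᵇ (toList v) w then φ b a else ℤ+ 0

data Ascent : ℕ → List ℕ → Set where
  here  : ∀ {x y r} → x < y → Ascent 0 (x ∷ y ∷ r)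
  there : ∀ {p x r} → Ascent p r → Ascent (suc p) (x ∷ r)

U-zero : ∀ {n} p (v : Vec ℕ n) b a → U p (λ _ _ _ → ℤ+ 0) v b a ≡ ℤ+ 0
U-zero zero    []          b a = refl
U-zero zero    (x ∷ [])    b a = refl
U-zero zero    (x ∷ y ∷ v) b a with x <ᵇ y
... | true = refl
... | false = refl
U-zero (suc p) []      b a = refl
U-zero (suc p) (x ∷ v) b a = U-zero p v b a

listEqᵇ-sound : ∀ u w → listEqᵇ u w ≡ true → u ≡ w
listEqᵇ-sound []      []      e = refl
listEqᵇ-sound (x ∷ u) (y ∷ w) e with x ≡ᵇ y in eq
... | true = cong₂ _∷_ (≡ᵇ⇒≡ x y (subst T (sym eq) _)) (listEqᵇ-sound u w e)

listEqᵇ-refl : ∀ u → listEqᵇ u u ≡ true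
listEqᵇ-refl []      = refl
listEqᵇ-refl (x ∷ u) with x ≡ᵇ x | ≡⇒≡ᵇ x x refl
... | true | _ = listEqᵇ-refl u

listEqᵇ-≢ : ∀ {u w} → u ≢ w → listEqᵇ u w ≡ false
listEqᵇ-≢ {u} {w} u≢w with listEqᵇ u w in eq
... | true  = ⊥-elim (u≢w (listEqᵇ-sound u w eq))
... | false = refl

listEqᵇ-swap : ∀ h h' v x y r → listEqᵇ (h' ∷ h ∷ v) (y ∷ x ∷ r) ≡ listEqᵇ (h ∷ h' ∷ v) (x ∷ y ∷ r)
listEqᵇ-swap h h' v x y r with h' ≡ᵇ y | h ≡ᵇ x
... | true  | true  = refl
... | true  | false = refl
... | false | true  = refl
... | false | false = refl

-- Coefficient extraction at the word with a descent at `p`. It is reached from itself, where u_p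
-- acts as β and the terms in β x_i cancel, and from `w'`, where u_p turns the ascent into the
-- descent.
ind-R : ∀ {n p w'} i i' → Ascent p w' → ∀ φ (v : Vec ℕ n) b a →
  R p i i' (ind (swap0 p w') φ) v b a ≡
  ind (swap0 p w') (λ b a → φ b a +ℤ φ (suc b) (inc i' a)) v b a +ℤ
  ind w' (λ b a → φ b (inc i' a) +ℤ ℤ- φ b (inc i a)) v b a
ind-R i i' (here x<y) φ [] b a = refl
ind-R i i' (here {x} {y} x<y) φ (h ∷ []) b a with h ≡ᵇ x | h ≡ᵇ y
... | true  | true  = refl
... | true  | false = refl
... | false | true  = refl
... | false | false = refl
ind-R i i' (here {x} {y} {r} x<y) φ (h ∷ h' ∷ v) b a with h <? h'
... | yes h<h'
  rewrite <ᵇ-true h<h'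
        | listEqᵇ-≢ {h ∷ h' ∷ toList v} {y ∷ x ∷ r} (λ { refl → <-asym x<y h<h' })
        | listEqᵇ-swap h h' (toList v) x y r
  with listEqᵇ (h ∷ h' ∷ toList v) (x ∷ y ∷ r)
...   | true  = refl
...   | false = refl
ind-R i i' (here {x} {y} {r} x<y) φ (h ∷ h' ∷ v) b a | no h≮h'
  rewrite <ᵇ-false h≮h'
        | listEqᵇ-≢ {h ∷ h' ∷ toList v} {x ∷ y ∷ r} (λ { refl → h≮h' x<y })
  with listEqᵇ (h ∷ h' ∷ toList v) (y ∷ x ∷ r)
...   | true  = lem (φ b a) (φ (suc b) (inc i a)) (φ (suc b) (inc i' a))
  where
  lem : ∀ p q r → (p +ℤ q) +ℤ (r +ℤ ℤ- q) ≡ (p +ℤ r) +ℤ ℤ+ 0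
  lem = ℤSolver.solve-∀
...   | false = refl
ind-R i i' (there {p} {x} {r} asc) φ [] b a = refl
ind-R i i' (there {p} {x} {r} asc) φ (h ∷ v) b a with h ≡ᵇ x
... | true  = ind-R i i' asc φ v b a
... | false rewrite U-zero p v b (inc i a) | U-zero p v b (inc i' a) = refl

private
  ind-linear : ∀ {n} (w : List ℕ) (v : Vec ℕ n) → Linear {⊤} (λ φ → ind w (φ tt) v)
  ind-linear w v with listEqᵇ (toList v) w
  ... | true  = eval-linear tt
  ... | false = record
    { F-cong = λ _ _ _ → refl ; F-+ = λ _ _ _ _ → refl ; F-neg = λ _ _ _ → refl
    ; F-β = λ _ _ _ → refl ; F-x = λ _ _ _ _ → refl }

module _ {n : ℕ} (ts : Vec ℕ n) where

  -- The coefficient of `w` in the product of all tiles, in dual form: `Z w φ b a` is the pairing of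
  -- `φ` with this coefficient times β^b x^a. `pair-groth` identifies it with G_w when the tops are
  -- 1, ..., n.
  Z : List ℕ → K → K
  Z w φ = runSum (rangeV 0 n) ts (ind w φ)

  Z-linear : ∀ w → Linear {⊤} (λ φ → Z w (φ tt))
  Z-linear w = reindex (λ φ → ind w (φ tt)) (runSum-linear (rangeV 0 n) ts) (ind-linear w)

  Z-invariant : ∀ w φ γ → Transports id γ (rangeV 0 n) (rangeV 0 n) → ∀ b a →
    Z w (λ b a → φ b (γ a)) b a ≡ Z w φ b (γ a)
  Z-invariant w φ γ trs b a = trans (F-cong (runSum-linear (rangeV 0 n) ts) (λ v b a → lem v b a) b a)
    (runSum-transport trs ts (ind w φ) b a)
    where
    lem : ∀ v b a → ind w (λ b a → φ b (γ a)) v b a ≡ ind w φ v b (γ a)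
    lem v b a with listEqᵇ (toList v) w
    ... | true  = refl
    ... | false = refl

  Zβ : List ℕ → ℕ → K → K
  Zβ w p φ = Z w (λ b a → φ b a +ℤ φ (suc b) (inc (suc p) a))

  -- The sum with `R` inserted is evaluated twice. By `ind-R` it is (1 + β x_{p+1}) G_w + (x_{p+1} -
  -- x_p) G_{w'}, where w = `swap0 p w'`; by `runSum-R` it is 1 + β x_p times G_w with its variables
  -- exchanged, that is s_p applied to (1 + β x_{p+1}) G_w. Variables are counted from 0 here.
  Z-exchange : ∀ {p w'} → Ascent p w' → suc p < n → ∀ φ b a → swapPQ p a ≡ a →
    Zβ (swap0 p w') p φ b a +ℤ Z w' (λ b a → φ b (inc (suc p) a) +ℤ ℤ- φ b (inc p a)) b a ≡
    Zβ (swap0 p w') p (λ b a → φ b (swapPQ p a)) b a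
  Z-exchange {p} {w'} asc p<n φ b a inv with swapped-range 0 p p n refl p<n
  ... | is' , adj , trs = begin
    _ ≡⟨ sym (F-+ L (ind w (λ b a → φ b a +ℤ φ (suc b) (inc (suc p) a)))
                     (ind w' (λ b a → φ b (inc (suc p) a) +ℤ ℤ- φ b (inc p a))) b a) ⟩
    _ ≡⟨ F-cong L (λ v b a → sym (ind-R p (suc p) asc φ v b a)) b a ⟩
    runSum (rangeV 0 n) ts (R p p (suc p) (ind w φ)) b a
      ≡⟨ runSum-R adj ts (ind w φ) b a ⟩
    runSum is' ts (ind w φ) b a +ℤ runSum is' ts (ind w φ) (suc b) (inc p a)
      ≡⟨ sym (trans (F-+ L' (ind w φ) (λ v b a → ind w φ v (suc b) (inc p a)) b a)
           (cong (runSum is' ts (ind w φ) b a +ℤ_) (F-βx L' p (ind w φ) b a))) ⟩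
    runSum is' ts (λ v b a → Φ v b a) b a
      -- The exchange of variables acts on the whole monomial, including the starting one, which
      -- therefore has to be symmetric.
      ≡⟨ cong (runSum is' ts Φ b) (sym inv) ⟩
    runSum is' ts Φ b (swapPQ p a)
      ≡⟨ sym (runSum-transport trs ts Φ b a) ⟩
    _ ≡⟨ F-cong L final b a ⟩
    Zβ w p (λ b a → φ b (swapPQ p a)) b a ∎
    where
    open ≡-Reasoning
    w = swap0 p w'
    L = runSum-linear (rangeV 0 n) ts
    L' = runSum-linear is' ts
    Φ : Vec ℕ n → K
    Φ v b a = ind w φ v b a +ℤ ind w φ v (suc b) (inc p a)
    final : ∀ v b a → Φ v b (swapPQ p a) ≡
      ind w (λ b a → φ b (swapPQ p a) +ℤ φ (suc b) (swapPQ p (inc (suc p) a))) v b a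
    final v b a with listEqᵇ (toList v) w
    ... | true  = cong (λ z → φ b (swapPQ p a) +ℤ φ (suc b) z) (sym (γ-inc (swap-snd p) a))
    ... | false = refl

-- Divided differences in dual form

pair : Poly → K → ℤ
pair []               φ = ℤ+ 0
pair (term c b a ∷ P) φ = c *ℤ φ b a +ℤ pair P φ

pair-++ : ∀ P Q φ → pair (P ++ Q) φ ≡ pair P φ +ℤ pair Q φ
pair-++ []               Q φ = sym (ℤₚ.+-identityˡ _)
pair-++ (term c b a ∷ P) Q φ = trans (cong (c *ℤ φ b a +ℤ_) (pair-++ P Q φ)) (sym (ℤₚ.+-assoc (c *ℤ φ b a) _ _))

pair-+ : ∀ P φ φ' → pair P (λ b a → φ b a +ℤ φ' b a) ≡ pair P φ +ℤ pair P φ'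
pair-+ []               φ φ' = refl
pair-+ (term c b a ∷ P) φ φ' = trans (cong (c *ℤ (φ b a +ℤ φ' b a) +ℤ_) (pair-+ P φ φ'))
  (lem c (φ b a) (φ' b a) (pair P φ) (pair P φ'))
  where
  lem : ∀ c x y p q → c *ℤ (x +ℤ y) +ℤ (p +ℤ q) ≡ (c *ℤ x +ℤ p) +ℤ (c *ℤ y +ℤ q)
  lem = ℤSolver.solve-∀

pair-mulβx : ∀ p P φ → pair (map (mulβx (suc p)) P) φ ≡ pair P (λ b a → φ (suc b) (inc p a))
pair-mulβx p []               φ = refl
pair-mulβx p (term c b a ∷ P) φ = cong (c *ℤ φ (suc b) (inc p a) +ℤ_) (pair-mulβx p P φ)

-- Adjoint of multiplication by x_i − x_{i+1}, solved for: the recursion says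
-- antidiff (p+1 , q) − antidiff (p , q+1) = f (p , q).
antidiff : (ℕ → ℕ → ℤ) → ℕ → ℕ → ℤ
antidiff f zero    q = ℤ+ 0
antidiff f (suc p) q = f p q +ℤ antidiff f p (suc q)

sumRange-snoc : ∀ (f : ℕ → ℤ) a d →
  sumℤ (map f (range a (suc d))) ≡ sumℤ (map f (range a d)) +ℤ f (a + d)
sumRange-snoc f a zero    = trans (ℤₚ.+-comm (f a) (ℤ+ 0)) (cong (λ z → ℤ+ 0 +ℤ f z) (sym (+-identityʳ a)))
sumRange-snoc f a (suc d) = trans (cong (f a +ℤ_) (sumRange-snoc f (suc a) d))
  (trans (sym (ℤₚ.+-assoc (f a) _ _)) (cong (λ z → (f a +ℤ sumℤ (map f (range (suc a) d))) +ℤ f z) (sym (+-suc a d))))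

sum-cong : ∀ {A : Set} (f g : A → ℤ) xs → (∀ x → f x ≡ g x) → sumℤ (map f xs) ≡ sumℤ (map g xs)
sum-cong f g []       e = refl
sum-cong f g (x ∷ xs) e = cong₂ _+ℤ_ (e x) (sum-cong f g xs e)

-- The recursion is unrolled `d` times. `r` is kept apart from `q` because each step raises it;
-- `antidiff-diff` takes both equal. The unrolling produces the terms of `∂Term` in reverse order,
-- hence `sumRange-snoc`.
antidiff-sum : ∀ f q r d →
  antidiff f (q + d) r ≡ sumℤ (map (λ t → f (q + t) (r + d ∸ 1 ∸ t)) (range 0 d)) +ℤ antidiff f q (r + d)
antidiff-sum f q r zero rewrite +-identityʳ q | +-identityʳ r = sym (ℤₚ.+-identityˡ _)
antidiff-sum f q r (suc d) rewrite +-suc q d | +-suc r d = begin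
  f (q + d) r +ℤ antidiff f (q + d) (suc r)
    ≡⟨ cong (f (q + d) r +ℤ_) (antidiff-sum f q (suc r) d) ⟩
  f (q + d) r +ℤ (Σd +ℤ antidiff f q (suc (r + d)))
    ≡⟨ lem (f (q + d) r) Σd _ ⟩
  (Σd +ℤ f (q + d) r) +ℤ antidiff f q (suc (r + d))
    ≡⟨ cong (λ z → (Σd +ℤ f (q + d) z) +ℤ antidiff f q (suc (r + d))) (sym (m+n∸n≡m r d)) ⟩
  (Σd +ℤ f (q + d) (r + d ∸ d)) +ℤ antidiff f q (suc (r + d))
    ≡⟨ cong (_+ℤ antidiff f q (suc (r + d))) (sym (sumRange-snoc (λ t → f (q + t) (r + d ∸ t)) 0 d)) ⟩
  sumℤ (map (λ t → f (q + t) (r + d ∸ t)) (range 0 (suc d))) +ℤ antidiff f q (suc (r + d)) ∎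
  where
  open ≡-Reasoning
  Σd = sumℤ (map (λ t → f (q + t) (r + d ∸ t)) (range 0 d))
  lem : ∀ x y z → x +ℤ (y +ℤ z) ≡ (y +ℤ x) +ℤ z
  lem = ℤSolver.solve-∀

-- The adjoint of the divided difference. As a difference of two antidifferences it covers all three
-- cases of `∂Term` at once: the common part of the two sums cancels, and the sign follows the
-- larger exponent.
δ : ℕ → K → K
δ p φ b a = antidiff (λ u v → φ b (setPQ a (suc p) u v)) (at a p) (at a (suc p)) +ℤ
  ℤ- antidiff (λ u v → φ b (setPQ a (suc p) u v)) (at a (suc p)) (at a p)

pair-monomials : ∀ c b (h : ℕ → List ℕ) φ ts →
  pair (map (λ t → term c b (h t)) ts) φ ≡ c *ℤ sumℤ (map (λ t → φ b (h t)) ts)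
pair-monomials c b h φ []       = sym (ℤₚ.*-zeroʳ c)
pair-monomials c b h φ (t ∷ ts) = trans (cong (c *ℤ φ b (h t) +ℤ_) (pair-monomials c b h φ ts))
  (sym (ℤₚ.*-distribˡ-+ c (φ b (h t)) _))

antidiff-diff : ∀ f P Q → Q ≤ P →
  antidiff f P Q +ℤ ℤ- antidiff f Q P ≡ sumℤ (map (λ t → f (Q + t) (P ∸ 1 ∸ t)) (range 0 (P ∸ Q)))
antidiff-diff f P Q Q≤P with P ∸ Q | m+[n∸m]≡n Q≤P
... | d | refl rewrite antidiff-sum f Q Q d = lem _ (antidiff f Q (Q + d))
  where
  lem : ∀ x y → (x +ℤ y) +ℤ ℤ- y ≡ x
  lem = ℤSolver.solve-∀

pair-∂Term : ∀ p c b a φ → pair (∂Term (suc p) (term c b a)) φ ≡ c *ℤ δ p φ b a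
pair-∂Term p c b a φ with <-cmp (at a (suc p)) (at a p)
... | tri< q<p _ _ rewrite <ᵇ-true q<p =
  trans (pair-monomials c b (λ t → setPQ a (suc p) (at a (suc p) + t) (at a p ∸ 1 ∸ t)) φ (range 0 (at a p ∸ at a (suc p))))
    (cong (c *ℤ_) (sym (antidiff-diff (λ u v → φ b (setPQ a (suc p) u v)) _ _ (<⇒≤ q<p))))
... | tri≈ q≮p q≡p _ rewrite q≡p | <ᵇ-false (<-irrefl {at a p} refl) =
  sym (trans (cong (c *ℤ_) (ℤₚ.+-inverseʳ (antidiff (λ u v → φ b (setPQ a (suc p) u v)) (at a p) (at a p)))) (ℤₚ.*-zeroʳ c))
... | tri> q≮p _ p<q rewrite <ᵇ-false q≮p | <ᵇ-true p<q =
  trans (pair-monomials (ℤ- c) b (λ t → setPQ a (suc p) (at a p + t) (at a (suc p) ∸ 1 ∸ t)) φ (range 0 (at a (suc p) ∸ at a p)))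
    (trans (cong ((ℤ- c) *ℤ_) (sym (antidiff-diff f _ _ (<⇒≤ p<q))))
      (lem c (antidiff f (at a (suc p)) (at a p)) (antidiff f (at a p) (at a (suc p)))))
  where
  f : ℕ → ℕ → ℤ
  f u v = φ b (setPQ a (suc p) u v)
  lem : ∀ c x y → (ℤ- c) *ℤ (x +ℤ ℤ- y) ≡ c *ℤ (y +ℤ ℤ- x)
  lem = ℤSolver.solve-∀

pair-∂ : ∀ p P φ → pair (∂ (suc p) P) φ ≡ pair P (δ p φ)
pair-∂ p []               φ = refl
pair-∂ p (term c b a ∷ P) φ = trans (pair-++ (∂Term (suc p) (term c b a)) (∂ (suc p) P) φ)
  (cong₂ _+ℤ_ (pair-∂Term p c b a φ) (pair-∂ p P φ))

pair-πop : ∀ p P φ → pair (πop (suc p) P) φ ≡ pair P (λ b a → δ p φ b a +ℤ δ p φ (suc b) (inc (suc p) a))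
pair-πop p P φ = begin
  pair (πop (suc p) P) φ
    ≡⟨ pair-∂ p (P ++ map (mulβx (suc (suc p))) P) φ ⟩
  pair (P ++ map (mulβx (suc (suc p))) P) (δ p φ)
    ≡⟨ pair-++ P _ (δ p φ) ⟩
  pair P (δ p φ) +ℤ pair (map (mulβx (suc (suc p))) P) (δ p φ)
    ≡⟨ cong (pair P (δ p φ) +ℤ_) (pair-mulβx (suc p) P (δ p φ)) ⟩
  pair P (δ p φ) +ℤ pair P (λ b a → δ p φ (suc b) (inc (suc p) a))
    ≡⟨ sym (pair-+ P (δ p φ) (λ b a → δ p φ (suc b) (inc (suc p) a))) ⟩
  _ ∎
  where open ≡-Reasoning

antidiff-cong : ∀ {f g} → (∀ u v → f u v ≡ g u v) → ∀ p q → antidiff f p q ≡ antidiff g p q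
antidiff-cong e zero    q = refl
antidiff-cong e (suc p) q = cong₂ _+ℤ_ (e p q) (antidiff-cong e p (suc q))

module _ {n : ℕ} (ts : Vec ℕ n) where

  -- `δ p φ` is ψ minus its swap, for an antidifference ψ of φ. So the left side is a difference of
  -- two values of `Zβ`, which `Z-exchange` turns into the pairing of G_{w'} with the difference of
  -- ψ; by the recursion of `antidiff` that is φ up to padding.
  Z-π : ∀ {p w'} → Ascent p w' → suc p < n → ∀ φ b a → swapPQ p a ≡ a → normPQ p a ≡ a →
    Zβ ts (swap0 p w') p (δ p φ) b a ≡ Z ts w' φ b a
  Z-π {p} {w'} asc p<n φ b a inv nrm = begin
    Zβ ts w p (δ p φ) b a
      ≡⟨ F-cong L (λ _ b a → cong₂ _+ℤ_ (δ-ψ b a) (δ-ψ (suc b) (inc (suc p) a))) b a ⟩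
    Z ts w (λ b a → (ψ b a +ℤ ℤ- ψs b a) +ℤ (ψ (suc b) (inc (suc p) a) +ℤ ℤ- ψs (suc b) (inc (suc p) a))) b a
      ≡⟨ F-cong L (λ _ b a → shuffle (ψ b a) (ψs b a) (ψ (suc b) (inc (suc p) a)) (ψs (suc b) (inc (suc p) a))) b a ⟩
    Z ts w (λ b a → (ψ b a +ℤ ψ (suc b) (inc (suc p) a)) +ℤ ℤ- (ψs b a +ℤ ψs (suc b) (inc (suc p) a))) b a
      ≡⟨ trans (F-+ L (λ _ b a → ψ b a +ℤ ψ (suc b) (inc (suc p) a))
                      (λ _ b a → ℤ- (ψs b a +ℤ ψs (suc b) (inc (suc p) a))) b a)
           (cong (Zβ ts w p ψ b a +ℤ_) (F-neg L (λ _ b a → ψs b a +ℤ ψs (suc b) (inc (suc p) a)) b a)) ⟩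
    Zβ ts w p ψ b a +ℤ ℤ- Zβ ts w p ψs b a
      ≡⟨ cong (λ z → Zβ ts w p ψ b a +ℤ ℤ- z) (sym (Z-exchange ts asc p<n ψ b a inv)) ⟩
    Zβ ts w p ψ b a +ℤ ℤ- (Zβ ts w p ψ b a +ℤ D)
      ≡⟨ cancel (Zβ ts w p ψ b a) D ⟩
    ℤ- D
      ≡⟨ cong ℤ-_ (trans (F-cong L' (λ _ b a → diff b a) b a) (F-neg L' (λ _ b a → φ b (normPQ p a)) b a)) ⟩
    ℤ- (ℤ- Z ts w' (λ b a → φ b (normPQ p a)) b a)
      ≡⟨ ℤₚ.neg-involutive _ ⟩
    Z ts w' (λ b a → φ b (normPQ p a)) b a
      ≡⟨ Z-invariant ts w' φ (normPQ p) (normals p (rangeV 0 n)) b a ⟩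
    Z ts w' φ b (normPQ p a)
      ≡⟨ cong (Z ts w' φ b) nrm ⟩
    Z ts w' φ b a ∎
    where
    open ≡-Reasoning
    w = swap0 p w'
    L = Z-linear ts w
    L' = Z-linear ts w'
    ψ ψs : K
    ψ b a = antidiff (λ u v → φ b (setPQ a (suc p) u v)) (at a p) (at a (suc p))
    ψs b a = ψ b (swapPQ p a)
    D = Z ts w' (λ b a → ψ b (inc (suc p) a) +ℤ ℤ- ψ b (inc p a)) b a
    δ-ψ : ∀ b a → δ p φ b a ≡ ψ b a +ℤ ℤ- ψs b a
    δ-ψ b a rewrite setPQ-at₁ a p (at a (suc p)) (at a p) | setPQ-at₂ a p (at a (suc p)) (at a p) =
      cong (λ z → ψ b a +ℤ ℤ- z)
        (antidiff-cong (λ u v → cong (φ b) (sym (setPQ-setPQ a p (at a (suc p)) (at a p) u v))) (at a (suc p)) (at a p))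
    shuffle : ∀ x y z t → (x +ℤ ℤ- y) +ℤ (z +ℤ ℤ- t) ≡ (x +ℤ z) +ℤ ℤ- (y +ℤ t)
    shuffle = ℤSolver.solve-∀
    cancel : ∀ x y → x +ℤ ℤ- (x +ℤ y) ≡ ℤ- y
    cancel = ℤSolver.solve-∀
    diff : ∀ b a → ψ b (inc (suc p) a) +ℤ ℤ- ψ b (inc p a) ≡ ℤ- φ b (normPQ p a)
    diff b a
      rewrite at-inc a (suc p) p (λ e → n≢1+n (sym e)) | at-inc₁ a (suc p)
            | at-inc a p (suc p) n≢1+n | at-inc₁ a p
            | antidiff-cong (λ u v → cong (φ b) (setPQ-set₂ a p (suc (at a (suc p))) u v)) (at a p) (suc (at a (suc p)))
            | antidiff-cong (λ u v → cong (φ b) (setPQ-set₁ a p (suc (at a p)) u v)) (at a p) (suc (at a (suc p))) =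
      trans (cong (λ z → X +ℤ ℤ- (φ b z +ℤ X)) (setPQ-set₁ a p (suc (at a p)) (at a p) (at a (suc p))))
        (lem X (φ b (normPQ p a)))
      where
      X = antidiff (λ u v → φ b (setPQ a (suc p) u v)) (at a p) (suc (at a (suc p)))
      lem : ∀ x y → x +ℤ ℤ- (y +ℤ x) ≡ ℤ- y
      lem = ℤSolver.solve-∀

-- The longest permutation

F-zero : ∀ {J : Set} {F : (J → K) → K} → Linear F → ∀ Φ → (∀ j b a → Φ j b a ≡ ℤ+ 0) → ∀ b a → F Φ b a ≡ ℤ+ 0
F-zero {F = F} L Φ e b a = identityˡ-unique (F Φ b a) (F Φ b a)
  (trans (sym (F-+ L Φ Φ b a)) (F-cong L (λ j b a → trans (cong₂ _+ℤ_ (e j b a) (e j b a)) (sym (e j b a))) b a))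

iter : ∀ {A : Set} → ℕ → (A → A) → A → A
iter zero    f x = x
iter (suc n) f x = f (iter n f x)

-- The largest label enters at the rightmost column and can leave at the left end only by crossing
-- every other label of the row. One term survives, with a factor x_i for each of the `n` tiles.
rowSum-max : ∀ n i (us : Vec ℕ n) h → Allⱽ (_< h) us → ∀ Φ →
  (∀ x v b a → x ≢ h → Φ (x ∷ v) b a ≡ ℤ+ 0) → ∀ b a →
  rowSum n i (us ∷ʳ h) Φ b a ≡ Φ (h ∷ us) b (iter n (inc i) a)
rowSum-max zero    i []       h []         Φ e b a = refl
rowSum-max (suc n) i (t ∷ us) h (t<h ∷ us<h) Φ e b a =
  trans (rowSum-max n i us h us<h (λ w → H 0 i Φ (t ∷ w)) e' b a) last
  where
  e' : ∀ x v b a → x ≢ h → H 0 i Φ (t ∷ x ∷ v) b a ≡ ℤ+ 0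
  e' x v b a x≢h with t <ᵇ x
  ... | true  = cong₂ _+ℤ_ (e t (x ∷ v) b a (<⇒≢ t<h)) (e x (t ∷ v) b (inc i a) x≢h)
  ... | false = cong₂ _+ℤ_ (e t (x ∷ v) b a (<⇒≢ t<h)) (e t (x ∷ v) (suc b) (inc i a) (<⇒≢ t<h))
  last : H 0 i Φ (t ∷ h ∷ us) b (iter n (inc i) a) ≡ Φ (h ∷ t ∷ us) b (iter (suc n) (inc i) a)
  last rewrite <ᵇ-true t<h | e t (h ∷ us) b (iter n (inc i) a) (<⇒≢ t<h) = ℤₚ.+-identityˡ _

desc stair : ℕ → List ℕ
desc zero     = []
desc (suc n)  = suc n ∷ desc n
stair zero    = []
stair (suc n) = n ∷ stair n

rangeV-∷ʳ : ∀ a n → rangeV a (suc n) ≡ rangeV a n ∷ʳ (a + n)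
rangeV-∷ʳ a zero    = cong (_∷ []) (sym (+-identityʳ a))
rangeV-∷ʳ a (suc n) = cong (a ∷_) (trans (rangeV-∷ʳ (suc a) n) (cong (rangeV (suc a) n ∷ʳ_) (sym (+-suc a n))))

rangeV-< : ∀ a n m → a + n ≤ m → Allⱽ (_< m) (rangeV a n)
rangeV-< a zero    m a+n≤m = []
rangeV-< a (suc n) m a+n≤m = ≤-trans (s≤s (m≤m+n a n)) (subst (_≤ m) (+-suc a n) a+n≤m)
  ∷ rangeV-< (suc a) n m (subst (_≤ m) (+-suc a n) a+n≤m)

shift-vars : ∀ m a n → Transports id (m ∷_) (rangeV a n) (rangeV (suc a) n)
shift-vars m a zero    = []
shift-vars m a (suc n) = record { γ-inc = λ _ → refl ; β-suc = λ _ → refl } ∷ shift-vars m (suc a) n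

iter-inc₀ : ∀ n x a → iter n (inc 0) (x ∷ a) ≡ n + x ∷ a
iter-inc₀ zero    x a = refl
iter-inc₀ (suc n) x a rewrite iter-inc₀ n x a = refl

-- By `rowSum-max` the first row consists of crosses, and what lies below is the same problem of
-- rank one less in the remaining variables. Only the pipe dream with crosses in all free cells
-- contributes.
Z-desc : ∀ n φ b → Z (rangeV 1 n) (desc n) φ b (replicate n 0) ≡ φ b (stair n)
Z-desc zero    φ b = refl
Z-desc (suc n) φ b = begin
  rowSum n 0 (rangeV 1 (suc n)) Ψ b z
    ≡⟨ cong (λ ts → rowSum n 0 ts Ψ b z) (rangeV-∷ʳ 1 n) ⟩
  rowSum n 0 (rangeV 1 n ∷ʳ suc n) Ψ b z
    ≡⟨ rowSum-max n 0 (rangeV 1 n) (suc n) (rangeV-< 1 n (suc n) ≤-refl) Ψ Ψ-zero b z ⟩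
  Ψ (suc n ∷ rangeV 1 n) b (iter n (inc 0) z)
    ≡⟨ cong (Ψ (suc n ∷ rangeV 1 n) b) (trans (iter-inc₀ n 0 _) (cong (_∷ replicate n 0) (+-identityʳ n))) ⟩
  runSum (rangeV 1 n) (rangeV 1 n) (λ v → ind (desc (suc n)) φ (suc n ∷ v)) b (n ∷ replicate n 0)
    ≡⟨ sym (runSum-transport (shift-vars n 0 n) (rangeV 1 n) (λ v → ind (desc (suc n)) φ (suc n ∷ v)) b (replicate n 0)) ⟩
  _ ≡⟨ F-cong (runSum-linear (rangeV 0 n) (rangeV 1 n)) strip b (replicate n 0) ⟩
  Z (rangeV 1 n) (desc n) (λ b a → φ b (n ∷ a)) b (replicate n 0)
    ≡⟨ Z-desc n (λ b a → φ b (n ∷ a)) b ⟩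
  φ b (n ∷ stair n) ∎
  where
  open ≡-Reasoning
  z = replicate (suc n) 0
  Ψ : Vec ℕ (suc n) → K
  Ψ = tailSum (runSum (rangeV 1 n)) (λ h v → ind (desc (suc n)) φ (h ∷ v))
  Ψ-zero : ∀ x v b a → x ≢ suc n → Ψ (x ∷ v) b a ≡ ℤ+ 0
  Ψ-zero x v b a x≢ = F-zero (runSum-linear (rangeV 1 n) v) (λ v → ind (desc (suc n)) φ (x ∷ v)) zeroes b a
    where
    zeroes : ∀ v b a → ind (desc (suc n)) φ (x ∷ v) b a ≡ ℤ+ 0
    zeroes v b a rewrite listEqᵇ-≢ {x ∷ toList v} {suc n ∷ desc n} (λ e → x≢ (∷-injectiveˡ e)) = refl
  strip : ∀ v b a → ind (desc (suc n)) φ (suc n ∷ v) b (n ∷ a) ≡ ind (desc n) (λ b a → φ b (n ∷ a)) v b a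
  strip v b a with n ≡ᵇ n | ≡⇒≡ᵇ n n refl
  ... | true | _ = refl

-- The recursion computed by `groth`

map-suc-range : ∀ a n → map suc (range a n) ≡ range (suc a) n
map-suc-range a zero    = refl
map-suc-range a (suc n) = cong (suc a ∷_) (map-suc-range (suc a) n)

stair≡ : ∀ n → map (λ i → n ∸ i) (oneTo n) ≡ stair n
stair≡ zero    = refl
stair≡ (suc n) = cong (n ∷_) (trans (lem 1 n) (stair≡ n))
  where
  lem : ∀ a m → map (λ i → suc n ∸ i) (range (suc a) m) ≡ map (λ i → n ∸ i) (range a m)
  lem a zero    = refl
  lem a (suc m) = cong (n ∸ a ∷_) (lem (suc a) m)

-- All pairs in increasing order count, not only adjacent ones. Thus a swap at an ascent lowers the
-- number by exactly one, which makes it the measure for the fuel.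
ascents : List ℕ → ℕ
ascents []      = 0
ascents (x ∷ w) = count (x <ᵇ_) w + ascents w

count-swap : ∀ {p w} (q : ℕ → Bool) → Ascent p w → count q (swap0 p w) ≡ count q w
count-swap q (here {x} {y} {r} x<y) with q x | q y
... | true  | true  = refl
... | true  | false = refl
... | false | true  = refl
... | false | false = refl
count-swap q (there {x = x} asc) with q x
... | true  = cong suc (count-swap q asc)
... | false = count-swap q asc

ascents-swap : ∀ {p w} → Ascent p w → ascents w ≡ suc (ascents (swap0 p w))
ascents-swap (here {x} {y} {r} x<y) rewrite <ᵇ-true x<y | <ᵇ-false (<-asym x<y) =
  cong suc (lem (count (x <ᵇ_) r) (count (y <ᵇ_) r) (ascents r))
  where
  lem : ∀ a b c → a + (b + c) ≡ b + (a + c)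
  lem = ℕSolver.solve-∀
ascents-swap {suc p} (there {x = x} {r} asc) rewrite count-swap (x <ᵇ_) asc =
  trans (cong (count (x <ᵇ_) r +_) (ascents-swap asc)) (+-suc (count (x <ᵇ_) r) _)

count-≤ : ∀ {A : Set} (q : A → Bool) w → count q w ≤ length w
count-≤ q []      = z≤n
count-≤ q (x ∷ w) with q x
... | true  = s≤s (count-≤ q w)
... | false = m≤n⇒m≤1+n (count-≤ q w)

-- Justifies the fuel `length w * length w` in `groth`.
ascents-≤ : ∀ w → ascents w ≤ length w * length w
ascents-≤ []      = z≤n
ascents-≤ (x ∷ w) = ≤-trans (+-mono-≤ (count-≤ (x <ᵇ_) w) (ascents-≤ w))
  (≤-trans (n≤1+n _) (s≤s (+-monoʳ-≤ (length w) (*-monoʳ-≤ (length w) (n≤1+n (length w))))))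

swap-↭ : ∀ {p w} → Ascent p w → swap0 p w ↭ w
swap-↭ (here {x} {y} x<y) = swap y x ↭-refl
swap-↭ (there {x = x} asc) = prep x (swap-↭ asc)

Ascent-< : ∀ {p w} → Ascent p w → suc p < length w
Ascent-< (here x<y)  = s≤s (s≤s z≤n)
Ascent-< (there asc) = s≤s (Ascent-< asc)

findAscent : ℕ → List ℕ → Maybe ℕ
findAscent i (x ∷ y ∷ r) = if x <ᵇ y then just i else findAscent (suc i) (y ∷ r)
findAscent i (x ∷ [])    = nothing
findAscent i []          = nothing

-- The worker of firstAscent is local to it; unification recovers its name
-- once its three arguments have been abstracted.
go-tail≡ : ∀ (w : List ℕ) y r → _ ≡ findAscent 2 (y ∷ r)
go≡ : ∀ (w : List ℕ) i xs → _ ≡ findAscent i xs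

if-cong : ∀ {A : Set} (c : Bool) {x y z : A} → y ≡ z → (if c then x else y) ≡ (if c then x else z)
if-cong true  e = refl
if-cong false e = e

firstAscent-tail : ∀ x y r → (x <ᵇ y) ≡ false → firstAscent (x ∷ y ∷ r) ≡ findAscent 2 (y ∷ r)
firstAscent-tail x y r e rewrite e with x List.∷ (y List.∷ r)
... | w = go-tail≡ w y r

go-tail≡ w y r with 2 | y List.∷ r
... | i | xs = go≡ w i xs

go≡ w i []          = refl
go≡ w i (x ∷ [])    = refl
go≡ w i (x ∷ y ∷ r) = if-cong (x <ᵇ y) (go≡ w (suc i) (y ∷ r))

firstAscent≡ : ∀ w → firstAscent w ≡ findAscent 1 w
firstAscent≡ []          = refl
firstAscent≡ (x ∷ [])    = refl
firstAscent≡ (x ∷ y ∷ r) with x <? y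
... | yes x<y rewrite <ᵇ-true x<y = refl
... | no x≮y = trans (firstAscent-tail x y r (<ᵇ-false x≮y)) (sym (lem (<ᵇ-false x≮y)))
  where
  lem : (x <ᵇ y) ≡ false → findAscent 1 (x ∷ y ∷ r) ≡ findAscent 2 (y ∷ r)
  lem e rewrite e = refl

data AscentSearch (i : ℕ) (w : List ℕ) : Maybe ℕ → Set where
  found    : ∀ {p} → Ascent p w → AscentSearch i w (just (i + p))
  no-ascent : Linked _≥_ w → AscentSearch i w nothing

findAscent-step : ∀ i x y r {m} → AscentSearch (suc i) (y ∷ r) m →
  AscentSearch i (x ∷ y ∷ r) (if x <ᵇ y then just i else m)
findAscent-step i x y r s with x <? y
findAscent-step i x y r s | yes x<y rewrite <ᵇ-true x<y =
  subst (λ j → AscentSearch i (x ∷ y ∷ r) (just j)) (+-identityʳ i) (found (here x<y))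
findAscent-step i x y r (found {p} asc) | no x≮y rewrite <ᵇ-false x≮y =
  subst (λ j → AscentSearch i (x ∷ y ∷ r) (just j)) (+-suc i p) (found (there asc))
findAscent-step i x y r (no-ascent l) | no x≮y rewrite <ᵇ-false x≮y = no-ascent (≮⇒≥ x≮y ∷ l)

findAscent-spec : ∀ i w → AscentSearch i w (findAscent i w)
findAscent-spec i []          = no-ascent []
findAscent-spec i (x ∷ [])    = no-ascent [-]
findAscent-spec i (x ∷ y ∷ r) = findAscent-step i x y r (findAscent-spec (suc i) (y ∷ r))

range-∷ʳ : ∀ a n → range a (suc n) ≡ range a n ++ (a + n ∷ [])
range-∷ʳ a zero    = cong (_∷ []) (sym (+-identityʳ a))
range-∷ʳ a (suc n) = cong (a ∷_) (trans (range-∷ʳ (suc a) n) (cong (λ m → range (suc a) n ++ (m ∷ [])) (sym (+-suc a n))))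

desc-↭ : ∀ n → desc n ↭ oneTo n
desc-↭ zero    = ↭-refl
desc-↭ (suc n) = ↭-trans (prep (suc n) (desc-↭ n))
  (↭-trans (∷↭∷ʳ (suc n) (oneTo n)) (↭-reflexive (sym (range-∷ʳ 1 n))))

desc-Linked : ∀ n → Linked _≥_ (desc n)
desc-Linked zero          = []
desc-Linked (suc zero)    = [-]
desc-Linked (suc (suc n)) = n≤1+n (suc n) ∷ desc-Linked (suc n)

decreasing : ∀ n w → w ↭ oneTo n → Linked _≥_ w → w ≡ desc n
decreasing n w w↭ l = Pointwise-≡⇒≡ (↗↭↗⇒≋ (Flip.totalOrder ≤-totalOrder) l (desc-Linked n) (↭⇒↭ₛ (↭-trans w↭ (↭-sym (desc-↭ n)))))

length-range : ∀ a n → length (range a n) ≡ n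
length-range a zero    = refl
length-range a (suc n) = cong suc (length-range (suc a) n)

at-zeros : ∀ n q → at (replicate n 0) q ≡ 0
at-zeros zero    q       = refl
at-zeros (suc n) zero    = refl
at-zeros (suc n) (suc q) = at-zeros n q

setAt-zeros : ∀ n q → q < n → setAt (replicate n 0) q 0 ≡ replicate n 0
setAt-zeros (suc n) zero    q<n       = refl
setAt-zeros (suc n) (suc q) (s≤s q<n) = cong (0 ∷_) (setAt-zeros n q q<n)

setPQ-zeros : ∀ n q → suc q < n → setPQ (replicate n 0) (suc q) 0 0 ≡ replicate n 0
setPQ-zeros n q q<n rewrite setAt-zeros n q (<-trans (n<1+n q) q<n) = setAt-zeros n (suc q) q<n

pair-Gw₀ : ∀ n φ → pair (Gw₀ n) φ ≡ Z (rangeV 1 n) (desc n) φ 0 (replicate n 0)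
pair-Gw₀ n φ = trans (trans (ℤₚ.+-identityʳ _) (ℤₚ.*-identityˡ _)) (trans (cong (φ 0) (stair≡ n)) (sym (Z-desc n φ 0)))

-- Induction on the fuel, with `Z-π` for each application of `πop`. The starting exponents are `n`
-- zeros: they are symmetric in all variables, and the list is long enough for `normPQ` to fix it.
pair-groth : ∀ n f w → w ↭ oneTo n → ascents w ≤ f → ∀ φ →
  pair (grothFuel n f w) φ ≡ Z (rangeV 1 n) w φ 0 (replicate n 0)
pair-groth n zero w w↭ a≤f φ with findAscent 1 w | findAscent-spec 1 w
... | _ | found asc = ⊥-elim (1+n≰n (≤-trans (subst (1 ≤_) (sym (ascents-swap asc)) (s≤s z≤n)) (≤-trans a≤f z≤n)))
... | _ | no-ascent l rewrite decreasing n w w↭ l = pair-Gw₀ n φ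
pair-groth n (suc f) w w↭ a≤f φ rewrite firstAscent≡ w with findAscent 1 w | findAscent-spec 1 w
... | _ | no-ascent l rewrite decreasing n w w↭ l = pair-Gw₀ n φ
... | _ | found {p} asc = begin
  pair (πop (suc p) (grothFuel n f (swap0 p w))) φ
    ≡⟨ pair-πop p (grothFuel n f (swap0 p w)) φ ⟩
  pair (grothFuel n f (swap0 p w)) (λ b a → δ p φ b a +ℤ δ p φ (suc b) (inc (suc p) a))
    ≡⟨ pair-groth n f (swap0 p w) (↭-trans (swap-↭ asc) w↭)
         (≤-pred (subst (_≤ suc f) (ascents-swap asc) a≤f)) _ ⟩
  Zβ (rangeV 1 n) (swap0 p w) p (δ p φ) 0 (replicate n 0)
    ≡⟨ Z-π (rangeV 1 n) asc p<n φ 0 (replicate n 0) inv inv' ⟩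
  Z (rangeV 1 n) w φ 0 (replicate n 0) ∎
  where
  open ≡-Reasoning
  p<n : suc p < n
  p<n = subst (suc p <_) (trans (↭-length w↭) (length-range 1 n)) (Ascent-< asc)
  inv : swapPQ p (replicate n 0) ≡ replicate n 0
  inv rewrite at-zeros n p | at-zeros n (suc p) = setPQ-zeros n p p<n
  inv' : normPQ p (replicate n 0) ≡ replicate n 0
  inv' rewrite at-zeros n p | at-zeros n (suc p) = setPQ-zeros n p p<n

-- From generating functions to counting

tri : ℕ → ℕ
tri zero    = 0
tri (suc n) = n + tri n

ifℤ : Bool → ℤ → ℤ
ifℤ c z = if c then z else ℤ+ 0

sumT : ℕ → (List Tile → ℤ) → ℤ
sumT m f = sumℤ (map f (tileLists m))

private
  over : (List Tile → ℤ) → List Tile → ℤ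
  over f F = f (cross ∷ F) +ℤ (f (bump ∷ F) +ℤ f (mbump ∷ F))

sumT-suc : ∀ m f → sumT (suc m) f ≡ sumT m (over f)
sumT-suc m f = go (tileLists m)
  where
  lem : ∀ x y z u → x +ℤ (y +ℤ (z +ℤ u)) ≡ (x +ℤ (y +ℤ z)) +ℤ u
  lem = ℤSolver.solve-∀
  go : ∀ Fs → sumℤ (map f (concatMap (λ F → (cross ∷ F) ∷ (bump ∷ F) ∷ (mbump ∷ F) ∷ []) Fs)) ≡ sumℤ (map (over f) Fs)
  go []       = refl
  go (F ∷ Fs) = trans (lem (f (cross ∷ F)) (f (bump ∷ F)) (f (mbump ∷ F)) _) (cong (over f F +ℤ_) (go Fs))

sumT-cong : ∀ m {f g} → (∀ F → f F ≡ g F) → sumT m f ≡ sumT m g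
sumT-cong m {f} {g} = sum-cong f g (tileLists m)

sumT-+ : ∀ m f g → sumT m (λ F → f F +ℤ g F) ≡ sumT m f +ℤ sumT m g
sumT-+ m f g = go (tileLists m)
  where
  lem : ∀ x y z u → (x +ℤ y) +ℤ (z +ℤ u) ≡ (x +ℤ z) +ℤ (y +ℤ u)
  lem = ℤSolver.solve-∀
  go : ∀ Fs → sumℤ (map (λ F → f F +ℤ g F) Fs) ≡ sumℤ (map f Fs) +ℤ sumℤ (map g Fs)
  go []       = refl
  go (F ∷ Fs) = trans (cong (f F +ℤ g F +ℤ_) (go Fs)) (lem (f F) (g F) _ _)

sumT-split : ∀ m k (g : Vec Tile m → List Tile → ℤ) →
  sumT (m + k) (λ F → g (rowFrom m F) (drop m F)) ≡ sumT m (λ F → sumT k (g (rowFrom m F)))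
sumT-split zero    k g = sym (ℤₚ.+-identityʳ _)
sumT-split (suc m) k g = begin
  sumT (suc (m + k)) (λ F → g (rowFrom (suc m) F) (drop (suc m) F))
    ≡⟨ sumT-suc (m + k) (λ F → g (rowFrom (suc m) F) (drop (suc m) F)) ⟩
  sumT (m + k) (λ F → g' (rowFrom m F) (drop m F))
    ≡⟨ sumT-split m k g' ⟩
  sumT m (λ F → sumT k (g' (rowFrom m F)))
    ≡⟨ sumT-cong m (λ F → trans (sumT-+ k (g (cross ∷ rowFrom m F)) (λ F' → g (bump ∷ rowFrom m F) F' +ℤ g (mbump ∷ rowFrom m F) F'))
         (cong (sumT k (g (cross ∷ rowFrom m F)) +ℤ_) (sumT-+ k (g (bump ∷ rowFrom m F)) (g (mbump ∷ rowFrom m F))))) ⟩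
  sumT m (over (λ F → sumT k (g (rowFrom (suc m) F))))
    ≡⟨ sym (sumT-suc m (λ F → sumT k (g (rowFrom (suc m) F)))) ⟩
  sumT (suc m) (λ F → sumT k (g (rowFrom (suc m) F))) ∎
  where
  open ≡-Reasoning
  g' : Vec Tile m → List Tile → ℤ
  g' ρ F = g (cross ∷ ρ) F +ℤ (g (bump ∷ ρ) F +ℤ g (mbump ∷ ρ) F)

sumT-ifℤ : ∀ m c f → sumT m (λ F → ifℤ c (f F)) ≡ ifℤ c (sumT m f)
sumT-ifℤ m true  f = refl
sumT-ifℤ m false f = go (tileLists m)
  where
  go : ∀ Fs → sumℤ (map (λ F → ℤ+ 0) Fs) ≡ ℤ+ 0
  go []       = refl
  go (_ ∷ Fs) = trans (ℤₚ.+-identityˡ _) (go Fs)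

rowTerm : ∀ {n} → Vec ℕ (suc n) → (Vec ℕ (suc n) → ℕ → ℤ) → ℕ → Vec Tile n → ℤ
rowTerm ts Φ b ρ = ifℤ (rowOK ts ρ) (Φ (rowH ts ρ ∷ rowU ts ρ) (b + marksV ρ))

-- A test function that ignores `a` amounts to x = 1, so a tile contributes 1 + u. The 1 is the
-- bump; u is the cross if top < right and β times the identity, the marked bump, otherwise. These
-- are exactly the tiles that `okTile` admits.
rowSum-count : ∀ n i (ts : Vec ℕ (suc n)) (Φ : Vec ℕ (suc n) → ℕ → ℤ) b a →
  rowSum n i ts (λ w b a → Φ w b) b a ≡ sumT n (λ F → rowTerm ts Φ b (rowFrom n F))
rowSum-count zero    i (t ∷ []) Φ b a = trans (cong (Φ (t ∷ [])) (sym (+-identityʳ b))) (sym (ℤₚ.+-identityʳ _))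
rowSum-count (suc n) i (t ∷ ts) Φ b a = begin
  rowSum n i ts (λ w → H 0 i (λ w b a → Φ w b) (t ∷ w)) b a
    ≡⟨ F-cong (rowSum-linear n i ts) H≡ b a ⟩
  rowSum n i ts (λ w b a → Ψ w b) b a
    ≡⟨ rowSum-count n i ts Ψ b a ⟩
  sumT n (λ F → rowTerm ts Ψ b (rowFrom n F))
    ≡⟨ sumT-cong n (λ F → term≡ (rowFrom n F)) ⟩
  sumT n (over (λ F → rowTerm (t ∷ ts) Φ b (rowFrom (suc n) F)))
    ≡⟨ sym (sumT-suc n (λ F → rowTerm (t ∷ ts) Φ b (rowFrom (suc n) F))) ⟩
  sumT (suc n) (λ F → rowTerm (t ∷ ts) Φ b (rowFrom (suc n) F)) ∎
  where
  open ≡-Reasoning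
  Ψ : Vec ℕ (suc n) → ℕ → ℤ
  Ψ (h ∷ us) b = Φ (t ∷ h ∷ us) b +ℤ (if t <ᵇ h then Φ (h ∷ t ∷ us) b else Φ (t ∷ h ∷ us) (suc b))
  H≡ : ∀ w b a → H 0 i (λ w b a → Φ w b) (t ∷ w) b a ≡ Ψ w b
  H≡ (h ∷ us) b a = refl
  term≡ : ∀ ρ → rowTerm ts Ψ b ρ ≡
    rowTerm (t ∷ ts) Φ b (cross ∷ ρ) +ℤ (rowTerm (t ∷ ts) Φ b (bump ∷ ρ) +ℤ rowTerm (t ∷ ts) Φ b (mbump ∷ ρ))
  term≡ ρ with rowOK ts ρ | t <ᵇ rowH ts ρ
  ... | true  | true  = lem (Φ (t ∷ rowH ts ρ ∷ rowU ts ρ) (b + marksV ρ)) _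
    where
    lem : ∀ x y → x +ℤ y ≡ y +ℤ (x +ℤ ℤ+ 0)
    lem = ℤSolver.solve-∀
  ... | true  | false rewrite +-suc b (marksV ρ) = sym (ℤₚ.+-identityˡ _)
  ... | false | true  = refl
  ... | false | false = refl

runTerm : ∀ {n} → Vec ℕ n → (Vec ℕ n → ℕ → ℤ) → ℕ → PD n → ℤ
runTerm ts Φ b P = ifℤ (valid ts P) (Φ (run ts P) (b + marks P))

runTerm-consRow : ∀ {n} (ts : Vec ℕ (suc n)) Φ b (ρ : Vec Tile n) P →
  runTerm ts Φ b (consRow ρ P) ≡ ifℤ (rowOK ts ρ) (runTerm (rowU ts ρ) (λ v → Φ (rowH ts ρ ∷ v)) (b + marksV ρ) P)
runTerm-consRow ts Φ b ρ P
  rewrite valid-consRow ts ρ P | run-consRow ts ρ P | marks-consRow ρ P | +-assoc b (marksV ρ) (marks P)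
  with rowOK ts ρ
... | true  = refl
... | false = refl

runSum-count : ∀ {n} (is ts : Vec ℕ n) (Φ : Vec ℕ n → ℕ → ℤ) b a →
  runSum is ts (λ v b a → Φ v b) b a ≡ sumT (tri n) (λ F → runTerm ts Φ b (toPD n F))
runSum-count []       []  Φ b a = trans (cong (Φ []) (sym (+-identityʳ b))) (sym (ℤₚ.+-identityʳ _))
runSum-count {suc n} (i ∷ is) ts Φ b a = begin
  rowSum n i ts (tailSum (runSum is) (λ h v b a → Φ (h ∷ v) b)) b a
    ≡⟨ F-cong (rowSum-linear n i ts) inner b a ⟩
  rowSum n i ts (λ w b a → Ψ w b) b a
    ≡⟨ rowSum-count n i ts Ψ b a ⟩
  sumT n (λ F → rowTerm ts Ψ b (rowFrom n F))
    ≡⟨ sumT-cong n (λ F → step (rowFrom n F)) ⟩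
  sumT n (λ F → sumT (tri n) (λ F' → runTerm ts Φ b (consRow (rowFrom n F) (toPD n F'))))
    ≡⟨ sym (sumT-split n (tri n) (λ ρ F' → runTerm ts Φ b (consRow ρ (toPD n F')))) ⟩
  sumT (n + tri n) (λ F → runTerm ts Φ b (toPD (suc n) F)) ∎
  where
  open ≡-Reasoning
  Ψ : Vec ℕ (suc n) → ℕ → ℤ
  Ψ (h ∷ us) b = sumT (tri n) (λ F → runTerm us (λ v → Φ (h ∷ v)) b (toPD n F))
  inner : ∀ w b a → tailSum (runSum is) (λ h v b a → Φ (h ∷ v) b) w b a ≡ Ψ w b
  inner (h ∷ us) b a = runSum-count is us (λ v → Φ (h ∷ v)) b a
  step : ∀ ρ → rowTerm ts Ψ b ρ ≡ sumT (tri n) (λ F' → runTerm ts Φ b (consRow ρ (toPD n F')))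
  step ρ = sym (trans (sumT-cong (tri n) (λ F' → runTerm-consRow ts Φ b ρ (toPD n F')))
    (sumT-ifℤ (tri n) (rowOK ts ρ) (λ F' → runTerm (rowU ts ρ) (λ v → Φ (rowH ts ρ ∷ v)) (b + marksV ρ) (toPD n F'))))

count-sum : ∀ {A : Set} (p : A → Bool) xs → sumℤ (map (λ x → ifℤ (p x) (ℤ+ 1)) xs) ≡ ℤ+ count p xs
count-sum p []       = refl
count-sum p (x ∷ xs) with p x
... | true  = cong (ℤ+ 1 +ℤ_) (count-sum p xs)
... | false = trans (ℤₚ.+-identityˡ _) (count-sum p xs)

isPDof : ∀ {n} → Vec ℕ n → List ℕ → ℕ → PD n → Bool
isPDof ts w k P = valid ts P ∧ listEqᵇ (toList (run ts P)) w ∧ (marks P ≡ᵇ k)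

length-cells : ∀ n → length (cells n) ≡ tri n
length-cells n = go n 1 n (+-comm n 1)
  where
  go : ∀ n a m → m + a ≡ suc n → length (concatMap (λ i → map (λ k → (i , k)) (oneTo (n ∸ i))) (range a m)) ≡ tri m
  go n a zero    e = refl
  go n a (suc m) e = trans (length-++ (map (λ k → (a , k)) (oneTo (n ∸ a))))
    (cong₂ _+_ (trans (length-map (λ k → (a , k)) (oneTo (n ∸ a))) (trans (length-range 1 (n ∸ a)) n∸a))
               (go n (suc a) m (trans (+-suc m a) e)))
    where
    n∸a : n ∸ a ≡ m
    n∸a = trans (cong (_∸ a) (sym (suc-injective e))) (m+n∸n≡m m a)

allPD : (n : ℕ) → List (PD n)
allPD n = map (toPD n) (fillings n)

count-map : ∀ {A B : Set} (p : B → Bool) (f : A → B) xs → count p (map f xs) ≡ count (λ x → p (f x)) xs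
count-map p f []       = refl
count-map p f (x ∷ xs) with p (f x)
... | true  = cong suc (count-map p f xs)
... | false = count-map p f xs

-- The test function looks at the exponent of β alone, which sets all variables to 1.
coeffβ-pair : ∀ P k → coeffβ P k ≡ pair P (λ b a → ifℤ (b ≡ᵇ k) (ℤ+ 1))
coeffβ-pair []               k = refl
coeffβ-pair (term c b a ∷ P) k with b ≡ᵇ k
... | true  = cong₂ _+ℤ_ (sym (ℤₚ.*-identityʳ c)) (coeffβ-pair P k)
... | false = trans (coeffβ-pair P k)
  (trans (sym (ℤₚ.+-identityˡ _)) (cong (_+ℤ pair P (λ b a → ifℤ (b ≡ᵇ k) (ℤ+ 1))) (sym (ℤₚ.*-zeroʳ c))))

Υ-count : ∀ n w → w ↭ oneTo n → ∀ k → Υ w k ≡ ℤ+ count (isPDof (rangeV 1 n) w k) (allPD n)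
Υ-count n w w↭ k with trans (↭-length w↭) (length-range 1 n)
Υ-count n []        w↭ zero    | refl = refl
Υ-count n []        w↭ (suc k) | refl = refl
Υ-count n w@(_ ∷ _) w↭ k       | refl = begin
  coeffβ (groth w) k
    ≡⟨ coeffβ-pair (groth w) k ⟩
  pair (groth w) φ
    ≡⟨ pair-groth n (n * n) w w↭ (ascents-≤ w) φ ⟩
  Z (rangeV 1 n) w φ 0 (replicate n 0)
    ≡⟨ runSum-count (rangeV 0 n) (rangeV 1 n) (λ v b → ind w φ v b []) 0 (replicate n 0) ⟩
  sumT (tri n) (λ F → runTerm (rangeV 1 n) (λ v b → ind w φ v b []) 0 (toPD n F))
    ≡⟨ cong (λ m → sumT m (λ F → runTerm (rangeV 1 n) (λ v b → ind w φ v b []) 0 (toPD n F))) (sym (length-cells n)) ⟩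
  sumT (length (cells n)) (λ F → runTerm (rangeV 1 n) (λ v b → ind w φ v b []) 0 (toPD n F))
    ≡⟨ sumT-cong (length (cells n)) (λ F → term≡ (toPD n F)) ⟩
  sumT (length (cells n)) (λ F → ifℤ (isPDof (rangeV 1 n) w k (toPD n F)) (ℤ+ 1))
    ≡⟨ count-sum (λ F → isPDof (rangeV 1 n) w k (toPD n F)) (fillings n) ⟩
  ℤ+ count (λ F → isPDof (rangeV 1 n) w k (toPD n F)) (fillings n)
    ≡⟨ cong ℤ+_ (sym (count-map (isPDof (rangeV 1 n) w k) (toPD n) (fillings n))) ⟩
  ℤ+ count (isPDof (rangeV 1 n) w k) (allPD n) ∎
  where
  open ≡-Reasoning
  φ : K
  φ b a = ifℤ (b ≡ᵇ k) (ℤ+ 1)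
  term≡ : ∀ P → runTerm (rangeV 1 n) (λ v b → ind w φ v b []) 0 P ≡ ifℤ (isPDof (rangeV 1 n) w k P) (ℤ+ 1)
  term≡ P with valid (rangeV 1 n) P | listEqᵇ (toList (run (rangeV 1 n) P)) w
  ... | true  | true  = refl
  ... | true  | false = refl
  ... | false | true  = refl
  ... | false | false = refl

-- Removing and inserting a pipe

data InsAt (j : ℕ) : ∀ {n} → ℕ → Vec ℕ n → Vec ℕ (suc n) → Set where
  here  : ∀ {n} {v : Vec ℕ n} → InsAt j 0 v (j ∷ v)
  there : ∀ {n a x} {v : Vec ℕ n} {v'} → InsAt j a v v' → InsAt j (suc a) (x ∷ v) (x ∷ v')

-- ColIns f a τ' τ b : a new pipe entering the column τ' from the right above
-- row a and leaving above row b turns it into τ; f tells whether the tile above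
-- is an unmarked bump. Condition (ii) makes the pipe go straight iff f is false.
data ColIns : ∀ {m} → Bool → ℕ → Vec Tile m → Vec Tile (suc m) → ℕ → Set where
  straight : ∀ {m} {τ' : Vec Tile m} → ColIns false 0 τ' (cross ∷ τ') 0
  descend  : ∀ {m f} {τ' : Vec Tile m} → ColIns f 0 (bump ∷ τ') (bump ∷ bump ∷ τ') 1
  diagonal : ∀ {f} → ColIns f 0 [] (bump ∷ []) 1
  below    : ∀ {m f a x b} {τ' : Vec Tile m} {τ} → ColIns (isBump x) a τ' τ b →
             ColIns f (suc a) (x ∷ τ') (x ∷ τ) (suc b)

data CrossBump : ∀ {m} → ℕ → Vec Tile m → Set where
  []    : CrossBump 0 []
  bump  : ∀ {m} {τ : Vec Tile m} → CrossBump 0 τ → CrossBump 0 (bump ∷ τ)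
  cross : ∀ {m r} {τ : Vec Tile m} → CrossBump r τ → CrossBump (suc r) (cross ∷ τ)

-- b is the row of P' above which the removed pipe j exits.
data Removes (j : ℕ) : ∀ {n} → Vec ℕ n → Vec ℕ (suc n) → PD n → PD (suc n) → ℕ → Set where
  here  : ∀ {n r} {ts : Vec ℕ n} {P τ} → CrossBump r τ → Removes j ts (j ∷ ts) P (τ ∷ P) r
  there : ∀ {n a b t} {ts' : Vec ℕ n} {ts P' P τ' τ} → Removes j ts' ts P' P a →
          ColIns false a τ' τ b → Removes j (t ∷ ts') (t ∷ ts) (τ' ∷ P') (τ ∷ P) b

-- The increasing map that misses the value `a`: it converts a row or exit position in the diagram
-- without a pipe into the position once that pipe is back at `a`.
punch : ℕ → ℕ → ℕ
punch zero    x       = suc x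
punch (suc a) zero    = zero
punch (suc a) (suc x) = suc (punch a x)

col-enter-≤ : ∀ {m f a b} {τ' : Vec Tile m} {τ} → ColIns f a τ' τ b → a ≤ m
col-enter-≤ straight  = z≤n
col-enter-≤ descend   = z≤n
col-enter-≤ diagonal  = z≤n
col-enter-≤ (below p) = s≤s (col-enter-≤ p)

-- The flag for the second pipe survives the erasure of the first. `straight` removes a cross, whose
-- flag is false, from a place where the flag was false already; `descend` merges two bumps into
-- one, and a bump still stands above whatever followed. A chain of three bumps used by both pipes
-- becomes a pair of two.
col-commute : ∀ {m f a b d e} {τ' : Vec Tile (suc m)} {τ τ''} →
  ColIns f a τ' τ b → ColIns f (punch a d) τ'' τ e →
  ∃₂ λ τ''' e' → ColIns f d τ''' τ' e' × e ≡ punch b e'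
col-commute straight (below q) = _ , _ , q , refl
col-commute descend (below descend)   = _ , _ , descend , refl
col-commute descend (below diagonal)  = _ , _ , diagonal , refl
col-commute descend (below (below q)) = _ , _ , below q , refl
col-commute {d = zero} (below p) straight = _ , _ , straight , refl
col-commute {d = zero} (below descend)   descend = _ , _ , descend , refl
col-commute {d = zero} (below diagonal)  descend = _ , _ , diagonal , refl
col-commute {d = zero} (below (below p)) descend = _ , _ , descend , refl
col-commute {m = suc m} {d = suc d} (below p) (below q) with col-commute p q
... | _ , _ , q' , refl = _ , _ , below q' , refl
col-commute {m = zero} {d = suc d} (below p) (below q) with col-enter-≤ p | col-enter-≤ q
... | z≤n | ()

col-commute⁻¹ : ∀ {m f a b d e} {τ' : Vec Tile (suc m)} {τ τ'''} →
  ColIns f a τ' τ b → ColIns f d τ''' τ' e →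
  ∃ λ τ'' → ColIns f (punch a d) τ'' τ (punch b e)
col-commute⁻¹ straight q = _ , below q
col-commute⁻¹ descend descend   = _ , below descend
col-commute⁻¹ descend diagonal  = _ , below diagonal
col-commute⁻¹ descend (below q) = _ , below (below q)
col-commute⁻¹ (below p) straight = _ , straight
col-commute⁻¹ (below descend) descend = _ , descend
col-commute⁻¹ (below (below p)) descend = _ , descend
col-commute⁻¹ (below diagonal) diagonal = _ , descend
col-commute⁻¹ {m = suc m} (below p) (below q) with col-commute⁻¹ p q
... | _ , q' = _ , below q'

col-≤ : ∀ {m f a b} {τ' : Vec Tile m} {τ} → ColIns f a τ' τ b → b ≤ suc m
col-≤ straight  = z≤n
col-≤ descend   = s≤s z≤n
col-≤ diagonal  = s≤s z≤n
col-≤ (below p) = s≤s (col-≤ p)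

CrossBump-≤ : ∀ {m r} {τ : Vec Tile m} → CrossBump r τ → r ≤ m
CrossBump-≤ []        = z≤n
CrossBump-≤ (bump c)  = z≤n
CrossBump-≤ (cross c) = s≤s (CrossBump-≤ c)

removes-≤ : ∀ {j n b} {ts' : Vec ℕ n} {ts P' P} → Removes j ts' ts P' P b → b ≤ n
removes-≤ (here c)    = CrossBump-≤ c
removes-≤ (there p q) = col-≤ q

CrossBump-col : ∀ {m f a r e} {τ'' : Vec Tile m} {τ} → CrossBump r τ → ColIns f a τ'' τ e → e ≡ punch r a
CrossBump-col (cross c) straight  = refl
CrossBump-col (bump c)  descend   = refl
CrossBump-col (bump c)  diagonal  = refl
CrossBump-col (cross c) (below q) = cong suc (CrossBump-col c q)
CrossBump-col (bump c)  (below q) = cong suc (CrossBump-col c q)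

CrossBump-remove : ∀ {m f a b e} {τ' : Vec Tile m} {τ} → CrossBump e τ → ColIns f a τ' τ b →
  ∃ λ e' → CrossBump e' τ' × e ≡ punch b e'
CrossBump-remove (cross c) straight        = _ , c , refl
CrossBump-remove (bump (bump c)) descend   = _ , bump c , refl
CrossBump-remove (bump []) diagonal        = _ , [] , refl
CrossBump-remove (cross c) (below q) with CrossBump-remove c q
... | _ , c' , refl = _ , cross c' , refl
CrossBump-remove (bump c) (below {b = b} q) with CrossBump-remove c q
CrossBump-remove (bump c) (below {b = suc b} q) | zero , c' , e = _ , bump c' , refl

-- A pipe entering at a cross must go straight, which an unmarked bump above would forbid. In such a
-- column a bump is followed by bumps only, so the hypothesis on `f` is passed down.
col-CrossBump : ∀ {m f r} e {τ : Vec Tile (suc m)} → CrossBump r τ → (f ≡ true → r ≡ 0) → e ≤ m →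
  ∃ λ τ'' → ColIns f e τ'' τ (punch r e)
col-CrossBump {f = true}  zero (cross c) h e≤m with () ← h refl
col-CrossBump {f = false} zero (cross c) h e≤m = _ , straight
col-CrossBump zero (bump []) h e≤m       = _ , diagonal
col-CrossBump zero (bump (bump c)) h e≤m = _ , descend
col-CrossBump {suc m} (suc e) (cross c) h (s≤s e≤m) with col-CrossBump {f = false} e c (λ ()) e≤m
... | _ , q = _ , below q
col-CrossBump {suc m} (suc e) (bump c) h (s≤s e≤m) with col-CrossBump {f = true} e c (λ _ → refl) e≤m
... | _ , q = _ , below q

CrossBump-insert : ∀ {m f a b e} {τ' : Vec Tile m} {τ} → CrossBump e τ' → ColIns f a τ' τ b → CrossBump (punch b e) τ
CrossBump-insert c straight               = cross c
CrossBump-insert (bump c) descend         = bump (bump c)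
CrossBump-insert [] diagonal              = bump []
CrossBump-insert (cross c) (below q)      = cross (CrossBump-insert c q)
CrossBump-insert (bump c) (below {b = suc b} q) = bump (CrossBump-insert c q)

remove-commute : ∀ {j l n b e} {ts : Vec ℕ (suc (suc n))} {ts' ts'' P' P'' P} →
  Removes j ts' ts P' P b → Removes l ts'' ts P'' P e → j ≢ l →
  ∃₂ λ ts''' P''' → ∃ λ e' → Removes l ts''' ts' P''' P' e' × e ≡ punch b e'
remove-commute (here c)    (here c')   j≢l = ⊥-elim (j≢l refl)
remove-commute (here c)    (there q s) j≢l = _ , _ , _ , q , CrossBump-col c s
remove-commute (there p r) (here c)    j≢l with CrossBump-remove c r
... | _ , c' , e = _ , _ , _ , here c' , e
remove-commute {n = suc n} (there p r) (there q s) j≢l with remove-commute p q j≢l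
... | _ , _ , _ , q' , refl with col-commute r s
...   | _ , _ , s' , refl = _ , _ , _ , there q' s' , refl
remove-commute {n = zero} (there (here _) r) (there (here _) s) j≢l = ⊥-elim (j≢l refl)

remove-commute⁻¹ : ∀ {j l n b e} {ts : Vec ℕ (suc (suc n))} {ts' ts''' P' P''' P} →
  Removes j ts' ts P' P b → Removes l ts''' ts' P''' P' e →
  ∃₂ λ ts'' P'' → Removes l ts'' ts P'' P (punch b e)
remove-commute⁻¹ (here c) q with col-CrossBump {f = false} _ c (λ ()) (removes-≤ q)
... | _ , s = _ , _ , there q s
remove-commute⁻¹ (there p r) (here c) = _ , _ , here (CrossBump-insert c r)
remove-commute⁻¹ {n = suc n} (there p r) (there q s) with remove-commute⁻¹ p q
... | _ , _ , q' with col-commute⁻¹ r s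
...   | _ , s' = _ , _ , there q' s'

-- Deciding removability

colPos : ∀ {m} → Bool → ℕ → Vec Tile m → Maybe ℕ
colPos f     zero    []                = nothing
colPos f     zero    (cross ∷ τ)       = if f then nothing else just 0
colPos f     zero    (bump ∷ [])       = just 1
colPos f     zero    (bump ∷ bump ∷ τ) = just 1
colPos f     zero    (bump ∷ _ ∷ τ)    = nothing
colPos f     zero    (mbump ∷ τ)       = nothing
colPos f     (suc a) []                = nothing
colPos f     (suc a) (x ∷ τ)           = Maybe.map suc (colPos (isBump x) a τ)

crossBumpPos : ∀ {m} → Vec Tile m → Maybe ℕ
crossBumpPos []          = just 0
crossBumpPos (cross ∷ τ) = Maybe.map suc (crossBumpPos τ)
crossBumpPos (bump ∷ τ)  = crossBumpPos τ >>= λ { zero → just 0 ; (suc _) → nothing }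
crossBumpPos (mbump ∷ τ) = nothing

-- The computable side of `Removes`: counting needs a Boolean test, while the bijections are proved
-- by induction on the relation.
exitPos : ∀ {n} → ℕ → Vec ℕ n → PD n → Maybe ℕ
exitPos j []       []      = nothing
exitPos j (t ∷ ts) (τ ∷ P) =
  if t ≡ᵇ j then crossBumpPos τ else (exitPos j ts P >>= λ a → colPos false a τ)

removable : ∀ {n} → ℕ → Vec ℕ n → PD n → Bool
removable j ts P = is-just (exitPos j ts P)

colPos-sound : ∀ {m} f a (τ : Vec Tile (suc m)) {b} → colPos f a τ ≡ just b → ∃ λ τ' → ColIns f a τ' τ b
colPos-sound false zero (cross ∷ τ) refl = _ , straight
colPos-sound f zero (bump ∷ []) refl = _ , diagonal
colPos-sound f zero (bump ∷ bump ∷ τ) refl = _ , descend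
colPos-sound {suc m} f (suc a) (x ∷ τ) e with colPos (isBump x) a τ in eq
colPos-sound {suc m} f (suc a) (x ∷ τ) refl | just b with colPos-sound (isBump x) a τ eq
... | _ , q = _ , below q
colPos-sound {zero} f (suc zero) (x ∷ []) ()
colPos-sound {zero} f (suc (suc a)) (x ∷ []) ()

colPos-complete : ∀ {m f a b} {τ' : Vec Tile m} {τ} → ColIns f a τ' τ b → colPos f a τ ≡ just b
colPos-complete straight = refl
colPos-complete descend  = refl
colPos-complete diagonal = refl
colPos-complete (below q) rewrite colPos-complete q = refl

crossBumpPos-sound : ∀ {m} (τ : Vec Tile m) {r} → crossBumpPos τ ≡ just r → CrossBump r τ
crossBumpPos-sound [] refl = []
crossBumpPos-sound (cross ∷ τ) e with crossBumpPos τ in eq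
crossBumpPos-sound (cross ∷ τ) refl | just r = cross (crossBumpPos-sound τ eq)
crossBumpPos-sound (bump ∷ τ) e with crossBumpPos τ in eq
crossBumpPos-sound (bump ∷ τ) refl | just zero = bump (crossBumpPos-sound τ eq)

crossBumpPos-complete : ∀ {m r} {τ : Vec Tile m} → CrossBump r τ → crossBumpPos τ ≡ just r
crossBumpPos-complete [] = refl
crossBumpPos-complete (cross c) rewrite crossBumpPos-complete c = refl
crossBumpPos-complete (bump c)  rewrite crossBumpPos-complete c = refl

exitPos-sound : ∀ {n} j (ts : Vec ℕ (suc n)) P {b} → exitPos j ts P ≡ just b →
  ∃₂ λ ts' P' → Removes j ts' ts P' P b
exitPos-sound j (t ∷ ts) (τ ∷ P) e with t ≡ᵇ j in eq
... | true with refl ← ≡ᵇ⇒≡ t j (subst T (sym eq) _) = _ , _ , here (crossBumpPos-sound τ e)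
exitPos-sound j (t ∷ ts) (τ ∷ P) e | false with exitPos j ts P in eq'
exitPos-sound {suc n} j (t ∷ ts) (τ ∷ P) e | false | just a
  with _ , _ , p ← exitPos-sound j ts P eq' | _ , q ← colPos-sound false a τ e = _ , _ , there p q
exitPos-sound {zero} j (t ∷ []) (τ ∷ []) () | false | nothing

data Increasing : ∀ {n} → Vec ℕ n → Set where
  []  : Increasing []
  _∷_ : ∀ {n t} {ts : Vec ℕ n} → Allⱽ (t <_) ts → Increasing ts → Increasing (t ∷ ts)

removes-All : ∀ {p} {Q : ℕ → Set p} {j n b} {ts' : Vec ℕ n} {ts P' P} →
  Removes j ts' ts P' P b → Allⱽ Q ts → Q j × Allⱽ Q ts'
removes-All (here c)    (q ∷ qs) = q , qs
removes-All (there p _) (q ∷ qs) with removes-All p qs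
... | qj , qs' = qj , q ∷ qs'

removes-Increasing : ∀ {j n b} {ts' : Vec ℕ n} {ts P' P} →
  Removes j ts' ts P' P b → Increasing ts → Increasing ts'
removes-Increasing (here c)    (_ ∷ i) = i
removes-Increasing (there p _) (q ∷ i) = proj₂ (removes-All p q) ∷ removes-Increasing p i

-- `Increasing` makes the top labels distinct, so the search does not stop at a column before that
-- of `j`.
exitPos-complete : ∀ {j n b} {ts' : Vec ℕ n} {ts P' P} → Increasing ts →
  Removes j ts' ts P' P b → exitPos j ts P ≡ just b
exitPos-complete {j} i (here c) with j ≡ᵇ j | ≡⇒≡ᵇ j j refl
... | true | _ = crossBumpPos-complete c
exitPos-complete {j} (t< ∷ i) (there {t = t} p q) with t ≡ᵇ j in eq
... | true = ⊥-elim (<⇒≢ (proj₁ (removes-All p t<)) (≡ᵇ⇒≡ t j (subst T (sym eq) _)))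
... | false rewrite exitPos-complete i p = colPos-complete q

removable⇒ : ∀ {n} j (ts : Vec ℕ (suc n)) P → removable j ts P ≡ true →
  ∃₂ λ ts' P' → ∃ λ b → Removes j ts' ts P' P b
removable⇒ j ts P e with exitPos j ts P in eq
... | just b with _ , _ , p ← exitPos-sound j ts P eq = _ , _ , b , p

⇒removable : ∀ {j n b} {ts' : Vec ℕ n} {ts P' P} → Increasing ts → Removes j ts' ts P' P b → removable j ts P ≡ true
⇒removable i p rewrite exitPos-complete i p = refl

-- `remove-commute` and `remove-commute⁻¹` are the two implications. This allows the pipes to be
-- erased one at a time; rank one is separate, as no pipe is left there after `j`.
removable-invariant : ∀ {j l n b} {ts' : Vec ℕ n} {ts P' P} → Increasing ts →
  Removes j ts' ts P' P b → j ≢ l → removable l ts P ≡ removable l ts' P'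
removable-invariant {j} {l} {zero} {ts' = []} {t ∷ []} {P' = []} i (here c) j≢l with j ≡ᵇ l in eq
... | true  = ⊥-elim (j≢l (≡ᵇ⇒≡ j l (subst T (sym eq) _)))
... | false = refl
removable-invariant {j} {l} {suc n} {ts' = ts'} {ts} {P'} {P} i p j≢l
  with removable l ts P in e | removable l ts' P' in e'
... | true  | true  = refl
... | false | false = refl
... | true  | false with removable⇒ l ts P e
...   | _ , _ , _ , q with remove-commute p q j≢l
...     | _ , _ , _ , q' , _ = trans (sym (⇒removable (removes-Increasing p i) q')) e'
removable-invariant {j} {l} {suc n} {ts' = ts'} {ts} {P'} {P} i p j≢l | false | true with removable⇒ l ts' P' e'
... | _ , _ , _ , q with remove-commute⁻¹ p q
...   | _ , _ , q' = trans (sym e) (⇒removable i q')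

-- Labels, validity and marks under erasure

bumps-run : ∀ {m} {τ : Vec Tile m} → CrossBump 0 τ → ∀ c rs → colStep c rs τ ≡ c ∷ rs
bumps-run [] c [] = refl
bumps-run (bump p) c (r ∷ rs) = cong (c ∷_) (bumps-run p r rs)

CrossBump-run : ∀ {j m r} {τ : Vec Tile m} → CrossBump r τ → ∀ rs → InsAt j r rs (colStep j rs τ)
CrossBump-run [] [] = here
CrossBump-run (cross c) (x ∷ rs) = there (CrossBump-run c rs)
CrossBump-run {j} (bump c) (x ∷ rs) rewrite bumps-run c x rs = here

-- In `descend` the upper bump sends `c` left and `j` down, and the lower one sends `j` left and the
-- next label down. Apart from `j` this is what the single bump did.
col-run : ∀ {j m f a b} {τ' : Vec Tile m} {τ rs' rs} c → ColIns f a τ' τ b → InsAt j a rs' rs →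
  InsAt j b (colStep c rs' τ') (colStep c rs τ)
col-run c straight here = here
col-run {rs' = _ ∷ _} c descend here = there here
col-run {rs' = []} c diagonal here = there here
col-run c (below {x = x} p) (there {x = r} i) = there (col-run (botOf x c r) p i)

removes-run : ∀ {j n b} {ts' : Vec ℕ n} {ts P' P} → Removes j ts' ts P' P b → InsAt j b (run ts' P') (run ts P)
removes-run {ts' = ts'} {P' = P'} (here c) = CrossBump-run c (run ts' P')
removes-run (there {t = t} p q) = col-run t q (removes-run p)

∧-true : ∀ {x y} → x ∧ y ≡ true → x ≡ true × y ≡ true
∧-true {true} {true} refl = refl , refl

∧-intro : ∀ {x y} → x ≡ true → y ≡ true → x ∧ y ≡ true
∧-intro refl refl = refl

col-valid : ∀ {j m f a b} {τ' : Vec Tile m} {τ rs' rs} c → ColIns f a τ' τ b → InsAt j a rs' rs →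
  colOK c rs τ ≡ true → colOK c rs' τ' ≡ true
col-valid c straight here e = proj₂ (∧-true e)
col-valid {rs' = _ ∷ _} c descend here e = e
col-valid {rs' = []} c diagonal here e = refl
col-valid c (below {x = x} p) (there {x = r} i) e =
  ∧-intro (proj₁ (∧-true e)) (col-valid (botOf x c r) p i (proj₂ (∧-true {okTile x c r} e)))

-- Every tile that remains meets the same two labels as before, so its test is among those already
-- passed. The bumps that `descend` merges are not tested at all.
removes-valid : ∀ {j n b} {ts' : Vec ℕ n} {ts P' P} → Removes j ts' ts P' P b → valid ts P ≡ true → valid ts' P' ≡ true
removes-valid {ts' = ts'} {P' = P'} (here {τ = τ} c) e = proj₂ (∧-true {colOK _ (run ts' P') τ} e)
removes-valid (there {t = t} {ts = ts} {P = P} {τ = τ} p q) e = ∧-intro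
  (col-valid t q (removes-run p) (proj₁ (∧-true e))) (removes-valid p (proj₂ (∧-true {colOK t (run ts P) τ} e)))

CrossBump-marks : ∀ {m r} {τ : Vec Tile m} → CrossBump r τ → marksV τ ≡ 0
CrossBump-marks [] = refl
CrossBump-marks (bump c) = CrossBump-marks c
CrossBump-marks (cross c) = CrossBump-marks c

col-marks : ∀ {m f a b} {τ' : Vec Tile m} {τ} → ColIns f a τ' τ b → marksV τ ≡ marksV τ'
col-marks straight = refl
col-marks descend = refl
col-marks diagonal = refl
col-marks (below {x = x} p) = cong (isM x +_) (col-marks p)

removes-marks : ∀ {j n b} {ts' : Vec ℕ n} {ts P' P} → Removes j ts' ts P' P b → marks P ≡ marks P'
removes-marks (here c) rewrite CrossBump-marks c = refl
removes-marks (there p q) = cong₂ _+_ (col-marks q) (removes-marks p)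

colStep-↭ : ∀ {m} c (rs : Vec ℕ m) τ → toList (colStep c rs τ) ↭ c ∷ toList rs
colStep-↭ c [] [] = ↭-refl
colStep-↭ c (r ∷ rs) (cross ∷ τ) = ↭-trans (prep r (colStep-↭ c rs τ)) (swap r c ↭-refl)
colStep-↭ c (r ∷ rs) (bump ∷ τ)  = prep c (colStep-↭ r rs τ)
colStep-↭ c (r ∷ rs) (mbump ∷ τ) = prep c (colStep-↭ r rs τ)

run-↭ : ∀ {n} (ts : Vec ℕ n) P → toList (run ts P) ↭ toList ts
run-↭ []       []      = ↭-refl
run-↭ (t ∷ ts) (τ ∷ P) = ↭-trans (colStep-↭ t (run ts P) τ) (prep t (run-↭ ts P))

Increasing⇒Unique : ∀ {n} {ts : Vec ℕ n} → Increasing ts → Unique (toList ts)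
Increasing⇒Unique []      = []
Increasing⇒Unique (q ∷ i) = All.map <⇒≢ (toList⁺ q) ∷ Increasing⇒Unique i

run-Unique : ∀ {n} {ts : Vec ℕ n} → Increasing ts → ∀ P → Unique (toList (run ts P))
run-Unique {ts = ts} i P = Unique-resp-↭ (↭⇒↭ₛ (↭-sym (run-↭ ts P))) (Increasing⇒Unique i)

-- The pattern 1423 behind an illegal crossing

data Before (x y : ℕ) : List ℕ → Set where
  here  : ∀ {u} → y ∈ u → Before x y (x ∷ u)
  there : ∀ {z u} → Before x y u → Before x y (z ∷ u)

Before-∈ : ∀ {x y u} → Before x y u → y ∈ u
Before-∈ (here p)  = there p
Before-∈ (there b) = there (Before-∈ b)

above under : ∀ {n} → ℕ → Vec ℕ n → List ℕ
above b v = take b (toList v)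
under b v = drop b (toList v)

-- The pattern 1423 in which j plays the role of 2.
record Pattern (j b : ℕ) {n : ℕ} (v : Vec ℕ n) : Set where
  constructor pattern1423
  field
    {x q' q} : ℕ
    x<j : x < j
    j<q : j < q
    q<q' : q < q'
    before : Before x q' (above b v)
    after : q ∈ under b v

module _ {j : ℕ} where

  after-persists : ∀ {m f a b q} {τ' : Vec Tile m} {τ} (rs' : Vec ℕ m) c → ColIns f a τ' τ b →
    q ∈ under a rs' → q ∈ under b (colStep c rs' τ')
  after-persists {τ' = τ'} rs' c straight q∈ = ∈-resp-↭ (↭-sym (colStep-↭ c rs' τ')) (there q∈)
  after-persists {τ' = _ ∷ τ'} (r ∷ rs') c descend q∈ = ∈-resp-↭ (↭-sym (colStep-↭ r rs' τ')) q∈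
  after-persists [] c diagonal ()
  after-persists (r ∷ rs') c (below {x = x} p) q∈ = after-persists rs' (botOf x c r) p q∈

  -- A carried label can fall below `j` only by crossing it, and in a valid column it is then
  -- smaller than `j`. Larger labels therefore stay above.
  above-persists : ∀ {m f a b y} {τ' : Vec Tile m} {τ rs' rs} c → ColIns f a τ' τ b → InsAt j a rs' rs →
    colOK c rs τ ≡ true → j < y → y ∈ c ∷ above a rs' → y ∈ above b (colStep c rs' τ')
  above-persists c straight here ok j<y (here refl) with c <? j
  ... | yes c<j = ⊥-elim (<-asym c<j j<y)
  ... | no c≮j rewrite <ᵇ-false c≮j with () ← ok
  above-persists {rs' = _ ∷ _} c descend here ok j<y (here refl) = here refl
  above-persists {rs' = []} c diagonal here ok j<y (here refl) = here refl
  above-persists c (below {x = cross} p) (there {x = r} i) ok j<y (here refl) =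
    there (above-persists c p i (proj₂ (∧-true {c <ᵇ r} ok)) j<y (here refl))
  above-persists c (below {x = cross} p) (there {x = r} i) ok j<y (there (here refl)) = here refl
  above-persists c (below {x = cross} p) (there {x = r} i) ok j<y (there (there y∈)) =
    there (above-persists c p i (proj₂ (∧-true {c <ᵇ r} ok)) j<y (there y∈))
  above-persists c (below {x = bump} p) (there {x = r} i) ok j<y (here refl) = here refl
  above-persists c (below {x = bump} p) (there {x = r} i) ok j<y (there y∈) = there (above-persists r p i ok j<y y∈)
  above-persists c (below {x = mbump} p) (there {x = r} i) ok j<y (here refl) = here refl
  above-persists c (below {x = mbump} p) (there {x = r} i) ok j<y (there y∈) =
    there (above-persists r p i (proj₂ (∧-true {not (c <ᵇ r)} ok)) j<y y∈)

  -- The 1 of the pattern may change on the way. While `c` crosses, the first label keeps its place;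
  -- once a bump releases `c`, it stands before `q'`, and being smaller than `j` it takes over as
  -- the 1.
  Before-persists : ∀ {m f a b x q'} {τ' : Vec Tile m} {τ rs' rs} c → ColIns f a τ' τ b → InsAt j a rs' rs →
    colOK c rs τ ≡ true → c < j → x < j → j < q' → Before x q' (above a rs') →
    ∃ λ y → y < j × Before y q' (above b (colStep c rs' τ'))
  Before-persists c (below {x = cross} p) (there {x = r} i) ok c<j x<j j<q' (here q'∈) =
    _ , x<j , here (above-persists c p i (proj₂ (∧-true {c <ᵇ r} ok)) j<q' (there q'∈))
  Before-persists c (below {x = cross} p) (there {x = r} i) ok c<j x<j j<q' (there bf)
    with y , y<j , bf' ← Before-persists c p i (proj₂ (∧-true {c <ᵇ r} ok)) c<j x<j j<q' bf = y , y<j , there bf'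
  Before-persists c (below {x = bump} p) (there {x = r} i) ok c<j x<j j<q' bf =
    c , c<j , here (above-persists r p i ok j<q' (Before-∈ bf))
  Before-persists c (below {x = mbump} p) (there {x = r} i) ok c<j x<j j<q' bf =
    c , c<j , here (above-persists r p i (proj₂ (∧-true {not (c <ᵇ r)} ok)) j<q' (Before-∈ bf))

  -- A pattern that still lacks its 1: `q'` is the 4 and `z` the 3. `u` is a parameter so that the 4
  -- may also be the label emitted just before the rows in question.
  record Double (b : ℕ) {n : ℕ} (v : Vec ℕ n) (u : List ℕ) : Set where
    constructor double
    field
      {z q'} : ℕ
      j<z : j < z
      z<q' : z < q'
      q'∈ : q' ∈ u
      z∈ : z ∈ under b v

  -- If the carried label c crosses j illegally, the label p that left the column
  -- just above is larger than c: they become the 3 and the 4 of a pattern 1423.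
  crossing-carry : ∀ {m f a b} {τ' : Vec Tile m} {τ rs' rs} p c → ColIns f a τ' τ b → InsAt j a rs' rs →
    Unique (c ∷ toList rs') → j ∉ c ∷ toList rs' → colOK c rs' τ' ≡ true → (f ≡ false → c < p) →
    colOK c rs τ ≡ true ⊎ Double b (colStep c rs' τ') (p ∷ above b (colStep c rs' τ'))
  crossing-carry {τ' = τ'} {rs' = rs'} p c straight here un j∉ ok c<p with <-cmp c j
  ... | tri< c<j _ _ rewrite <ᵇ-true c<j = inj₁ ok
  ... | tri≈ _ refl _ = ⊥-elim (j∉ (here refl))
  ... | tri> _ _ j<c = inj₂ (double j<c (c<p refl) (here refl) (∈-resp-↭ (↭-sym (colStep-↭ c rs' τ')) (here refl)))
  crossing-carry {rs' = _ ∷ _} p c descend here un j∉ ok c<p = inj₁ ok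
  crossing-carry {rs' = []} p c diagonal here un j∉ ok c<p = inj₁ refl
  crossing-carry p c (below {x = cross} q) (there {x = r} i) ((c≢r ∷ c≢) ∷ _ ∷ un) j∉ ok c<p
    with c<r , ok' ← ∧-true {c <ᵇ r} ok
    with crossing-carry r c q i (c≢ ∷ un) (λ { (here e) → j∉ (here e) ; (there e) → j∉ (there (there e)) }) ok'
           (λ _ → <ᵇ⇒< c r (subst T (sym c<r) _))
  ... | inj₁ ok″ = inj₁ (∧-intro c<r ok″)
  ... | inj₂ (double j<z z<q' q'∈ z∈) = inj₂ (double j<z z<q' (there q'∈) z∈)
  crossing-carry p c (below {x = bump} q) (there {x = r} i) (_ ∷ un) j∉ ok c<p
    with crossing-carry c r q i un (λ e → j∉ (there e)) ok (λ ())
  ... | inj₁ ok″ = inj₁ ok″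
  ... | inj₂ (double j<z z<q' q'∈ z∈) = inj₂ (double j<z z<q' (there q'∈) z∈)
  crossing-carry p c (below {x = mbump} q) (there {x = r} i) ((c≢r ∷ c≢) ∷ un) j∉ ok c<p
    with c≮r , ok' ← ∧-true {not (c <ᵇ r)} ok
    with crossing-carry c r q i un (λ e → j∉ (there e)) ok' (λ _ → r<c c≮r)
    where
    r<c : not (c <ᵇ r) ≡ true → r < c
    r<c e with <-cmp c r
    ... | tri> _ _ r<c = r<c
    ... | tri≈ _ c≡r _ = ⊥-elim (c≢r c≡r)
    ... | tri< c<r _ _ rewrite <ᵇ-true c<r with () ← e
  ... | inj₁ ok″ = inj₁ (∧-intro c≮r ok″)
  ... | inj₂ (double j<z z<q' q'∈ z∈) = inj₂ (double j<z z<q' (there q'∈) z∈)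

  -- As long as the column's own top label `c` < `j` is carried, it may cross `j`. A crossing can
  -- fail only after a bump has released `c`; then `c` precedes all later labels and is the 1, and
  -- `crossing-carry` supplies the 3 and the 4.
  col-valid⁻¹ : ∀ {m f a b} {τ' : Vec Tile m} {τ rs' rs} c → ColIns f a τ' τ b → InsAt j a rs' rs →
    Unique (c ∷ toList rs') → j ∉ c ∷ toList rs' → colOK c rs' τ' ≡ true → c < j →
    colOK c rs τ ≡ true ⊎ Pattern j b (colStep c rs' τ')
  col-valid⁻¹ c straight here un j∉ ok c<j rewrite <ᵇ-true c<j = inj₁ ok
  col-valid⁻¹ {rs' = _ ∷ _} c descend here un j∉ ok c<j = inj₁ ok
  col-valid⁻¹ {rs' = []} c diagonal here un j∉ ok c<j = inj₁ refl
  col-valid⁻¹ c (below {x = cross} q) (there {x = r} i) ((c≢r ∷ c≢) ∷ _ ∷ un) j∉ ok c<j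
    with c<r , ok' ← ∧-true {c <ᵇ r} ok
    with col-valid⁻¹ c q i (c≢ ∷ un) (λ { (here e) → j∉ (here e) ; (there e) → j∉ (there (there e)) }) ok' c<j
  ... | inj₁ ok″ = inj₁ (∧-intro c<r ok″)
  ... | inj₂ (pattern1423 x<j j<q q<q' bf af) = inj₂ (pattern1423 x<j j<q q<q' (there bf) af)
  col-valid⁻¹ c (below {x = bump} q) (there {x = r} i) (_ ∷ un) j∉ ok c<j
    with crossing-carry c r q i un (λ e → j∉ (there e)) ok (λ ())
  ... | inj₁ ok″ = inj₁ ok″
  ... | inj₂ (double j<z z<q' (here refl) z∈) = ⊥-elim (<-asym c<j (<-trans j<z z<q'))
  ... | inj₂ (double j<z z<q' (there q'∈) z∈) = inj₂ (pattern1423 c<j j<z z<q' (here q'∈) z∈)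
  col-valid⁻¹ c (below {x = mbump} q) (there {x = r} i) ((c≢r ∷ c≢) ∷ un) j∉ ok c<j
    with c≮r , ok' ← ∧-true {not (c <ᵇ r)} ok
    with crossing-carry c r q i un (λ e → j∉ (there e)) ok' (λ _ → r<c c≮r)
    where
    r<c : not (c <ᵇ r) ≡ true → r < c
    r<c e with <-cmp c r
    ... | tri> _ _ r<c = r<c
    ... | tri≈ _ c≡r _ = ⊥-elim (c≢r c≡r)
    ... | tri< c<r _ _ rewrite <ᵇ-true c<r with () ← e
  ... | inj₁ ok″ = inj₁ (∧-intro c≮r ok″)
  ... | inj₂ (double j<z z<q' (here refl) z∈) = ⊥-elim (<-asym c<j (<-trans j<z z<q'))
  ... | inj₂ (double j<z z<q' (there q'∈) z∈) = inj₂ (pattern1423 c<j j<z z<q' (here q'∈) z∈)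

  CrossBump-valid : ∀ {m r} {τ : Vec Tile m} → CrossBump r τ → ∀ rs → All (j <_) (toList rs) → colOK j rs τ ≡ true
  CrossBump-valid [] [] _ = refl
  CrossBump-valid (cross c) (x ∷ rs) (j<x ∷ a) = ∧-intro (<ᵇ-true j<x) (CrossBump-valid c rs a)
  CrossBump-valid (bump c) (x ∷ rs) _ = bumps-valid c x rs
    where
    bumps-valid : ∀ {m} {τ : Vec Tile m} → CrossBump 0 τ → ∀ c rs → colOK c rs τ ≡ true
    bumps-valid [] c [] = refl
    bumps-valid (bump p) c (r ∷ rs) = bumps-valid p r rs

  removes-∉ : ∀ {n b} {ts' : Vec ℕ n} {ts P' P} → Removes j ts' ts P' P b → Increasing ts → j ∉ toList ts'
  removes-∉ (here c) (a ∷ i) j∈ = <-irrefl refl (All.lookup (toList⁺ a) j∈)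
  removes-∉ (there p q) (a ∷ i) (here refl) = <-irrefl refl (proj₁ (removes-All p a))
  removes-∉ (there p q) (a ∷ i) (there j∈) = removes-∉ p i j∈

  -- A failure in an inner column yields a pattern in the labels leaving that column, which the
  -- persistence lemmas carry to the left boundary. They need the columns on the left to be valid
  -- already, so the leftmost column is checked first.
  removes-valid⁻¹ : ∀ {n b} {ts' : Vec ℕ n} {ts P' P} → Removes j ts' ts P' P b → Increasing ts →
    ¬ Pattern j b (run ts' P') → valid ts' P' ≡ true → valid ts P ≡ true
  removes-valid⁻¹ {ts' = ts'} {P' = P'} (here c) (a ∷ i) np ok =
    ∧-intro (CrossBump-valid c (run ts' P') (All-resp-↭ (↭-sym (run-↭ ts' P')) (toList⁺ a))) ok
  removes-valid⁻¹ (there {t = t} {ts' = ts'} {ts = ts} {P' = P'} {P = P} {τ' = τ'} p q) inc@(a ∷ i) np ok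
    with ok₁ , ok₂ ← ∧-true {colOK t (run ts' P') τ'} ok
    with t<j , t<ts' ← removes-All p a
    with col-valid⁻¹ t q (removes-run p)
           (All.map <⇒≢ (All-resp-↭ (↭-sym (run-↭ ts' P')) (toList⁺ t<ts')) ∷ run-Unique (removes-Increasing p i) P')
           (λ { (here refl) → <-irrefl refl t<j ; (there j∈) → removes-∉ p i (∈-resp-↭ (run-↭ ts' P') j∈) })
           ok₁ t<j
  ... | inj₂ pat = ⊥-elim (np pat)
  ... | inj₁ ok₁' = ∧-intro ok₁' (removes-valid⁻¹ p i np' ok₂)
    where
    np' : ¬ Pattern j _ (run ts' P')
    np' (pattern1423 x<j j<q q<q' bf af)
      with _ , y<j , bf' ← Before-persists t q (removes-run p) ok₁' t<j x<j (<-trans j<q q<q') bf =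
      np (pattern1423 y<j j<q q<q' bf' (after-persists (run ts' P') t q af))

-- Uniqueness and existence of the way back

col-det : ∀ {m f a b b'} {τ' τ'' : Vec Tile m} {τ} → ColIns f a τ' τ b → ColIns f a τ'' τ b' → τ' ≡ τ''
col-det straight straight = refl
col-det descend descend = refl
col-det diagonal diagonal = refl
col-det (below p) (below q) = cong (_ ∷_) (col-det p q)

col-det⁻¹ : ∀ {m f a a' b} {τ' : Vec Tile m} {τ σ} → ColIns f a τ' τ b → ColIns f a' τ' σ b → a ≡ a' × τ ≡ σ
col-det⁻¹ straight straight = refl , refl
col-det⁻¹ descend descend = refl , refl
col-det⁻¹ diagonal diagonal = refl , refl
col-det⁻¹ (below p) (below q) with col-det⁻¹ p q
... | refl , refl = refl , refl

CrossBump-det : ∀ {m r} {τ σ : Vec Tile m} → CrossBump r τ → CrossBump r σ → τ ≡ σ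
CrossBump-det [] [] = refl
CrossBump-det (bump c) (bump d) = cong (bump ∷_) (CrossBump-det c d)
CrossBump-det (cross c) (cross d) = cong (cross ∷_) (CrossBump-det c d)

removes-det : ∀ {j n b b'} {ts' ts'' : Vec ℕ n} {ts P' P'' P} → Increasing ts →
  Removes j ts' ts P' P b → Removes j ts'' ts P'' P b' → P' ≡ P''
removes-det i (here c) (here d) = refl
removes-det (a ∷ i) (here c) (there q s) = ⊥-elim (<-irrefl refl (proj₁ (removes-All q a)))
removes-det (a ∷ i) (there p r) (here d) = ⊥-elim (<-irrefl refl (proj₁ (removes-All p a)))
removes-det (_ ∷ i) (there p r) (there q s)
  with refl ← just-injective (trans (sym (exitPos-complete i p)) (exitPos-complete i q)) =
  cong₂ _∷_ (col-det r s) (removes-det i p q)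

removes-det⁻¹ : ∀ {j n b} {ts' : Vec ℕ n} {ts P' P Q} → Increasing ts →
  Removes j ts' ts P' P b → Removes j ts' ts P' Q b → P ≡ Q
removes-det⁻¹ i (here c) (here d) = cong (_∷ _) (CrossBump-det c d)
removes-det⁻¹ (a ∷ i) (here c) (there q s) = ⊥-elim (<-irrefl refl (proj₁ (removes-All q a)))
removes-det⁻¹ (a ∷ i) (there p r) (here d) = ⊥-elim (<-irrefl refl (proj₁ (removes-All p a)))
removes-det⁻¹ (_ ∷ i) (there p r) (there q s) with col-det⁻¹ r s
... | refl , e = cong₂ _∷_ e (removes-det⁻¹ i p q)

-- The tile just above the exit decides: an unmarked bump forces `descend`, the diagonal forces
-- `diagonal`, and a cross or a marked bump forces `straight`. For `b` = 0 the tile above is the one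
-- recorded by `f`.
col-exists : ∀ {m} f b (τ' : Vec Tile m) → b ≤ suc m → (b ≡ 0 → f ≡ false) → ∃₂ λ a τ → ColIns f a τ' τ b
col-exists f zero τ' b≤ h with refl ← h refl = _ , _ , straight
col-exists f (suc zero) [] b≤ h = _ , _ , diagonal
col-exists f (suc zero) (bump ∷ τ') b≤ h = _ , _ , descend
col-exists f (suc zero) (cross ∷ τ') b≤ h = _ , _ , below straight
col-exists f (suc zero) (mbump ∷ τ') b≤ h = _ , _ , below straight
col-exists f (suc (suc b)) (x ∷ τ') (s≤s b≤) h with col-exists (isBump x) (suc b) τ' b≤ (λ ())
... | _ , _ , p = _ , _ , below p
col-exists f (suc (suc b)) [] (s≤s ()) h

CrossBump-exists : ∀ m r → r ≤ m → ∃ λ (τ : Vec Tile m) → CrossBump r τ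
CrossBump-exists zero    zero    r≤m = _ , []
CrossBump-exists (suc m) zero    r≤m = _ , bump (proj₂ (CrossBump-exists m zero z≤n))
CrossBump-exists (suc m) (suc r) (s≤s r≤m) = _ , cross (proj₂ (CrossBump-exists m r r≤m))

removes-exists : ∀ {j a n} {ts' : Vec ℕ n} {ts} → InsAt j a ts' ts → ∀ P' b → b ≤ n →
  ∃ λ P → Removes j ts' ts P' P b
removes-exists {n = n} here P' b b≤n = _ , here (proj₂ (CrossBump-exists n b b≤n))
removes-exists (there i) (τ' ∷ P') b b≤n with col-exists false b τ' b≤n (λ _ → refl)
... | a , _ , q = _ , there (proj₂ (removes-exists i P' a (col-enter-≤ q))) q

removes-InsAt : ∀ {j n b} {ts' : Vec ℕ n} {ts P' P} → Removes j ts' ts P' P b → ∃ λ a → InsAt j a ts' ts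
removes-InsAt (here c)    = _ , here
removes-InsAt (there p q) = _ , there (proj₂ (removes-InsAt p))

InsAt-split : ∀ {j n b} {v : Vec ℕ n} {v' u L} → InsAt j b v v' → toList v' ≡ u ++ j ∷ L →
  j ∉ u → j ∉ toList v → toList v ≡ u ++ L × b ≡ length u
InsAt-split {u = []} here e j∉u j∉v = ∷-injectiveʳ e , refl
InsAt-split {u = x ∷ u} here e j∉u j∉v = ⊥-elim (j∉u (here (∷-injectiveˡ e)))
InsAt-split {u = []} (there i) e j∉u j∉v = ⊥-elim (j∉v (here (sym (∷-injectiveˡ e))))
InsAt-split {u = x ∷ u} (there i) e j∉u j∉v with InsAt-split i (∷-injectiveʳ e) (λ p → j∉u (there p)) (λ p → j∉v (there p))
... | e' , refl = cong₂ _∷_ (∷-injectiveˡ e) e' , refl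

InsAt-join : ∀ {j n} u {L} {v : Vec ℕ n} {v'} → InsAt j (length u) v v' → toList v ≡ u ++ L → toList v' ≡ u ++ j ∷ L
InsAt-join [] here e = cong (_ ∷_) e
InsAt-join (x ∷ u) (there i) e = cong₂ _∷_ (∷-injectiveˡ e) (InsAt-join u i (∷-injectiveʳ e))

InsAt-All : ∀ {j n a t} {v : Vec ℕ n} {w} → InsAt j a v w → Allⱽ (t <_) w → t < j
InsAt-All here (q ∷ _) = q
InsAt-All (there s) (_ ∷ qs) = InsAt-All s qs

InsAt-det : ∀ {j n a b} {v v' : Vec ℕ n} {w} → Increasing w → InsAt j a v w → InsAt j b v' w → v ≡ v'
InsAt-det i here here = refl
InsAt-det (q ∷ i) here (there s) = ⊥-elim (<-irrefl refl (InsAt-All s q))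
InsAt-det (q ∷ i) (there s) here = ⊥-elim (<-irrefl refl (InsAt-All s q))
InsAt-det (_ ∷ i) (there r) (there s) = cong (_ ∷_) (InsAt-det i r s)

-- Counting by bijections

count-++ : ∀ {A : Set} (p : A → Bool) xs ys → count p (xs ++ ys) ≡ count p xs + count p ys
count-++ p []       ys = refl
count-++ p (x ∷ xs) ys with p x
... | true  = cong suc (count-++ p xs ys)
... | false = count-++ p xs ys

-- The partner of the first element is cut out of `ys`; since `R` is injective, no later element
-- needs it.
count-injection : ∀ {A B : Set} (R : A → B → Set) (p : A → Bool) (q : B → Bool) xs ys → Unique xs →
  (∀ {x} → x ∈ xs → p x ≡ true → ∃ λ y → y ∈ ys × q y ≡ true × R x y) →
  (∀ {x x' y} → R x y → R x' y → x ≡ x') → count p xs ≤ count q ys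
count-injection R p q []       ys un f inj = z≤n
count-injection R p q (x ∷ xs) ys (x∉ ∷ un) f inj with p x in px
... | false = count-injection R p q xs ys un (λ x∈ → f (there x∈)) inj
... | true with f (here refl) px
...   | y , y∈ , qy , r with ys₁ , ys₂ , refl ← ∈-∃++ y∈ =
  ≤-trans (s≤s (count-injection R p q xs (ys₁ ++ ys₂) un g inj)) (≤-reflexive eq)
  where
  g : ∀ {x'} → x' ∈ xs → p x' ≡ true → ∃ λ y' → y' ∈ ys₁ ++ ys₂ × q y' ≡ true × R x' y'
  g x'∈ px' with f (there x'∈) px'
  ... | y' , y'∈ , qy' , r' with ∈-++⁻ ys₁ y'∈
  ...   | inj₁ y'∈₁ = y' , ∈-++⁺ˡ y'∈₁ , qy' , r'
  ...   | inj₂ (here refl) = ⊥-elim (All.lookup x∉ x'∈ (inj r r'))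
  ...   | inj₂ (there y'∈₂) = y' , ∈-++⁺ʳ ys₁ y'∈₂ , qy' , r'
  eq : suc (count q (ys₁ ++ ys₂)) ≡ count q (ys₁ ++ y ∷ ys₂)
  eq rewrite count-++ q ys₁ ys₂ | count-++ q ys₁ (y ∷ ys₂) | qy = sym (+-suc (count q ys₁) (count q ys₂))

firstRow : ∀ {n} → PD (suc n) → Vec Tile n
firstRow ([] ∷ [])      = []
firstRow ((x ∷ τ) ∷ P)  = x ∷ firstRow P

restRows : ∀ {n} → PD (suc n) → PD n
restRows ([] ∷ [])     = []
restRows ((x ∷ τ) ∷ P) = τ ∷ restRows P

consRow-rows : ∀ {n} (P : PD (suc n)) → consRow (firstRow P) (restRows P) ≡ P
consRow-rows ([] ∷ [])     = refl
consRow-rows ((x ∷ τ) ∷ P) = cong ((x ∷ τ) ∷_) (consRow-rows P)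

firstRow-consRow : ∀ {n} (ρ : Vec Tile n) P → firstRow (consRow ρ P) ≡ ρ
firstRow-consRow []      []      = refl
firstRow-consRow (x ∷ ρ) (τ ∷ P) = cong (x ∷_) (firstRow-consRow ρ P)

restRows-consRow : ∀ {n} (ρ : Vec Tile n) P → restRows (consRow ρ P) ≡ P
restRows-consRow []      []      = refl
restRows-consRow (x ∷ ρ) (τ ∷ P) = cong (τ ∷_) (restRows-consRow ρ P)

fromPD : ∀ {n} → PD n → List Tile
fromPD {zero}  P = []
fromPD {suc n} P = toList (firstRow P) ++ fromPD (restRows P)

length-fromPD : ∀ {n} (P : PD n) → length (fromPD P) ≡ tri n
length-fromPD {zero}  P = refl
length-fromPD {suc n} P = trans (length-++ (toList (firstRow P)))
  (cong₂ _+_ (length-toList (firstRow P)) (length-fromPD (restRows P)))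

rowFrom-++ : ∀ {n} (ρ : Vec Tile n) F → rowFrom n (toList ρ ++ F) ≡ ρ
rowFrom-++ []      F = refl
rowFrom-++ (x ∷ ρ) F = cong (x ∷_) (rowFrom-++ ρ F)

drop-toList : ∀ {n} (ρ : Vec Tile n) F → drop n (toList ρ ++ F) ≡ F
drop-toList []      F = refl
drop-toList (x ∷ ρ) F = drop-toList ρ F

toPD-fromPD : ∀ {n} (P : PD n) → toPD n (fromPD P) ≡ P
toPD-fromPD {zero}  [] = refl
toPD-fromPD {suc n} P
  rewrite rowFrom-++ (firstRow P) (fromPD (restRows P)) | drop-toList (firstRow P) (fromPD (restRows P))
        | toPD-fromPD (restRows P) = consRow-rows P

rowFrom-drop : ∀ n F → n ≤ length F → toList (rowFrom n F) ++ drop n F ≡ F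
rowFrom-drop zero    F       n≤ = refl
rowFrom-drop (suc n) (x ∷ F) (s≤s n≤) = cong (x ∷_) (rowFrom-drop n F n≤)

length-drop-+ : ∀ n m (F : List Tile) → length F ≡ n + m → length (drop n F) ≡ m
length-drop-+ zero    m F e = e
length-drop-+ (suc n) m (x ∷ F) e = length-drop-+ n m F (suc-injective e)

fromPD-toPD : ∀ n F → length F ≡ tri n → fromPD (toPD n F) ≡ F
fromPD-toPD zero    [] e = refl
fromPD-toPD (suc n) F e
  rewrite firstRow-consRow (rowFrom n F) (toPD n (drop n F)) | restRows-consRow (rowFrom n F) (toPD n (drop n F))
        | fromPD-toPD n (drop n F) (length-drop-+ n (tri n) F e) =
  rowFrom-drop n F (subst (n ≤_) (sym e) (m≤m+n n (tri n)))

private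
  three : List Tile → List (List Tile)
  three F = (cross ∷ F) ∷ (bump ∷ F) ∷ (mbump ∷ F) ∷ []

three-≢ : ∀ {F t} Fs → All (F ≢_) Fs → All ((t ∷ F) ≢_) (concatMap three Fs)
three-≢ [] [] = []
three-≢ (G ∷ Fs) (F≢G ∷ a) = (λ e → F≢G (∷-injectiveʳ e)) ∷ (λ e → F≢G (∷-injectiveʳ e)) ∷
  (λ e → F≢G (∷-injectiveʳ e)) ∷ three-≢ Fs a

three-unique : ∀ Fs → Unique Fs → Unique (concatMap three Fs)
three-unique [] [] = []
three-unique (F ∷ Fs) (a ∷ un) =
  ((λ ()) ∷ (λ ()) ∷ three-≢ Fs a) ∷ ((λ ()) ∷ three-≢ Fs a) ∷ three-≢ Fs a ∷ three-unique Fs un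

tileLists-unique : ∀ m → Unique (tileLists m)
tileLists-unique zero    = [] ∷ []
tileLists-unique (suc m) = three-unique (tileLists m) (tileLists-unique m)

three-∈ : ∀ t {F} Fs → F ∈ Fs → (t ∷ F) ∈ concatMap three Fs
three-∈ cross (_ ∷ Fs) (here refl) = here refl
three-∈ bump  (_ ∷ Fs) (here refl) = there (here refl)
three-∈ mbump (_ ∷ Fs) (here refl) = there (there (here refl))
three-∈ t     (_ ∷ Fs) (there p)   = there (there (there (three-∈ t Fs p)))

tileLists-complete : ∀ F → F ∈ tileLists (length F)
tileLists-complete []      = here refl
tileLists-complete (t ∷ F) = three-∈ t (tileLists (length F)) (tileLists-complete F)

three-length : ∀ {m F} Fs → All (λ G → length G ≡ m) Fs → F ∈ concatMap three Fs → length F ≡ suc m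
three-length (G ∷ Fs) (e ∷ a) (here refl) = cong suc e
three-length (G ∷ Fs) (e ∷ a) (there (here refl)) = cong suc e
three-length (G ∷ Fs) (e ∷ a) (there (there (here refl))) = cong suc e
three-length (G ∷ Fs) (e ∷ a) (there (there (there p))) = three-length Fs a p

tileLists-length : ∀ m → All (λ F → length F ≡ m) (tileLists m)
tileLists-length zero    = refl ∷ []
tileLists-length (suc m) = All.tabulate (three-length (tileLists m) (tileLists-length m))

allPD-complete : ∀ {n} (P : PD n) → P ∈ allPD n
allPD-complete {n} P = subst (_∈ allPD n) (toPD-fromPD P)
  (∈-map⁺ (toPD n) (subst (λ m → fromPD P ∈ tileLists m) (trans (length-fromPD P) (sym (length-cells n))) (tileLists-complete (fromPD P))))

-- A repetition would survive `fromPD`, but `fromPD` recovers the tile lists, which are distinct.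
allPD-unique : ∀ n → Unique (allPD n)
allPD-unique n = Uniqueₚ.map⁻ {f = fromPD} (subst Unique (sym (inverse (fillings n) lengths)) (tileLists-unique (length (cells n))))
  where
  lengths : All (λ F → length F ≡ tri n) (fillings n)
  lengths = All.map (λ e → trans e (length-cells n)) (tileLists-length (length (cells n)))
  inverse : ∀ Fs → All (λ F → length F ≡ tri n) Fs → map fromPD (map (toPD n) Fs) ≡ Fs
  inverse []       []      = refl
  inverse (F ∷ Fs) (e ∷ a) = cong₂ _∷_ (fromPD-toPD n F e) (inverse Fs a)

count-≡ : ∀ {m n} (R : PD m → PD n → Set) (p : PD m → Bool) (q : PD n → Bool) →
  (∀ {P} → p P ≡ true → ∃ λ Q → q Q ≡ true × R P Q) →
  (∀ {Q} → q Q ≡ true → ∃ λ P → p P ≡ true × R P Q) →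
  (∀ {P P' Q} → R P Q → R P' Q → P ≡ P') →
  (∀ {P Q Q'} → R P Q → R P Q' → Q ≡ Q') →
  count p (allPD m) ≡ count q (allPD n)
count-≡ {m} {n} R p q f g inj inj' = ≤-antisym
  (count-injection R p q (allPD m) (allPD n) (allPD-unique m)
    (λ _ pP → let Q , qQ , r = f pP in Q , allPD-complete Q , qQ , r) inj)
  (count-injection (λ Q P → R P Q) q p (allPD n) (allPD m) (allPD-unique n)
    (λ _ qQ → let P , pP , r = g qQ in P , allPD-complete P , pP , r) inj')

noneRemovable : ∀ {n} → List ℕ → Vec ℕ n → PD n → Bool
noneRemovable []      ts P = true
noneRemovable (l ∷ L) ts P = not (removable l ts P) ∧ noneRemovable L ts P

noneRemovable-invariant : ∀ {j n b} {ts' : Vec ℕ n} {ts P' P} → Increasing ts →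
  Removes j ts' ts P' P b → ∀ L → j ∉ L → noneRemovable L ts P ≡ noneRemovable L ts' P'
noneRemovable-invariant i p []      j∉ = refl
noneRemovable-invariant i p (l ∷ L) j∉ = cong₂ (λ x y → not x ∧ y)
  (removable-invariant i p (λ e → j∉ (here e))) (noneRemovable-invariant i p L (λ q → j∉ (there q)))

at-++ˡ : ∀ u {v} i → i < length u → at (u ++ v) i ≡ at u i
at-++ˡ (x ∷ u) zero    i< = refl
at-++ˡ (x ∷ u) (suc i) (s≤s i<) = at-++ˡ u i i<

at-++ʳ : ∀ u {v} i → at (u ++ v) (length u + i) ≡ at v i
at-++ʳ []      i = refl
at-++ʳ (x ∷ u) i = at-++ʳ u i

∈-at : ∀ {x u} → x ∈ u → ∃ λ i → i < length u × at u i ≡ x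
∈-at (here refl) = 0 , s≤s z≤n , refl
∈-at (there p) with i , i< , e ← ∈-at p = suc i , s≤s i< , e

Before-at : ∀ {x y u} → Before x y u → ∃₂ λ i k → i < k × k < length u × at u i ≡ x × at u k ≡ y
Before-at (here y∈) with k , k< , e ← ∈-at y∈ = 0 , suc k , s≤s z≤n , s≤s k< , refl , e
Before-at (there b) with i , k , i<k , k< , e , e' ← Before-at b = suc i , suc k , s≤s i<k , s≤s k< , e , e'

take-length-++ : ∀ (u : List ℕ) v → take (length u) (u ++ v) ≡ u
take-length-++ []      v = refl
take-length-++ (x ∷ u) v = cong (x ∷_) (take-length-++ u v)

drop-length-++ : ∀ (u : List ℕ) v → drop (length u) (u ++ v) ≡ v
drop-length-++ []      v = refl
drop-length-++ (x ∷ u) v = drop-length-++ u v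

no-Pattern : ∀ {j n} u L {v : Vec ℕ n} → Avoids1423 (u ++ j ∷ L) → toList v ≡ u ++ L → ¬ Pattern j (length u) v
no-Pattern {j} u L {v} av e (pattern1423 x<j j<q q<q' bf af) rewrite e | take-length-++ u L | drop-length-++ u L
  with i , k , i<k , k< , refl , refl ← Before-at bf | m , m< , refl ← ∈-at af =
  av i k (length u) (length u + suc m) i<k k< (subst (length u <_) (sym (+-suc (length u) m)) (s≤s (m≤m+n (length u) m)))
    (subst (length u + suc m <_) (sym (length-++ u)) (+-monoʳ-< (length u) (s≤s m<)))
    (subst₂ _<_ (sym (at-++ˡ u i (<-trans i<k k<))) (sym at-j) x<j)
    (subst₂ _<_ (sym at-j) (sym (at-++ʳ u (suc m))) j<q)
    (subst₂ _<_ (sym (at-++ʳ u (suc m))) (sym (at-++ˡ u k k<)) q<q')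
  where
  at-j : at (u ++ j ∷ L) (length u) ≡ j
  at-j = trans (cong (at (u ++ j ∷ L)) (sym (+-identityʳ (length u)))) (at-++ʳ u 0)

isPDof-split : ∀ {n} {ts : Vec ℕ n} {w k P} → isPDof ts w k P ≡ true →
  valid ts P ≡ true × toList (run ts P) ≡ w × (marks P ≡ᵇ k) ≡ true
isPDof-split {ts = ts} {w} {k} {P} e with a , e' ← ∧-true {valid ts P} e with b , c ← ∧-true e' =
  a , listEqᵇ-sound _ w b , c

isPDof-join : ∀ {n} {ts : Vec ℕ n} {w k P} → valid ts P ≡ true → toList (run ts P) ≡ w → (marks P ≡ᵇ k) ≡ true →
  isPDof ts w k P ≡ true
isPDof-join {ts = ts} {P = P} a refl c = ∧-intro a (∧-intro (listEqᵇ-refl (toList (run ts P))) c)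

-- Erasing `l` is a bijection once its exit is fixed, and the exit is forced to be the position
-- `length u` of `l` in the word. The condition on `L` is carried along by
-- `noneRemovable-invariant`, and the pipes of `u` are left free.
count-remove : ∀ {n a} (ts : Vec ℕ (suc n)) ts' l u L k → Increasing ts → InsAt l a ts' ts →
  Avoids1423 (u ++ l ∷ L) → Unique (u ++ l ∷ L) → u ++ l ∷ L ↭ toList ts →
  count (λ P → isPDof ts (u ++ l ∷ L) k P ∧ removable l ts P ∧ noneRemovable L ts P) (allPD (suc n)) ≡
  count (λ P → isPDof ts' (u ++ L) k P ∧ noneRemovable L ts' P) (allPD n)
count-remove {n} ts ts' l u L k inc ins av un w↭ =
  count-≡ (λ P P' → Removes l ts' ts P' P (length u)) _ _ to from
    (λ r r' → removes-det⁻¹ inc r r') (λ r r' → removes-det inc r r')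
  where
  l∉u : l ∉ u
  l∉u l∈ = go u un l∈
    where
    go : ∀ u → Unique (u ++ l ∷ L) → l ∈ u → ⊥
    go (x ∷ u) (a ∷ un) (here refl) = All.lookup a (∈-++⁺ʳ u (here refl)) refl
    go (x ∷ u) (a ∷ un) (there p)   = go u un p
  l∉L : l ∉ L
  l∉L l∈ = go u un
    where
    go : ∀ u → Unique (u ++ l ∷ L) → ⊥
    go []      (a ∷ un) = All.lookup a l∈ refl
    go (x ∷ u) (a ∷ un) = go u un
  to : ∀ {P} → isPDof ts (u ++ l ∷ L) k P ∧ removable l ts P ∧ noneRemovable L ts P ≡ true →
    ∃ λ P' → isPDof ts' (u ++ L) k P' ∧ noneRemovable L ts' P' ≡ true × Removes l ts' ts P' P (length u)
  to {P} e with pd , e' ← ∧-true e with rm , nn ← ∧-true {removable l ts P} e'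
    with ok , rn , mk ← isPDof-split {ts = ts} {u ++ l ∷ L} {k} {P} pd
    with ts″ , P' , b , r ← removable⇒ l ts P rm
    with refl ← InsAt-det inc ins (proj₂ (removes-InsAt r))
    -- Since `l` occurs only once in the word, the exit position found for it must be `length u`.
    with rn' , refl ← InsAt-split (removes-run r) rn l∉u (λ l∈ → removes-∉ r inc (∈-resp-↭ (run-↭ ts' P') l∈)) =
    P' , ∧-intro (isPDof-join {ts = ts'} {u ++ L} {k} {P'} (removes-valid r ok) rn' (trans (cong (_≡ᵇ k) (sym (removes-marks r))) mk))
      (trans (sym (noneRemovable-invariant inc r L l∉L)) nn) , r
  from : ∀ {P'} → isPDof ts' (u ++ L) k P' ∧ noneRemovable L ts' P' ≡ true →
    ∃ λ P → isPDof ts (u ++ l ∷ L) k P ∧ removable l ts P ∧ noneRemovable L ts P ≡ true × Removes l ts' ts P' P (length u)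
  from {P'} e with pd , nn ← ∧-true e
    with ok , rn , mk ← isPDof-split {ts = ts'} {u ++ L} {k} {P'} pd
    with P , r ← removes-exists ins P' (length u)
           (subst (length u ≤_) (trans (sym (length-++ u)) (trans (cong length (sym rn)) (length-toList (run ts' P')))) (m≤m+n (length u) (length L))) =
    P , ∧-intro (isPDof-join {ts = ts} {u ++ l ∷ L} {k} {P}
          (removes-valid⁻¹ r inc (no-Pattern u L av rn) ok) (InsAt-join u (removes-run r) rn)
          (trans (cong (_≡ᵇ k) (removes-marks r)) mk))
      (∧-intro (⇒removable inc r) (trans (noneRemovable-invariant inc r L l∉L) nn)) , r

-- Relabelling and inclusion–exclusion

count-↭ : ∀ {A : Set} (p : A → Bool) {xs ys} → xs ↭ ys → count p xs ≡ count p ys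
count-↭ p Perm.refl = refl
count-↭ p (prep x σ) with p x
... | true  = cong suc (count-↭ p σ)
... | false = count-↭ p σ
count-↭ p (swap x y σ) with p x | p y
... | true  | true  = cong (λ m → suc (suc m)) (count-↭ p σ)
... | true  | false = cong suc (count-↭ p σ)
... | false | true  = cong suc (count-↭ p σ)
... | false | false = count-↭ p σ
count-↭ p (Perm.trans σ σ') = trans (count-↭ p σ) (count-↭ p σ')

count-false : ∀ {A : Set} (p : A → Bool) xs → All (λ x → p x ≡ false) xs → count p xs ≡ 0
count-false p []       []      = refl
count-false p (x ∷ xs) (e ∷ a) rewrite e = count-false p xs a

count-mono : ∀ {A : Set} (p q : A → Bool) xs → (∀ x → p x ≡ true → q x ≡ true) → count p xs ≤ count q xs
count-mono p q []       h = z≤n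
count-mono p q (x ∷ xs) h with p x in e | q x in e'
... | true  | true  = s≤s (count-mono p q xs h)
... | true  | false with () ← trans (sym e') (h x e)
... | false | true  = m≤n⇒m≤1+n (count-mono p q xs h)
... | false | false = count-mono p q xs h

count-strict : ∀ {A : Set} (p q : A → Bool) {x} xs → (∀ x → p x ≡ true → q x ≡ true) → x ∈ xs →
  p x ≡ false → q x ≡ true → count p xs < count q xs
count-strict p q (x ∷ xs) h (here refl) ep eq rewrite ep | eq = s≤s (count-mono p q xs h)
count-strict p q (y ∷ xs) h (there x∈) ep eq with p y in e | q y in e'
... | true  | true  = s≤s (count-strict p q xs h x∈ ep eq)
... | true  | false with () ← trans (sym e') (h y e)
... | false | true  = m≤n⇒m≤1+n (count-strict p q xs h x∈ ep eq)
... | false | false = count-strict p q xs h x∈ ep eq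

rank : List ℕ → ℕ → ℕ
rank w x = suc (count (λ y → y <ᵇ x) w)

rank-< : ∀ {w x y} → x ∈ w → x < y → rank w x < rank w y
rank-< {w} {x} {y} x∈ x<y = s≤s (count-strict (_<ᵇ x) (_<ᵇ y) w
  (λ z e → <ᵇ-true (<-trans (<ᵇ⇒< z x (subst T (sym e) _)) x<y)) x∈ (<ᵇ-false (<-irrefl {x} refl)) (<ᵇ-true x<y))

rank-<ᵇ : ∀ {w x y} → x ∈ w → y ∈ w → (rank w x <ᵇ rank w y) ≡ (x <ᵇ y)
rank-<ᵇ {w} {x} {y} x∈ y∈ with <-cmp x y
... | tri< x<y _ _ = trans (<ᵇ-true (rank-< {w} x∈ x<y)) (sym (<ᵇ-true x<y))
... | tri≈ x≮y refl _ = trans (<ᵇ-false (<-irrefl {rank w x} refl)) (sym (<ᵇ-false x≮y))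
... | tri> x≮y _ y<x = trans (<ᵇ-false (<-asym (rank-< {w} y∈ y<x))) (sym (<ᵇ-false x≮y))

≢⇒≡ᵇ-false : ∀ {x y} → x ≢ y → (x ≡ᵇ y) ≡ false
≢⇒≡ᵇ-false {x} {y} x≢y with x ≡ᵇ y in e
... | true  = ⊥-elim (x≢y (≡ᵇ⇒≡ x y (subst T (sym e) _)))
... | false = refl

rank-≡ᵇ : ∀ {w x y} → x ∈ w → y ∈ w → (rank w x ≡ᵇ rank w y) ≡ (x ≡ᵇ y)
rank-≡ᵇ {w} {x} {y} x∈ y∈ with <-cmp x y
... | tri< x<y x≢y _ = trans (≢⇒≡ᵇ-false (<⇒≢ (rank-< {w} x∈ x<y))) (sym (≢⇒≡ᵇ-false x≢y))
... | tri≈ _ refl _ = lem (rank w x) x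
  where
  lem : ∀ a b → (a ≡ᵇ a) ≡ (b ≡ᵇ b)
  lem a b with a ≡ᵇ a | ≡⇒≡ᵇ a a refl | b ≡ᵇ b | ≡⇒≡ᵇ b b refl
  ... | true | _ | true | _ = refl
... | tri> _ x≢y y<x = trans (≢⇒≡ᵇ-false (λ e → <⇒≢ (rank-< {w} y∈ y<x) (sym e))) (sym (≢⇒≡ᵇ-false x≢y))

-- `run` only moves labels and `valid` only compares them, so a map that preserves comparisons on
-- the labels that occur changes neither.
module Relabel (S : ℕ → Set) (f : ℕ → ℕ)
  (f-< : ∀ {x y} → S x → S y → (f x <ᵇ f y) ≡ (x <ᵇ y)) where

  colStep-map : ∀ {m} c (rs : Vec ℕ m) τ → colStep (f c) (Vec.map f rs) τ ≡ Vec.map f (colStep c rs τ)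
  colStep-map c []       []          = refl
  colStep-map c (r ∷ rs) (cross ∷ τ) = cong (f r ∷_) (colStep-map c rs τ)
  colStep-map c (r ∷ rs) (bump ∷ τ)  = cong (f c ∷_) (colStep-map r rs τ)
  colStep-map c (r ∷ rs) (mbump ∷ τ) = cong (f c ∷_) (colStep-map r rs τ)

  colOK-map : ∀ {m} c (rs : Vec ℕ m) τ → S c → All S (toList rs) → colOK (f c) (Vec.map f rs) τ ≡ colOK c rs τ
  colOK-map c []       []          sc []        = refl
  colOK-map c (r ∷ rs) (cross ∷ τ) sc (sr ∷ ss) = cong₂ _∧_ (f-< sc sr) (colOK-map c rs τ sc ss)
  colOK-map c (r ∷ rs) (bump ∷ τ)  sc (sr ∷ ss) = colOK-map r rs τ sr ss
  colOK-map c (r ∷ rs) (mbump ∷ τ) sc (sr ∷ ss) = cong₂ (λ x y → not x ∧ y) (f-< sc sr) (colOK-map r rs τ sr ss)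

  run-map : ∀ {n} (ts : Vec ℕ n) P → run (Vec.map f ts) P ≡ Vec.map f (run ts P)
  run-map []       []      = refl
  run-map (t ∷ ts) (τ ∷ P) rewrite run-map ts P = colStep-map t (run ts P) τ

  valid-map : ∀ {n} (ts : Vec ℕ n) P → All S (toList ts) → valid (Vec.map f ts) P ≡ valid ts P
  valid-map []       []      []        = refl
  valid-map (t ∷ ts) (τ ∷ P) (st ∷ ss) rewrite run-map ts P =
    cong₂ _∧_ (colOK-map t (run ts P) τ st (All-resp-↭ (↭-sym (run-↭ ts P)) ss)) (valid-map ts P ss)

-- `m` counts the smaller labels already stripped off the front.
rank-rangeV : ∀ {n} m (ts : Vec ℕ n) → Increasing ts → ∀ (f : ℕ → ℕ) →
  (∀ {x} → x ∈ toList ts → f x ≡ suc (m + count (_<ᵇ x) (toList ts))) → Vec.map f ts ≡ rangeV (suc m) n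
rank-rangeV m []       []      f h = refl
rank-rangeV m (t ∷ ts) (a ∷ i) f h = cong₂ _∷_
  (trans (h (here refl)) (cong suc (trans (cong (m +_) zero-count) (+-identityʳ m))))
  (rank-rangeV (suc m) ts i f (λ {x} x∈ → trans (h (there x∈)) (cong suc (step x (All.lookup (toList⁺ a) x∈)))))
  where
  zero-count : count (_<ᵇ t) (t ∷ toList ts) ≡ 0
  zero-count rewrite <ᵇ-false (<-irrefl {t} refl) =
    count-false (_<ᵇ t) (toList ts) (All.map (λ t<x → <ᵇ-false (<-asym t<x)) (toList⁺ a))
  step : ∀ x → t < x → m + count (_<ᵇ x) (t ∷ toList ts) ≡ suc m + count (_<ᵇ x) (toList ts)
  step x t<x rewrite <ᵇ-true t<x = +-suc m _

module _ {n} (ts : Vec ℕ n) (w : List ℕ) (inc : Increasing ts) (w↭ : w ↭ toList ts) where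

  rank-tops : Vec.map (rank w) ts ≡ rangeV 1 n
  rank-tops = rank-rangeV 0 ts inc (rank w) (λ {x} _ → cong suc (count-↭ (_<ᵇ x) w↭))

  perm-↭ : perm w ↭ oneTo n
  perm-↭ = ↭-trans (↭-map⁺ (rank w) w↭)
    (↭-reflexive (trans (sym (toList-map (rank w) ts)) (trans (cong toList rank-tops) (toList-rangeV 1 n))))

  isPDof-rank : ∀ k P → isPDof (rangeV 1 n) (perm w) k P ≡ isPDof ts w k P
  isPDof-rank k P rewrite sym rank-tops = cong₂ (λ x y → x ∧ y ∧ (marks P ≡ᵇ k))
    (valid-map ts P (All.tabulate (∈-resp-↭ (↭-sym w↭))))
    (trans (cong (λ u → listEqᵇ u (map (rank w) w)) (trans (cong toList (run-map ts P)) (toList-map (rank w) (run ts P))))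
      (listEqᵇ-map (toList (run ts P)) w
        (All.tabulate (λ p → ∈-resp-↭ (↭-sym w↭) (∈-resp-↭ (run-↭ ts P) p))) (All.tabulate (λ p → p))))
    where
    open Relabel (_∈ w) (rank w) (rank-<ᵇ {w})
    listEqᵇ-map : ∀ u v → All (_∈ w) u → All (_∈ w) v → listEqᵇ (map (rank w) u) (map (rank w) v) ≡ listEqᵇ u v
    listEqᵇ-map []      []      _        _        = refl
    listEqᵇ-map []      (y ∷ v) _        _        = refl
    listEqᵇ-map (x ∷ u) []      _        _        = refl
    listEqᵇ-map (x ∷ u) (y ∷ v) (p ∷ a) (q ∷ b) = cong₂ _∧_ (rank-≡ᵇ {w} p q) (listEqᵇ-map u v a b)

count-cong : ∀ {A : Set} {p q : A → Bool} → (∀ x → p x ≡ q x) → ∀ xs → count p xs ≡ count q xs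
count-cong e []       = refl
count-cong {q = q} e (x ∷ xs) rewrite e x with q x
... | true  = cong suc (count-cong e xs)
... | false = count-cong e xs

Υ-perm : ∀ {n} (ts : Vec ℕ n) w k → Increasing ts → w ↭ toList ts →
  Υ (perm w) k ≡ ℤ+ count (isPDof ts w k) (allPD n)
Υ-perm {n} ts w k inc w↭ = trans (Υ-count n (perm w) (perm-↭ ts w inc w↭) k)
  (cong ℤ+_ (count-cong (isPDof-rank ts w inc w↭ k) (allPD n)))

InsAt-↭ : ∀ {l a n} {v : Vec ℕ n} {v'} → InsAt l a v v' → toList v' ↭ l ∷ toList v
InsAt-↭ here = ↭-refl
InsAt-↭ (there {x = x} i) = ↭-trans (prep x (InsAt-↭ i)) (swap x _ ↭-refl)

InsAt-Increasing : ∀ {l a n} {v : Vec ℕ n} {v'} → InsAt l a v v' → Increasing v' → Increasing v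
InsAt-Increasing here (_ ∷ i) = i
InsAt-Increasing (there s) (q ∷ i) = remove s q ∷ InsAt-Increasing s i
  where
  remove : ∀ {l a n t} {v : Vec ℕ n} {v'} → InsAt l a v v' → Allⱽ (t <_) v' → Allⱽ (t <_) v
  remove here (_ ∷ qs) = qs
  remove (there s) (q ∷ qs) = q ∷ remove s qs

∈-InsAt : ∀ {l n} (v' : Vec ℕ (suc n)) → l ∈ toList v' → ∃₂ λ v a → InsAt l a v v'
∈-InsAt (x ∷ v') (here refl) = v' , 0 , here
∈-InsAt {n = zero} (x ∷ []) (there ())
∈-InsAt {n = suc n} (x ∷ v') (there p) with v , a , i ← ∈-InsAt v' p = x ∷ v , suc a , there i

shift : ℕ → ℕ → ℕ
shift zero    i       = suc i
shift (suc m) zero    = zero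
shift (suc m) (suc i) = suc (shift m i)

shift-mono : ∀ m {i k} → i < k → shift m i < shift m k
shift-mono zero    i<k = s≤s i<k
shift-mono (suc m) {zero}  {suc k} i<k = s≤s z≤n
shift-mono (suc m) {suc i} {suc k} (s≤s i<k) = s≤s (shift-mono m i<k)

at-shift : ∀ u l L i → at (u ++ l ∷ L) (shift (length u) i) ≡ at (u ++ L) i
at-shift []      l L i       = refl
at-shift (x ∷ u) l L zero    = refl
at-shift (x ∷ u) l L (suc i) = at-shift u l L i

shift-length : ∀ (u : List ℕ) l L {i} → i < length (u ++ L) → shift (length u) i < length (u ++ l ∷ L)
shift-length []      l L i< = s≤s i<
shift-length (x ∷ u) l L {zero}  i< = s≤s z≤n
shift-length (x ∷ u) l L {suc i} (s≤s i<) = s≤s (shift-length u l L i<)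

Avoids-remove : ∀ u l L → Avoids1423 (u ++ l ∷ L) → Avoids1423 (u ++ L)
Avoids-remove u l L av i₁ i₂ i₃ i₄ p₁ p₂ p₃ p₄ q₁ q₂ q₃ =
  av (s i₁) (s i₂) (s i₃) (s i₄) (shift-mono m p₁) (shift-mono m p₂) (shift-mono m p₃) (shift-length u l L p₄)
    (subst₂ _<_ (sym (at-shift u l L i₁)) (sym (at-shift u l L i₃)) q₁)
    (subst₂ _<_ (sym (at-shift u l L i₃)) (sym (at-shift u l L i₄)) q₂)
    (subst₂ _<_ (sym (at-shift u l L i₄)) (sym (at-shift u l L i₂)) q₃)
  where
  m = length u
  s = shift m

count-partition : ∀ {A : Set} (a r c : A → Bool) xs →
  count (λ x → a x ∧ c x) xs ≡ count (λ x → a x ∧ r x ∧ c x) xs + count (λ x → a x ∧ not (r x) ∧ c x) xs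
count-partition a r c []       = refl
count-partition a r c (x ∷ xs) with a x | r x | c x
... | true  | true  | true  = cong suc (count-partition a r c xs)
... | true  | true  | false = count-partition a r c xs
... | true  | false | true  = trans (cong suc (count-partition a r c xs)) (sym (+-suc _ _))
... | true  | false | false = count-partition a r c xs
... | false | _     | _     = count-partition a r c xs

sum-++ : ∀ (xs ys : List ℤ) → sumℤ (xs ++ ys) ≡ sumℤ xs +ℤ sumℤ ys
sum-++ []       ys = sym (ℤₚ.+-identityˡ _)
sum-++ (x ∷ xs) ys = trans (cong (x +ℤ_) (sum-++ xs ys)) (sym (ℤₚ.+-assoc x _ _))

sum-neg : ∀ {A : Set} (f g : A → ℤ) xs → All (λ x → f x ≡ ℤ- g x) xs → sumℤ (map f xs) ≡ ℤ- sumℤ (map g xs)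
sum-neg f g []       []      = refl
sum-neg f g (x ∷ xs) (e ∷ a) = trans (cong₂ _+ℤ_ e (sum-neg f g xs a)) (sym (ℤₚ.neg-distrib-+ (g x) _))

subwords-length : ∀ L → All (λ v → length v ≤ length L) (subwords L)
subwords-length []      = z≤n ∷ []
subwords-length (l ∷ L) = All-++⁺ (All.map m≤n⇒m≤1+n (subwords-length L)) (All-map⁺ (All.map s≤s (subwords-length L)))

alternating : (List ℕ → ℤ) → List ℕ → List ℕ → ℤ
alternating Y u L = sumℤ (map (λ v → negPow (length L ∸ length v) (Y (u ++ v))) (subwords L))

-- The subwords containing `l` move it to the prefix and keep their sign; those without `l` miss one
-- more letter, hence the minus sign.
alternating-∷ : ∀ Y u l L → alternating Y u (l ∷ L) ≡ alternating Y (u ++ l ∷ []) L +ℤ ℤ- alternating Y u L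
alternating-∷ Y u l L = begin
  sumℤ (map t (subwords L ++ map (l ∷_) (subwords L)))
    ≡⟨ cong sumℤ (map-++ t (subwords L) (map (l ∷_) (subwords L))) ⟩
  sumℤ (map t (subwords L) ++ map t (map (l ∷_) (subwords L)))
    ≡⟨ sum-++ (map t (subwords L)) _ ⟩
  sumℤ (map t (subwords L)) +ℤ sumℤ (map t (map (l ∷_) (subwords L)))
    ≡⟨ cong₂ _+ℤ_ (sum-neg t _ (subwords L) (All.map (λ {v} v≤ → cong (λ m → negPow m (Y (u ++ v))) (+-∸-assoc 1 v≤)) (subwords-length L)))
         (cong sumℤ (trans (sym (map-∘ (subwords L))) (regroup (subwords L)))) ⟩
  ℤ- alternating Y u L +ℤ alternating Y (u ++ l ∷ []) L
    ≡⟨ ℤₚ.+-comm (ℤ- alternating Y u L) _ ⟩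
  alternating Y (u ++ l ∷ []) L +ℤ ℤ- alternating Y u L ∎
  where
  open ≡-Reasoning
  t : List ℕ → ℤ
  t v = negPow (suc (length L) ∸ length v) (Y (u ++ v))
  regroup : ∀ vs → map (λ v → t (l ∷ v)) vs ≡ map (λ v → negPow (length L ∸ length v) (Y ((u ++ l ∷ []) ++ v))) vs
  regroup []       = refl
  regroup (v ∷ vs) = cong₂ _∷_ (cong (λ z → negPow (length L ∸ length v) (Y z)) (sym (++-assoc u (l ∷ []) v))) (regroup vs)

-- The pipes of `u` are unrestricted, those of `L` must not be removable. Forbidding `l` as well
-- means subtracting the pipe dreams in which `l` is removable, and by `count-remove` these are
-- counted by the word without `l`. The two terms match `alternating-∷`.
inclusion-exclusion : ∀ L u {n} (ts : Vec ℕ n) k → Increasing ts → u ++ L ↭ toList ts → Avoids1423 (u ++ L) →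
  ℤ+ count (λ P → isPDof ts (u ++ L) k P ∧ noneRemovable L ts P) (allPD n) ≡ alternating (λ v → Υ (perm v) k) u L
inclusion-exclusion [] u {n} ts k inc w↭ av =
  trans (cong ℤ+_ (count-cong (λ P → ∧-identityʳ (isPDof ts (u ++ []) k P)) (allPD n)))
    (trans (sym (Υ-perm ts (u ++ []) k inc w↭)) (sym (ℤₚ.+-identityʳ _)))
inclusion-exclusion (l ∷ L) u {zero} [] k inc w↭ av with () ← ∈-resp-↭ w↭ (∈-++⁺ʳ u (here refl))
inclusion-exclusion (l ∷ L) u {suc n} ts k inc w↭ av with ts' , a , ins ← ∈-InsAt {l} ts (∈-resp-↭ w↭ (∈-++⁺ʳ u (here refl))) = begin
  ℤ+ count (λ P → isPDof ts w k P ∧ not (removable l ts P) ∧ noneRemovable L ts P) (allPD (suc n))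
    ≡⟨ subtract (count-partition (isPDof ts w k) (removable l ts) (noneRemovable L ts) (allPD (suc n))) ⟩
  ℤ+ count (λ P → isPDof ts w k P ∧ noneRemovable L ts P) (allPD (suc n)) +ℤ
  ℤ- ℤ+ count (λ P → isPDof ts w k P ∧ removable l ts P ∧ noneRemovable L ts P) (allPD (suc n))
    ≡⟨ cong₂ (λ x y → x +ℤ ℤ- y)
         (subst (λ z → ℤ+ count (λ P → isPDof ts z k P ∧ noneRemovable L ts P) (allPD (suc n)) ≡ alternating Y (u ++ l ∷ []) L)
           (++-assoc u (l ∷ []) L)
           (inclusion-exclusion L (u ++ l ∷ []) ts k inc (subst (_↭ toList ts) (sym (++-assoc u (l ∷ []) L)) w↭)
             (subst Avoids1423 (sym (++-assoc u (l ∷ []) L)) av)))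
         (trans (cong ℤ+_ (count-remove ts ts' l u L k inc ins av un w↭))
           (inclusion-exclusion L u ts' k (InsAt-Increasing ins inc)
             (drop-mid u [] (↭-trans w↭ (InsAt-↭ ins))) (Avoids-remove u l L av))) ⟩
  alternating Y (u ++ l ∷ []) L +ℤ ℤ- alternating Y u L
    ≡⟨ sym (alternating-∷ Y u l L) ⟩
  alternating Y u (l ∷ L) ∎
  where
  open ≡-Reasoning
  w = u ++ l ∷ L
  Y : List ℕ → ℤ
  Y v = Υ (perm v) k
  un : Unique w
  un = Unique-resp-↭ (↭⇒↭ₛ (↭-sym w↭)) (Increasing⇒Unique inc)
  subtract : ∀ {x y z} → x ≡ y + z → ℤ+ z ≡ ℤ+ x +ℤ ℤ- ℤ+ y
  subtract {y = y} {z} refl = trans (lem (ℤ+ y) (ℤ+ z)) (cong (λ q → q +ℤ ℤ- ℤ+ y) (sym (ℤₚ.pos-+ y z)))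
    where
    lem : ∀ y z → z ≡ (y +ℤ z) +ℤ ℤ- y
    lem = ℤSolver.solve-∀

rangeV-Increasing : ∀ a n → Increasing (rangeV a n)
rangeV-Increasing a zero    = []
rangeV-Increasing a (suc n) = lower a (suc a) n ≤-refl ∷ rangeV-Increasing (suc a) n
  where
  lower : ∀ a b n → a < b → Allⱽ (a <_) (rangeV b n)
  lower a b zero    a<b = []
  lower a b (suc n) a<b = a<b ∷ lower a (suc b) n (m≤n⇒m≤1+n a<b)

cCoeff-count : ∀ n w k → w ↭ oneTo n → Avoids1423 w →
  cCoeff w k ≡ ℤ+ count (λ P → isPDof (rangeV 1 n) w k P ∧ noneRemovable w (rangeV 1 n) P) (allPD n)
cCoeff-count n w k w↭ av = sym (inclusion-exclusion w [] (rangeV 1 n) k (rangeV-Increasing 1 n)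
  (subst (w ↭_) (sym (toList-rangeV 1 n)) w↭) av)

-- Traced pipes and cell labels

nextRow : ℕ × ℕ → ℕ × ℕ
nextRow (i , k) = suc i , k

cells-suc : ∀ n → cells (suc n) ≡ map (λ k → 1 , k) (oneTo n) ++ map nextRow (cells n)
cells-suc n = cong (map (λ k → 1 , k) (oneTo n) ++_) (go 1 n)
  where
  row : ℕ → ℕ → List (ℕ × ℕ)
  row n i = map (λ k → i , k) (oneTo (n ∸ i))
  go : ∀ a m → concatMap (row (suc n)) (range (suc a) m) ≡ map nextRow (concatMap (row n) (range a m))
  go a zero    = refl
  go a (suc m) = trans (cong₂ _++_ (map-∘ (oneTo (n ∸ a))) (go (suc a) m))
    (sym (map-++ nextRow (row n a) (concatMap (row n) (range (suc a) m))))

lookupV : ∀ {n} → Vec Tile n → ℕ → Tile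
lookupV []      i       = bump
lookupV (x ∷ τ) zero    = x
lookupV (x ∷ τ) (suc i) = lookupV τ i

-- Rows and columns are numbered from 0 here, and from 1 in tileAt.
lookupPD : ∀ {n} → PD n → ℕ → ℕ → Tile
lookupPD []      i k       = bump
lookupPD (τ ∷ P) i zero    = lookupV τ i
lookupPD (τ ∷ P) i (suc k) = lookupPD P i k

lookup-consRow-zero : ∀ {n} (ρ : Vec Tile n) P k → lookupPD (consRow ρ P) 0 k ≡ lookupV ρ k
lookup-consRow-zero []      []      zero    = refl
lookup-consRow-zero []      []      (suc k) = refl
lookup-consRow-zero (x ∷ ρ) (τ ∷ P) zero    = refl
lookup-consRow-zero (x ∷ ρ) (τ ∷ P) (suc k) = lookup-consRow-zero ρ P k

lookup-consRow-suc : ∀ {n} (ρ : Vec Tile n) P i k → lookupPD (consRow ρ P) (suc i) k ≡ lookupPD P i k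
lookup-consRow-suc []      []      i zero    = refl
lookup-consRow-suc []      []      i (suc k) = refl
lookup-consRow-suc (x ∷ ρ) (τ ∷ P) i zero    = refl
lookup-consRow-suc (x ∷ ρ) (τ ∷ P) i (suc k) = lookup-consRow-suc ρ P i k

lookupTile-[] : ∀ cs i k → lookupTile cs [] i k ≡ bump
lookupTile-[] []       i k = refl
lookupTile-[] (_ ∷ cs) i k = refl

lookupTile-nextRow : ∀ cs F i k → lookupTile (map nextRow cs) F (suc i) k ≡ lookupTile cs F i k
lookupTile-nextRow []       F       i k = refl
lookupTile-nextRow (c ∷ cs) []      i k = refl
lookupTile-nextRow (c ∷ cs) (t ∷ F) i k rewrite lookupTile-nextRow cs F i k = refl

lookupTile-nextRow-zero : ∀ cs F k → lookupTile (map nextRow cs) F 0 k ≡ bump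
lookupTile-nextRow-zero []       F       k = refl
lookupTile-nextRow-zero (c ∷ cs) []      k = refl
lookupTile-nextRow-zero (c ∷ cs) (t ∷ F) k = lookupTile-nextRow-zero cs F k

lookupTile-row-suc : ∀ a m cs F i k →
  lookupTile (map (λ k → 1 , k) (range a m) ++ cs) F (suc (suc i)) k ≡ lookupTile cs (drop m F) (suc (suc i)) k
lookupTile-row-suc a zero    cs F       i k = refl
lookupTile-row-suc a (suc m) cs []      i k = sym (lookupTile-[] cs (suc (suc i)) k)
lookupTile-row-suc a (suc m) cs (t ∷ F) i k = lookupTile-row-suc (suc a) m cs F i k

≡ᵇ-refl : ∀ a → (a ≡ᵇ a) ≡ true
≡ᵇ-refl zero    = refl
≡ᵇ-refl (suc a) = ≡ᵇ-refl a

a≢ᵇa+suc : ∀ a k → (a ≡ᵇ a + suc k) ≡ false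
a≢ᵇa+suc zero    k = refl
a≢ᵇa+suc (suc a) k = a≢ᵇa+suc a k

lookupTile-row-zero : ∀ a m cs F k → (∀ F k → lookupTile cs F 1 k ≡ bump) →
  lookupTile (map (λ k → 1 , k) (range a m) ++ cs) F 1 (a + k) ≡ lookupV (rowFrom m F) k
lookupTile-row-zero a zero    cs F       k h = h F (a + k)
lookupTile-row-zero a (suc m) cs []      zero    h = refl
lookupTile-row-zero a (suc m) cs []      (suc k) h = trans (sym (lookupTile-[] (map (λ k → 1 , k) (range (suc a) m) ++ cs) 1 (suc a + k)))
  (lookupTile-row-zero (suc a) m cs [] k h)
lookupTile-row-zero a (suc m) cs (t ∷ F) zero    h rewrite +-identityʳ a | ≡ᵇ-refl a = refl
lookupTile-row-zero a (suc m) cs (t ∷ F) (suc k) h rewrite a≢ᵇa+suc a k | +-suc a k = lookupTile-row-zero (suc a) m cs F k h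

-- Peeling off the top row lowers row indices by one. A lookup past the free cells of the first row
-- then lands in row 0, where only the default must be found.
tileAt-row-zero : ∀ n F k → tileAt n F 0 k ≡ bump
tileAt-row-zero zero    F k = refl
tileAt-row-zero (suc n) F k rewrite cells-suc n = go 1 n (map nextRow (cells n)) F (λ F → lookupTile-nextRow-zero (cells n) F k)
  where
  go : ∀ a m cs F → (∀ F → lookupTile cs F 0 k ≡ bump) → lookupTile (map (λ k → 1 , k) (range a m) ++ cs) F 0 k ≡ bump
  go a zero    cs F       h = h F
  go a (suc m) cs []      h = refl
  go a (suc m) cs (t ∷ F) h = go (suc a) m cs F h

tileAt≡ : ∀ n F i k → tileAt n F (suc i) (suc k) ≡ lookupPD (toPD n F) i k
tileAt≡ zero    F i       k = refl
tileAt≡ (suc n) F zero    k rewrite cells-suc n = trans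
  (lookupTile-row-zero 1 n (map nextRow (cells n)) F k
    (λ F k → trans (lookupTile-nextRow (cells n) F 0 k) (tileAt-row-zero n F k)))
  (sym (lookup-consRow-zero (rowFrom n F) (toPD n (drop n F)) k))
tileAt≡ (suc n) F (suc i) k rewrite cells-suc n = trans
  (lookupTile-row-suc 1 n (map nextRow (cells n)) F i (suc k))
  (trans (lookupTile-nextRow (cells n) (drop n F) (suc i) (suc k))
    (trans (tileAt≡ n (drop n F) i k) (sym (lookup-consRow-suc (rowFrom n F) (toPD n (drop n F)) i k))))

lookupV-outside : ∀ {m} (τ : Vec Tile m) i → m ≤ i → lookupV τ i ≡ bump
lookupV-outside []      i       m≤i = refl
lookupV-outside (x ∷ τ) (suc i) (s≤s m≤i) = lookupV-outside τ i m≤i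

lookupPD-outside : ∀ {n} (P : PD n) i k → n ≤ suc (i + k) → lookupPD P i k ≡ bump
lookupPD-outside []      i k       h = refl
lookupPD-outside (τ ∷ P) i zero    (s≤s h) = lookupV-outside τ i (subst (_ ≤_) (+-identityʳ i) h)
lookupPD-outside {suc n} (τ ∷ P) i (suc k) (s≤s h) = lookupPD-outside P i k (subst (n ≤_) (+-suc i k) h)

-- The label on the top edge of row `i` of a column, down to the diagonal cell; further down 0 is a
-- filler.
carry : ∀ {m} → ℕ → Vec ℕ m → Vec Tile m → ℕ → ℕ
carry c rs       τ       zero    = c
carry c []       []      (suc i) = 0
carry c (r ∷ rs) (x ∷ τ) (suc i) = carry (botOf x c r) rs τ i

topL : ∀ {n} → Vec ℕ n → PD n → ℕ → ℕ → ℕ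
topL []       []      i k       = 0
topL (t ∷ ts) (τ ∷ P) i zero    = carry t (run ts P) τ i
topL (t ∷ ts) (τ ∷ P) i (suc k) = topL ts P i k

-- Label on the left edge of the column k; it is the right edge of column k ∸ 1.
rightL : ∀ {n} → Vec ℕ n → PD n → ℕ → ℕ → ℕ
rightL ts       P       i zero    = at (toList (run ts P)) i
rightL []       []      i (suc k) = 0
rightL (t ∷ ts) (τ ∷ P) i (suc k) = rightL ts P i k

col-left : ∀ {m} c (rs : Vec ℕ m) τ i → i < m →
  at (toList (colStep c rs τ)) i ≡ leftOf (lookupV τ i) (carry c rs τ i) (at (toList rs) i)
col-left c (r ∷ rs) (x ∷ τ) zero    i<m = refl
col-left c (r ∷ rs) (x ∷ τ) (suc i) (s≤s i<m) = col-left (botOf x c r) rs τ i i<m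

col-bot : ∀ {m} c (rs : Vec ℕ m) τ i → i < m →
  carry c rs τ (suc i) ≡ botOf (lookupV τ i) (carry c rs τ i) (at (toList rs) i)
col-bot c (r ∷ rs) (x ∷ τ) zero    i<m = refl
col-bot c (r ∷ rs) (x ∷ τ) (suc i) (s≤s i<m) = col-bot (botOf x c r) rs τ i i<m

col-diag : ∀ {m} c (rs : Vec ℕ m) τ → at (toList (colStep c rs τ)) m ≡ carry c rs τ m
col-diag c []       []      = refl
col-diag c (r ∷ rs) (x ∷ τ) = col-diag (botOf x c r) rs τ

top-first : ∀ {n} (ts : Vec ℕ n) P k → topL ts P 0 k ≡ at (toList ts) k
top-first []       []      k       = refl
top-first (t ∷ ts) (τ ∷ P) zero    = refl
top-first (t ∷ ts) (τ ∷ P) (suc k) = top-first ts P k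

left-eq : ∀ {n} (ts : Vec ℕ n) P i k → suc (i + k) < n →
  rightL ts P i k ≡ leftOf (lookupPD P i k) (topL ts P i k) (rightL ts P i (suc k))
left-eq (t ∷ ts) (τ ∷ P) i zero    (s≤s h) = col-left t (run ts P) τ i (subst (_< _) (+-identityʳ i) h)
left-eq {suc n} (t ∷ ts) (τ ∷ P) i (suc k) (s≤s h) = left-eq ts P i k (subst (_< n) (+-suc i k) h)

bot-eq : ∀ {n} (ts : Vec ℕ n) P i k → suc (i + k) < n →
  topL ts P (suc i) k ≡ botOf (lookupPD P i k) (topL ts P i k) (rightL ts P i (suc k))
bot-eq (t ∷ ts) (τ ∷ P) i zero    (s≤s h) = col-bot t (run ts P) τ i (subst (_< _) (+-identityʳ i) h)
bot-eq {suc n} (t ∷ ts) (τ ∷ P) i (suc k) (s≤s h) = bot-eq ts P i k (subst (_< n) (+-suc i k) h)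

diag-eq : ∀ {n} (ts : Vec ℕ n) P i k → suc (i + k) ≡ n → rightL ts P i k ≡ topL ts P i k
diag-eq (t ∷ ts) (τ ∷ P) i zero    h rewrite sym (trans (sym (+-identityʳ i)) (suc-injective h)) = col-diag t (run ts P) τ
diag-eq (t ∷ ts) (τ ∷ P) i (suc k) h = diag-eq ts P i k (trans (sym (+-suc i k)) (suc-injective h))

top-consRow : ∀ {n} (ts : Vec ℕ (suc n)) (ρ : Vec Tile n) P i k → suc (i + k) ≤ n →
  topL ts (consRow ρ P) (suc i) k ≡ topL (rowU ts ρ) P i k
top-consRow (t ∷ []) [] [] i k ()
top-consRow (t ∷ ts) (x ∷ ρ) (τ ∷ P) i zero    h rewrite run-consRow ts ρ P = refl
top-consRow {suc n} (t ∷ ts) (x ∷ ρ) (τ ∷ P) i (suc k) (s≤s h) = top-consRow ts ρ P i k (subst (_≤ n) (+-suc i k) h)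

right-consRow : ∀ {n} (ts : Vec ℕ (suc n)) (ρ : Vec Tile n) P i k → suc (i + k) ≤ n →
  rightL ts (consRow ρ P) (suc i) k ≡ rightL (rowU ts ρ) P i k
right-consRow ts ρ P i zero h rewrite run-consRow ts ρ P = refl
right-consRow (t ∷ []) [] [] i (suc k) ()
right-consRow {suc n} (t ∷ ts) (x ∷ ρ) (τ ∷ P) i (suc k) (s≤s h) = right-consRow ts ρ P i k (subst (_≤ n) (+-suc i k) h)

≡true-ext : ∀ {x y : Bool} → (x ≡ true → y ≡ true) → (y ≡ true → x ≡ true) → x ≡ y
≡true-ext {true}  {true}  f g = refl
≡true-ext {true}  {false} f g = sym (f refl)
≡true-ext {false} {true}  f g = g refl
≡true-ext {false} {false} f g = refl

any-true⁻ : ∀ {A : Set} (p : A → Bool) xs → any p xs ≡ true → ∃ λ x → x ∈ xs × p x ≡ true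
any-true⁻ p (x ∷ xs) e with p x in eq
... | true  = x , here refl , eq
... | false with y , y∈ , py ← any-true⁻ p xs e = y , there y∈ , py

any-true⁺ : ∀ {A : Set} (p : A → Bool) {x} {xs} → x ∈ xs → p x ≡ true → any p xs ≡ true
any-true⁺ p {xs = x ∷ xs} (here refl) e rewrite e = refl
any-true⁺ p {xs = y ∷ xs} (there x∈) e with p y
... | true  = refl
... | false = any-true⁺ p x∈ e

all-true⁻ : ∀ {A : Set} (p : A → Bool) {x} {xs} → all p xs ≡ true → x ∈ xs → p x ≡ true
all-true⁻ p {xs = x ∷ xs} e (here refl) with p x
... | true = refl
all-true⁻ p {xs = y ∷ xs} e (there x∈) with p y
... | true = all-true⁻ p e x∈

all-true⁺ : ∀ {A : Set} (p : A → Bool) xs → (∀ {x} → x ∈ xs → p x ≡ true) → all p xs ≡ true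
all-true⁺ p []       h = refl
all-true⁺ p (x ∷ xs) h rewrite h (here refl) = all-true⁺ p xs (λ x∈ → h (there x∈))

≡ᵇ-true : ∀ {x y} → (x ≡ᵇ y) ≡ true → x ≡ y
≡ᵇ-true {x} {y} e = ≡ᵇ⇒≡ x y (subst T (sym e) _)

at-range : ∀ a n k → k < n → at (range a n) k ≡ a + k
at-range a (suc n) zero    _ = sym (+-identityʳ a)
at-range a (suc n) (suc k) (s≤s k<n) = trans (at-range (suc a) n k k<n) (sym (+-suc a k))

at-∈ : ∀ u k → k < length u → at u k ∈ u
at-∈ (x ∷ u) zero    _ = here refl
at-∈ (x ∷ u) (suc k) (s≤s h) = there (at-∈ u k h)

module Trace (n : ℕ) (F : List Tile) where

  P : PD n
  P = toPD n F

  tops : Vec ℕ n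
  tops = rangeV 1 n

  top right : ℕ → ℕ → ℕ
  top   = topL tops P
  right = rightL tops P

  tile : ℕ → ℕ → Tile
  tile i k = tileAt n F (suc i) (suc k)

  goesDown : Tile → Dir → Bool
  goesDown cross fromTop   = true
  goesDown cross fromRight = false
  goesDown _     fromTop   = false
  goesDown _     fromRight = true

  rest : Bool → ℕ → ℕ → ℕ → List (ℕ × ℕ) × ℕ
  rest true  f i k = trace n F f (suc (suc i)) (suc k) fromTop
  rest false f i k = trace n F f (suc i) k fromRight

  trace-step : ∀ f i k d x → tile i k ≡ x → trace n F (suc f) (suc i) (suc k) d ≡
    ((suc i , suc k) ∷ proj₁ (rest (goesDown x d) f i k) , proj₂ (rest (goesDown x d) f i k))
  trace-step f i k fromTop   cross e rewrite e = refl
  trace-step f i k fromRight cross e rewrite e = refl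
  trace-step f i k fromTop   bump  e rewrite e = refl
  trace-step f i k fromRight bump  e rewrite e = refl
  trace-step f i k fromTop   mbump e rewrite e = refl
  trace-step f i k fromRight mbump e rewrite e = refl

  -- Pipe l passes through the state (i , k , d). Each step decreases the
  -- fuel by one and increases i ∸ k by one, which gives the last field.
  record Reach (l i k : ℕ) (d : Dir) : Set where
    constructor reach
    field
      fuel : ℕ
      prefix : List (ℕ × ℕ)
      path : pipe n F l ≡ (prefix ++ proj₁ (trace n F fuel (suc i) k d) , proj₂ (trace n F fuel (suc i) k d))
      l≤n : l ≤ n
      fuel-eq : fuel + i + l ≡ suc (suc (n + n)) + k

  -- Shows that the fuel 2n + 2 of `pipe` never runs out inside the staircase: `i` + `l` is at most
  -- 2n, while the other side is at least 2n + 2.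
  no-fuel : ∀ {i l k} → i ≤ n → l ≤ n → 0 + i + l ≢ suc (suc (n + n)) + k
  no-fuel {i} {l} {k} i≤n l≤n e = 1+n≰n (≤-trans (s≤s (≤-trans (m≤m+n (n + n) k) (n≤1+n _)))
    (≤-trans (≤-reflexive (sym e)) (+-mono-≤ i≤n l≤n)))

  Continue : Bool → ℕ → ℕ → ℕ → Set
  Continue true  l i k = Reach l (suc i) (suc k) fromTop
  Continue false l i k = Reach l i k fromRight

  reach-step : ∀ {l i k d x} → i ≤ n → tile i k ≡ x → Reach l i (suc k) d →
    (suc i , suc k) ∈ proj₁ (pipe n F l) × Continue (goesDown x d) l i k
  reach-step i≤n e (reach zero pre p l≤n fe) = ⊥-elim (no-fuel i≤n l≤n fe)
  reach-step {l} {i} {k} {d} {x} i≤n e (reach (suc f) pre p l≤n fe) rewrite trace-step f i k d x e =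
    subst (λ q → (suc i , suc k) ∈ proj₁ q) (sym p) (∈-++⁺ʳ pre (here refl)) , go (goesDown x d) p
    where
    fe' : f + i + l ≡ suc (suc (n + n)) + k
    fe' = suc-injective (trans fe (+-suc (suc (suc (n + n))) k))
    assoc : ∀ (c : ℕ × ℕ) qs → pre ++ c ∷ qs ≡ (pre ++ c ∷ []) ++ qs
    assoc c qs = sym (++-assoc pre (c ∷ []) qs)
    go : ∀ b → pipe n F l ≡ (pre ++ (suc i , suc k) ∷ proj₁ (rest b f i k) , proj₂ (rest b f i k)) → Continue b l i k
    go true  p = reach f (pre ++ (suc i , suc k) ∷ []) (trans p (cong (_, _) (assoc _ _))) l≤n
      (trans (cong (_+ l) (+-suc f i)) (trans (cong suc fe') (sym (+-suc (suc (suc (n + n))) k))))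
    go false p = reach f (pre ++ (suc i , suc k) ∷ []) (trans p (cong (_, _) (assoc _ _))) l≤n fe'

  top-zero : ∀ k → k < n → top 0 k ≡ suc k
  top-zero k k<n = trans (top-first tops P k) (trans (cong (λ v → at v k) (toList-rangeV 1 n)) (at-range 1 n k k<n))

  tile-diag : ∀ i k → suc (i + k) ≡ n → tile i k ≡ bump
  tile-diag i k e = trans (tileAt≡ n F i k) (lookupPD-outside P i k (≤-reflexive (sym e)))

  left≡ : ∀ i k → suc (i + k) < n → right i k ≡ leftOf (tile i k) (top i k) (right i (suc k))
  left≡ i k h rewrite tileAt≡ n F i k = left-eq tops P i k h

  bot≡ : ∀ i k → suc (i + k) < n → top (suc i) k ≡ botOf (tile i k) (top i k) (right i (suc k))
  bot≡ i k h rewrite tileAt≡ n F i k = bot-eq tops P i k h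

  i≤ : ∀ {i k} → i + k < n → i ≤ n
  i≤ {i} {k} h = ≤-trans (m≤m+n i k) (<⇒≤ h)

  <n : ∀ {i k d} → suc (i + k + d) ≡ n → i + k < n
  <n {i} {k} {d} e = ≤-trans (s≤s (m≤m+n (i + k) d)) (≤-reflexive e)

  -- The pipe named on an edge does arrive there, as seen by walking backwards: each tile tells on
  -- which edge the label entered. `d` is the distance to the diagonal and makes the walk to the
  -- right terminate.
  reach-top : ∀ i k → i + k < n → Reach (top i k) i (suc k) fromTop
  reach-right : ∀ i k d → suc (i + k + d) ≡ n → Reach (right i k) i k fromRight

  reach-top zero    k h rewrite top-zero k h = reach (suc (suc (n + n))) [] refl h (cong (_+ suc k) (+-identityʳ (suc (suc (n + n)))))
  reach-top (suc i) k h with tile i k in eq | bot≡ i k h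
  ... | cross | e rewrite e = proj₂ (reach-step (i≤ (<⇒≤ h)) eq (reach-top i k (<⇒≤ h)))
  ... | bump  | e rewrite e = proj₂ (reach-step (i≤ (<⇒≤ h)) eq (reach-right i (suc k) (n ∸ suc (suc (i + k))) (lem i k h)))
    where
    lem : ∀ i k → suc (i + k) < n → suc (i + suc k + (n ∸ suc (suc (i + k)))) ≡ n
    lem i k h = trans (cong (λ z → suc (z + (n ∸ suc (suc (i + k))))) (+-suc i k)) (m+[n∸m]≡n h)
  ... | mbump | e rewrite e = proj₂ (reach-step (i≤ (<⇒≤ h)) eq (reach-right i (suc k) (n ∸ suc (suc (i + k))) (lem i k h)))
    where
    lem : ∀ i k → suc (i + k) < n → suc (i + suc k + (n ∸ suc (suc (i + k)))) ≡ n
    lem i k h = trans (cong (λ z → suc (z + (n ∸ suc (suc (i + k))))) (+-suc i k)) (m+[n∸m]≡n h)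

  reach-right i k zero e rewrite diag-eq tops P i k (trans (cong suc (sym (+-identityʳ (i + k)))) e) =
    proj₂ (reach-step (i≤ (<n {i} {k} {0} e)) (tile-diag i k (trans (cong suc (sym (+-identityʳ (i + k)))) e)) (reach-top i k (<n {i} {k} {0} e)))
  reach-right i k (suc d) e with tile i k in eq | left≡ i k (subst (suc (i + k) <_) e (s≤s (≤-trans (s≤s (m≤m+n (i + k) d)) (≤-reflexive (sym (+-suc (i + k) d))))))
  ... | cross | e' rewrite e' = proj₂ (reach-step (i≤ (<n {i} {k} {suc d} e)) eq (reach-right i (suc k) d
          (trans (cong suc (trans (cong (_+ d) (+-suc i k)) (sym (+-suc (i + k) d)))) e)))
  ... | bump  | e' rewrite e' = proj₂ (reach-step (i≤ (<n {i} {k} {suc d} e)) eq (reach-top i k (<n {i} {k} {suc d} e)))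
  ... | mbump | e' rewrite e' = proj₂ (reach-step (i≤ (<n {i} {k} {suc d} e)) eq (reach-top i k (<n {i} {k} {suc d} e)))

  Reach-right : ∀ i k → i + k < n → Reach (right i k) i k fromRight
  Reach-right i k h = reach-right i k (n ∸ suc (i + k)) (m+[n∸m]≡n h)

  Incident : ℕ → ℕ × ℕ → Set
  Incident l c = ∃₂ λ i k → c ≡ (suc i , suc k) × (top i k ≡ l ⊎ (suc (i + k) < n × right i (suc k) ≡ l))

  -- The converse, walking forwards: a traced pipe stays on edges that carry its label, so it visits
  -- only cells incident to that label. Both directions together give `visits≡`.
  sound-top   : ∀ f i k → i + k < n → All (Incident (top i k)) (proj₁ (trace n F f (suc i) (suc k) fromTop))
  sound-right : ∀ f i k → i + k < n → All (Incident (right i k)) (proj₁ (trace n F f (suc i) k fromRight))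

  private
    down : ∀ f i k {l} → suc i + k < n → top (suc i) k ≡ l → All (Incident l) (proj₁ (trace n F f (suc (suc i)) (suc k) fromTop))
    down f i k h refl = sound-top f (suc i) k h
    left : ∀ f i k {l} → i + k < n → right i k ≡ l → All (Incident l) (proj₁ (trace n F f (suc i) k fromRight))
    left f i k h refl = sound-right f i k h

  sound-top zero    i k h = []
  sound-top (suc f) i k h with suc (i + k) ≟ n
  ... | yes e rewrite trace-step f i k fromTop bump (tile-diag i k e) =
    (i , k , refl , inj₁ refl) ∷ left f i k h (diag-eq tops P i k e)
  ... | no ne with h' ← ≤∧≢⇒< h ne | tile i k in eq | left≡ i k (≤∧≢⇒< h ne) | bot≡ i k (≤∧≢⇒< h ne)
  ...   | cross | l | b = (i , k , refl , inj₁ refl) ∷ down f i k h' b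
  ...   | bump  | l | b = (i , k , refl , inj₁ refl) ∷ left f i k h l
  ...   | mbump | l | b = (i , k , refl , inj₁ refl) ∷ left f i k h l

  sound-right zero    i k       h = []
  sound-right (suc f) i zero    h = []
  sound-right (suc f) i (suc k) h with h' ← subst (_< n) (+-suc i k) h
    with tile i k in eq | left≡ i k h' | bot≡ i k h'
  ... | cross | l | b = (i , k , refl , inj₂ (h' , refl)) ∷ left f i k (<⇒≤ h') l
  ... | bump  | l | b = (i , k , refl , inj₂ (h' , refl)) ∷ down f i k h' b
  ... | mbump | l | b = (i , k , refl , inj₂ (h' , refl)) ∷ down f i k h' b

  visits≡ : ∀ j i k → suc (i + k) < n → 1 ≤ j → j ≤ n → visits n F j (suc i) (suc k) ≡ (top i k ≡ᵇ j) ∨ (right i (suc k) ≡ᵇ j)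
  visits≡ (suc j) i k h _ j≤n = ≡true-ext to from
    where
    at-cell : ℕ × ℕ → Bool
    at-cell c = (proj₁ c ≡ᵇ suc i) ∧ (proj₂ c ≡ᵇ suc k)
    incident : All (Incident (suc j)) (proj₁ (pipe n F (suc j)))
    incident = subst (λ l → All (Incident l) (proj₁ (pipe n F (suc j)))) (top-zero j j≤n) (sound-top (suc (suc (n + n))) 0 j j≤n)
    to : any at-cell (proj₁ (pipe n F (suc j))) ≡ true → (top i k ≡ᵇ suc j) ∨ (right i (suc k) ≡ᵇ suc j) ≡ true
    to e with any-true⁻ at-cell _ e
    ... | c , c∈ , ec with All.lookup incident c∈
    ...   | i' , k' , refl , p with i' ≡ᵇ i in e₁ | k' ≡ᵇ k in e₂
    ...     | true | true with refl ← ≡ᵇ-true {i'} e₁ | refl ← ≡ᵇ-true {k'} e₂ with p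
    ...       | inj₁ q rewrite q | ≡ᵇ-refl j = refl
    ...       | inj₂ (_ , q) rewrite q | ≡ᵇ-refl j with top i k ≡ᵇ suc j
    ...         | true  = refl
    ...         | false = refl
    from : (top i k ≡ᵇ suc j) ∨ (right i (suc k) ≡ᵇ suc j) ≡ true → any at-cell (proj₁ (pipe n F (suc j))) ≡ true
    from e = any-true⁺ at-cell member (cong₂ _∧_ (≡ᵇ-refl i) (≡ᵇ-refl k))
      where
      member : (suc i , suc k) ∈ proj₁ (pipe n F (suc j))
      member with top i k ≡ᵇ suc j in e₁
      ... | true = subst (λ l → (suc i , suc k) ∈ proj₁ (pipe n F l)) (≡ᵇ-true {top i k} e₁) (proj₁ (reach-step (i≤ (<⇒≤ h)) refl (reach-top i k (<⇒≤ h))))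
      ... | false = subst (λ l → (suc i , suc k) ∈ proj₁ (pipe n F l)) (≡ᵇ-true {right i (suc k)} e)
        (proj₁ (reach-step (i≤ (<⇒≤ h)) refl (Reach-right i (suc k) (subst (_< n) (sym (+-suc i k)) h))))

  word : List ℕ
  word = toList (run tops P)

  exitRow-at : ∀ i → i < n → exitRow n F (at word i) ≡ suc i
  exitRow-at i i<n with Reach-right i 0 (subst (_< n) (sym (+-identityʳ i)) i<n)
  ... | reach zero _ _ l≤n fe = ⊥-elim (no-fuel (<⇒≤ i<n) l≤n fe)
  ... | reach (suc f) _ p _ _ = cong proj₂ p

  -- The boundary word is a permutation of the tops, so `j` is one of its letters, and `exitRow-at`
  -- gives the exit row of each letter.
  exitRow≡ᵇ : ∀ i j → i < n → j ∈ oneTo n → (exitRow n F j ≡ᵇ suc i) ≡ (at word i ≡ᵇ j)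
  exitRow≡ᵇ i j i<n j∈ with i' , i'< , refl ← ∈-at (∈-resp-↭ (↭-sym (run-↭ tops P)) (subst (j ∈_) (sym (toList-rangeV 1 n)) j∈)) =
    ≡true-ext to from
    where
    i'<n : i' < n
    i'<n = subst (i' <_) (length-toList (run tops P)) i'<
    to : (exitRow n F (at word i') ≡ᵇ suc i) ≡ true → (at word i ≡ᵇ at word i') ≡ true
    to e with refl ← suc-injective (trans (sym (exitRow-at i' i'<n)) (≡ᵇ-true {exitRow n F (at word i')} e)) = ≡ᵇ-refl (at word i)
    from : (at word i ≡ᵇ at word i') ≡ true → (exitRow n F (at word i') ≡ᵇ suc i) ≡ true
    from e rewrite sym (≡ᵇ-true {at word i} e) | exitRow-at i i<n = ≡ᵇ-refl i

  find : ∀ (p : ℕ → Bool) w js → (∀ {j} → j ∈ js → p j ≡ (w ≡ᵇ j)) → w ∈ js →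
    firstOr0 (concatMap (λ j → if p j then j ∷ [] else []) js) ≡ w
  find p w (j ∷ js) h w∈ rewrite h (here refl) with w ≡ᵇ j in e
  ... | true = sym (≡ᵇ-true {w} e)
  find p w (j ∷ js) h (here refl) | false with () ← trans (sym (≡ᵇ-refl w)) e
  find p w (j ∷ js) h (there w∈)  | false = find p w js (λ j∈ → h (there j∈)) w∈

  labels≡ : labels n F ≡ word
  labels≡ = trans (map-at 1 n 0 (λ i i<n → find (λ j → exitRow n F j ≡ᵇ suc i) (at word i) (oneTo n) (exitRow≡ᵇ i _ i<n) (word∈ i i<n)))
    (at-list word n (length-toList (run tops P)))
    where
    g : ℕ → ℕ
    g i = firstOr0 (concatMap (λ j → if exitRow n F j ≡ᵇ i then j ∷ [] else []) (oneTo n))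
    word∈ : ∀ i → i < n → at word i ∈ oneTo n
    word∈ i i<n = subst (at word i ∈_) (toList-rangeV 1 n)
      (∈-resp-↭ (run-↭ tops P) (at-∈ word i (subst (i <_) (sym (length-toList (run tops P))) i<n)))
    map-at : ∀ a m i → (∀ i' → i' < i + m → g (suc i') ≡ at word i') → map g (range (suc i) m) ≡ map (at word) (range i m)
    map-at a zero    i h = refl
    map-at a (suc m) i h = cong₂ _∷_ (h i (subst (i <_) (sym (+-suc i m)) (s≤s (m≤m+n i m))))
      (map-at a m (suc i) (λ i' p → h i' (subst (i' <_) (sym (+-suc i m)) p)))
    at-list : ∀ u m → length u ≡ m → map (at u) (range 0 m) ≡ u
    at-list []      zero    e = refl
    at-list (x ∷ u) (suc m) e = cong (x ∷_) (trans (shift-at 0 m) (at-list u m (suc-injective e)))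
      where
      shift-at : ∀ a m → map (at (x ∷ u)) (range (suc a) m) ≡ map (at u) (range a m)
      shift-at a zero    = refl
      shift-at a (suc m) = cong (at u a ∷_) (shift-at (suc a) m)

-- Reducedness and marks

record Entry : Set where
  constructor entry
  field
    row : ℕ
    tile : Tile
    topLab rightLab : ℕ
open Entry

rowEntries : ∀ {m} → ℕ → Vec ℕ (suc m) → Vec Tile m → List Entry
rowEntries r (t ∷ ts) []      = []
rowEntries r (t ∷ ts) (x ∷ ρ) = entry r x t (rowH ts ρ) ∷ rowEntries r ts ρ

entries : ∀ {n} → ℕ → Vec ℕ n → PD n → List Entry
entries {zero}  r ts P = []
entries {suc n} r ts P = rowEntries r ts (firstRow P) ++ entries (suc r) (rowU ts (firstRow P)) (restRows P)

has : ℕ → Entry → Bool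
has j e = (topLab e ≡ᵇ j) ∨ (rightLab e ≡ᵇ j)

crosses : ℕ → ℕ → Entry → Bool
crosses j l e = isCross (tile e) ∧ has j e ∧ has l e

entryOK : Entry → Bool
entryOK e = okTile (tile e) (topLab e) (rightLab e)

rowOK-all : ∀ {m} r (ts : Vec ℕ (suc m)) (ρ : Vec Tile m) → rowOK ts ρ ≡ all entryOK (rowEntries r ts ρ)
rowOK-all r (t ∷ ts) []      = refl
rowOK-all r (t ∷ ts) (x ∷ ρ) = cong (okTile x t (rowH ts ρ) ∧_) (rowOK-all r ts ρ)

rowOut : ∀ {m} → Vec ℕ (suc m) → Vec Tile m → List ℕ
rowOut ts ρ = rowH ts ρ ∷ toList (rowU ts ρ)

rowH-∈ : ∀ {m} (ts : Vec ℕ (suc m)) (ρ : Vec Tile m) → rowH ts ρ ∈ toList ts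
rowH-∈ (t ∷ ts) []          = here refl
rowH-∈ (t ∷ ts) (cross ∷ ρ) = there (rowH-∈ ts ρ)
rowH-∈ (t ∷ ts) (bump ∷ ρ)  = here refl
rowH-∈ (t ∷ ts) (mbump ∷ ρ) = here refl

∈-rowOut : ∀ {m y} (ts : Vec ℕ (suc m)) (ρ : Vec Tile m) → y ∈ toList ts → y ∈ rowOut ts ρ
∈-rowOut (t ∷ []) [] (here p) = here p
∈-rowOut (t ∷ ts) (cross ∷ ρ) (here p) = there (here p)
∈-rowOut (t ∷ ts) (bump ∷ ρ)  (here p) = here p
∈-rowOut (t ∷ ts) (mbump ∷ ρ) (here p) = here p
∈-rowOut (t ∷ ts) (x ∷ ρ) (there p) with ∈-rowOut ts ρ p
∈-rowOut (t ∷ ts) (cross ∷ ρ) (there p) | here e  = here e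
∈-rowOut (t ∷ ts) (cross ∷ ρ) (there p) | there q = there (there q)
∈-rowOut (t ∷ ts) (bump ∷ ρ)  (there p) | q = there q
∈-rowOut (t ∷ ts) (mbump ∷ ρ) (there p) | q = there q

rowU-∈ : ∀ {m y} (ts : Vec ℕ (suc m)) (ρ : Vec Tile m) → y ∈ toList (rowU ts ρ) → y ∈ toList ts
rowU-∈ (t ∷ ts) (cross ∷ ρ) (here p)  = here p
rowU-∈ (t ∷ ts) (bump ∷ ρ)  (here refl) = there (rowH-∈ ts ρ)
rowU-∈ (t ∷ ts) (mbump ∷ ρ) (here refl) = there (rowH-∈ ts ρ)
rowU-∈ (t ∷ ts) (x ∷ ρ)     (there p) = there (rowU-∈ ts ρ p)

rowOut-∈ : ∀ {m y} (ts : Vec ℕ (suc m)) (ρ : Vec Tile m) → y ∈ rowOut ts ρ → y ∈ toList ts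
rowOut-∈ ts ρ (here refl) = rowH-∈ ts ρ
rowOut-∈ ts ρ (there p)   = rowU-∈ ts ρ p

∉⇒All-≢ : ∀ {y : ℕ} {u} → y ∉ u → All (y ≢_) u
∉⇒All-≢ y∉ = All.tabulate (λ { z∈ refl → y∉ z∈ })

rowOut-unique : ∀ {m} (ts : Vec ℕ (suc m)) (ρ : Vec Tile m) → Unique (toList ts) → Unique (rowOut ts ρ)
rowOut-unique (t ∷ []) [] un = un
rowOut-unique (t ∷ ts) (x ∷ ρ) (t∉ ∷ un) with rowOut-unique ts ρ un
  | ∉⇒All-≢ {t} {rowOut ts ρ} (λ p → All.lookup t∉ (rowOut-∈ ts ρ p) refl)
rowOut-unique (t ∷ ts) (cross ∷ ρ) (t∉ ∷ un) | h∉ ∷ un' | t≢h ∷ t∉' = ((λ e → t≢h (sym e)) ∷ h∉) ∷ t∉' ∷ un'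
rowOut-unique (t ∷ ts) (bump ∷ ρ)  (t∉ ∷ un) | un' | t∉' = t∉' ∷ un'
rowOut-unique (t ∷ ts) (mbump ∷ ρ) (t∉ ∷ un) | un' | t∉' = t∉' ∷ un'

Before-unique : ∀ {y z u} → Unique u → Before y z u → y ≢ z
Before-unique (y∉ ∷ un) (here z∈) refl = All.lookup y∉ z∈ refl
Before-unique (_ ∷ un)  (there b) = Before-unique un b

Before-fst : ∀ {y z u} → Before y z u → y ∈ u
Before-fst (here _)  = here refl
Before-fst (there b) = there (Before-fst b)

Before-asym : ∀ {y z u} → Unique u → Before y z u → Before z y u → ⊥
Before-asym (y∉ ∷ un) (here z∈) (here y∈) = All.lookup y∉ y∈ refl
Before-asym (y∉ ∷ un) (here z∈) (there b) = All.lookup y∉ (Before-∈ b) refl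
Before-asym (y∉ ∷ un) (there b) (here y∈) = All.lookup y∉ (Before-∈ b) refl
Before-asym (_ ∷ un)  (there b) (there c) = Before-asym un b c

Before-total : ∀ {y z : ℕ} u → y ∈ u → z ∈ u → y ≢ z → Before y z u ⊎ Before z y u
Before-total (x ∷ u) (here refl) (here refl) y≢z = ⊥-elim (y≢z refl)
Before-total (x ∷ u) (here refl) (there z∈)  y≢z = inj₁ (here z∈)
Before-total (x ∷ u) (there y∈)  (here refl) y≢z = inj₂ (here y∈)
Before-total (x ∷ u) (there y∈)  (there z∈)  y≢z with Before-total u y∈ z∈ y≢z
... | inj₁ b = inj₁ (there b)
... | inj₂ b = inj₂ (there b)

rowEntries-Before : ∀ {m r e} (ts : Vec ℕ (suc m)) (ρ : Vec Tile m) → e ∈ rowEntries r ts ρ →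
  Before (topLab e) (rightLab e) (toList ts)
rowEntries-Before (t ∷ ts) (x ∷ ρ) (here refl) = here (rowH-∈ ts ρ)
rowEntries-Before (t ∷ ts) (x ∷ ρ) (there p)   = there (rowEntries-Before ts ρ p)

rowEntries-row : ∀ {m r e} (ts : Vec ℕ (suc m)) (ρ : Vec Tile m) → e ∈ rowEntries r ts ρ → row e ≡ r
rowEntries-row (t ∷ ts) (x ∷ ρ) (here refl) = refl
rowEntries-row (t ∷ ts) (x ∷ ρ) (there p)   = rowEntries-row ts ρ p

entries-row : ∀ {n r e} (ts : Vec ℕ n) P → e ∈ entries r ts P → r ≤ row e
entries-row {suc n} {r} ts P p with ∈-++⁻ (rowEntries r ts (firstRow P)) p
... | inj₁ q = ≤-reflexive (sym (rowEntries-row ts (firstRow P) q))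
... | inj₂ q = <⇒≤ (entries-row (rowU ts (firstRow P)) (restRows P) q)

has-true : ∀ {j} e → has j e ≡ true → topLab e ≡ j ⊎ rightLab e ≡ j
has-true {j} e h with topLab e ≡ᵇ j in eq
... | true  = inj₁ (≡ᵇ-true {topLab e} eq)
... | false = inj₂ (≡ᵇ-true {rightLab e} h)

has-top : ∀ e → has (topLab e) e ≡ true
has-top e rewrite ≡ᵇ-refl (topLab e) = refl

has-right : ∀ e → has (rightLab e) e ≡ true
has-right e rewrite ≡ᵇ-refl (rightLab e) with topLab e ≡ᵇ rightLab e
... | true  = refl
... | false = refl

has-false : ∀ {j} e → topLab e ≢ j → rightLab e ≢ j → has j e ≡ false
has-false {j} e t≢ r≢ with has j e in eq
... | false = refl
... | true with has-true {j} e eq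
...   | inj₁ p = ⊥-elim (t≢ p)
...   | inj₂ p = ⊥-elim (r≢ p)

crosses-sym : ∀ j l e → crosses j l e ≡ crosses l j e
crosses-sym j l e = cong (isCross (tile e) ∧_) (∧-comm (has j e) (has l e))

count-cong-∈ : ∀ {A : Set} {p q : A → Bool} xs → (∀ {x} → x ∈ xs → p x ≡ q x) → count p xs ≡ count q xs
count-cong-∈ []       h = refl
count-cong-∈ {q = q} (x ∷ xs) h rewrite h (here refl) with q x
... | true  = cong suc (count-cong-∈ xs (λ p → h (there p)))
... | false = count-cong-∈ xs (λ p → h (there p))

count-pos : ∀ {A : Set} (p : A → Bool) {x} xs → x ∈ xs → p x ≡ true → 1 ≤ count p xs
count-pos p (x ∷ xs) (here refl) e rewrite e = s≤s z≤n
count-pos p (y ∷ xs) (there x∈) e with p y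
... | true  = s≤s z≤n
... | false = count-pos p xs x∈ e

count-witness : ∀ {A : Set} (p : A → Bool) xs → 1 ≤ count p xs → ∃ λ x → x ∈ xs × p x ≡ true
count-witness p (x ∷ xs) h with p x in e
... | true  = x , here refl , e
... | false with y , y∈ , py ← count-witness p xs h = y , there y∈ , py

crosses-absent : ∀ {m y z r} (ts : Vec ℕ (suc m)) (ρ : Vec Tile m) → y ∉ toList ts →
  count (crosses y z) (rowEntries r ts ρ) ≡ 0
crosses-absent {y = y} {z} {r} ts ρ y∉ = count-false (crosses y z) _ (All.tabulate absent)
  where
  absent : ∀ {e} → e ∈ rowEntries r ts ρ → crosses y z e ≡ false
  absent {e} e∈ rewrite has-false {y} e (λ { refl → y∉ (Before-fst (rowEntries-Before ts ρ e∈)) })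
    (λ { refl → y∉ (Before-∈ (rowEntries-Before ts ρ e∈)) }) = ∧-zeroʳ (isCross (tile e))

-- Within a row two labels can change order only if the later one runs left across the earlier one
-- coming from the top, and this happens at most once. The order on the outgoing side lists the left
-- exit first, then the bottom edges.
row-order : ∀ {m y z r} (ts : Vec ℕ (suc m)) (ρ : Vec Tile m) → Unique (toList ts) → Before y z (toList ts) →
  (count (crosses y z) (rowEntries r ts ρ) ≡ 0 × Before y z (rowOut ts ρ)) ⊎
  (count (crosses y z) (rowEntries r ts ρ) ≡ 1 × entry r cross y z ∈ rowEntries r ts ρ × Before z y (rowOut ts ρ))
row-order (t ∷ []) [] un (here ())
row-order (t ∷ []) [] un (there ())
row-order {z = z} {r} (t ∷ ts) (x ∷ ρ) (t∉ ∷ un) (here z∈) with ∈-rowOut ts ρ z∈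
  | crosses-absent {y = t} {z} {r} ts ρ (λ p → All.lookup t∉ p refl)
row-order (t ∷ ts) (bump ∷ ρ)  (t∉ ∷ un) (here z∈) | z∈' | c = inj₁ (c , here z∈')
row-order (t ∷ ts) (mbump ∷ ρ) (t∉ ∷ un) (here z∈) | z∈' | c = inj₁ (c , here z∈')
row-order {r = r} (t ∷ ts) (cross ∷ ρ) (t∉ ∷ un) (here z∈) | here refl | c
  rewrite ≡ᵇ-refl t | has-right (entry r cross t (rowH ts ρ)) = inj₂ (cong suc c , here refl , here (here refl))
row-order {z = z} {r} (t ∷ ts) (cross ∷ ρ) (t∉ ∷ un) (here z∈) | there z∈' | c
  rewrite ≡ᵇ-refl t | has-false {z} (entry r cross t (rowH ts ρ)) (λ { refl → All.lookup t∉ z∈ refl })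
    (Before-unique (rowOut-unique ts ρ un) (here z∈')) = inj₁ (c , there (here z∈'))
row-order {y = y} {z} {r} (t ∷ ts) (x ∷ ρ) (t∉ ∷ un) (there b) = step (row-order ts ρ un b)
  where
  y≢t : t ≢ y
  y≢t refl = All.lookup t∉ (Before-fst b) refl
  z≢t : t ≢ z
  z≢t refl = All.lookup t∉ (Before-∈ b) refl
  e₀ : Entry
  e₀ = entry r x t (rowH ts ρ)
  no-cross : crosses y z e₀ ≡ false
  no-cross with has y e₀ in ey | has z e₀ in ez
  ... | false | _     = ∧-zeroʳ (isCross x)
  ... | true  | false = ∧-zeroʳ (isCross x)
  ... | true  | true with has-true {y} e₀ ey | has-true {z} e₀ ez
  ...   | inj₁ p | _ = ⊥-elim (y≢t p)
  ...   | inj₂ _ | inj₁ q = ⊥-elim (z≢t q)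
  ...   | inj₂ p | inj₂ q = ⊥-elim (Before-unique un b (trans (sym p) q))
  insert : ∀ x {y z u} → Before y z (rowH ts ρ ∷ u) → Before y z (leftOf x t (rowH ts ρ) ∷ botOf x t (rowH ts ρ) ∷ u)
  insert cross (here p)  = here (there p)
  insert cross (there b) = there (there b)
  insert bump  b = there b
  insert mbump b = there b
  step : (count (crosses y z) (rowEntries r ts ρ) ≡ 0 × Before y z (rowOut ts ρ)) ⊎
    (count (crosses y z) (rowEntries r ts ρ) ≡ 1 × entry r cross y z ∈ rowEntries r ts ρ × Before z y (rowOut ts ρ)) →
    (count (crosses y z) (rowEntries r (t ∷ ts) (x ∷ ρ)) ≡ 0 × Before y z (rowOut (t ∷ ts) (x ∷ ρ))) ⊎
    (count (crosses y z) (rowEntries r (t ∷ ts) (x ∷ ρ)) ≡ 1 × entry r cross y z ∈ rowEntries r (t ∷ ts) (x ∷ ρ) ×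
      Before z y (rowOut (t ∷ ts) (x ∷ ρ)))
  step (inj₁ (c , b')) rewrite no-cross = inj₁ (c , insert x b')
  step (inj₂ (c , e∈ , b')) rewrite no-cross = inj₂ (c , there e∈ , insert x b')

-- Hs lists the cells of the rows above: two pipes are in the wrong order iff
-- they have crossed there.
History : ∀ {n} → Vec ℕ n → List Entry → Set
History ts Hs = ∀ {y z} → Before y z (toList ts) →
  (y < z × count (crosses y z) Hs ≡ 0) ⊎ (z < y × count (crosses y z) Hs ≡ 1)

count-sym : ∀ y z es → count (crosses y z) es ≡ count (crosses z y) es
count-sym y z es = count-cong-∈ es (λ {e} _ → crosses-sym y z e)

-- A pair that keeps its order has not crossed in this row, and its record carries over. A pair that
-- changes order has crossed legally, so it was increasing and had no earlier crossing; now it is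
-- decreasing with one.
History-step : ∀ {m r} (ts : Vec ℕ (suc m)) (ρ : Vec Tile m) Hs → Unique (toList ts) → History ts Hs →
  rowOK ts ρ ≡ true → History (rowU ts ρ) (Hs ++ rowEntries r ts ρ)
History-step {r = r} ts ρ Hs un hist ok {y} {z} b
  with Before-total (toList ts) (rowU-∈ ts ρ (Before-fst b)) (rowU-∈ ts ρ (Before-∈ b)) (Before-unique (rowOut-unique ts ρ un) (there b))
... | inj₁ b' rewrite count-++ (crosses y z) Hs (rowEntries r ts ρ) with row-order {r = r} ts ρ un b'
...   | inj₁ (c , _) rewrite c | +-identityʳ (count (crosses y z) Hs) = hist b'
...   | inj₂ (_ , _ , b″) = ⊥-elim (Before-asym (rowOut-unique ts ρ un) (there b) b″)
History-step {r = r} ts ρ Hs un hist ok {y} {z} b | inj₂ b'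
  rewrite count-++ (crosses y z) Hs (rowEntries r ts ρ) with row-order {r = r} ts ρ un b'
... | inj₁ (_ , b″) = ⊥-elim (Before-asym (rowOut-unique ts ρ un) (there b) b″)
... | inj₂ (c , e∈ , _) with hist b'
...   | inj₁ (z<y , c₀) rewrite count-sym y z Hs | c₀ | count-sym y z (rowEntries r ts ρ) | c = inj₂ (z<y , refl)
...   | inj₂ (y<z , _) with () ← trans (sym (<ᵇ-false (<-asym y<z)))
        (all-true⁻ entryOK (trans (sym (rowOK-all r ts ρ)) ok) e∈)

Marked : List Entry → Entry → Set
Marked es e = ∃ λ e' → e' ∈ es × row e' < row e × crosses (topLab e) (rightLab e) e' ≡ true

valid-rows : ∀ {n} (ts : Vec ℕ (suc n)) P → valid ts P ≡ rowOK ts (firstRow P) ∧ valid (rowU ts (firstRow P)) (restRows P)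
valid-rows ts P = trans (cong (valid ts) (sym (consRow-rows P))) (valid-consRow ts (firstRow P) (restRows P))

unique-tail : ∀ {x : ℕ} {u} → Unique (x ∷ u) → Unique u
unique-tail (_ ∷ un) = un

-- A valid cross has top < right, so by `History` its two pipes have not crossed before and their
-- count goes from 0 to 1. A label that has left the diagram occurs in no further row, so its counts
-- are final.
valid⇒reduced : ∀ {n} r (ts : Vec ℕ n) P Hs → Unique (toList ts) → History ts Hs → valid ts P ≡ true →
  (∀ y z → y ≢ z → count (crosses y z) Hs ≤ 1) → ∀ y z → y ≢ z → count (crosses y z) (Hs ++ entries r ts P) ≤ 1
valid⇒reduced {zero} r [] [] Hs un hist ok h y z y≢z rewrite count-++ (crosses y z) Hs [] | +-identityʳ (count (crosses y z) Hs) = h y z y≢z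
valid⇒reduced {suc n} r ts P Hs un hist ok h y z y≢z with ok₁ , ok₂ ← ∧-true (trans (sym (valid-rows ts P)) ok) =
  subst (λ es → count (crosses y z) es ≤ 1) (++-assoc Hs Rs _)
    (valid⇒reduced (suc r) (rowU ts ρ) (restRows P) (Hs ++ Rs) (unique-tail (rowOut-unique ts ρ un))
      (History-step ts ρ Hs un hist ok₁) ok₂ h' y z y≢z)
  where
  ρ = firstRow P
  Rs = rowEntries r ts ρ
  both : ∀ {y z} → Before y z (toList ts) → count (crosses y z) Hs + count (crosses y z) Rs ≤ 1
  both {y} {z} b with row-order {r = r} ts ρ un b
  ... | inj₁ (c , _) rewrite c | +-identityʳ (count (crosses y z) Hs) = h y z (Before-unique un b)
  ... | inj₂ (c , e∈ , _) with hist b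
  ...   | inj₁ (_ , c₀) rewrite c | c₀ = ≤-refl
  ...   | inj₂ (z<y , _) with () ← trans (sym (<ᵇ-false (<-asym z<y)))
          (all-true⁻ entryOK (trans (sym (rowOK-all r ts ρ)) (proj₁ (∧-true (trans (sym (valid-rows ts P)) ok)))) e∈)
  h' : ∀ y z → y ≢ z → count (crosses y z) (Hs ++ Rs) ≤ 1
  h' y z y≢z rewrite count-++ (crosses y z) Hs Rs with y ∈? toList ts | z ∈? toList ts
  ... | no y∉ | _ rewrite crosses-absent {y = y} {z} {r} ts ρ y∉ | +-identityʳ (count (crosses y z) Hs) = h y z y≢z
  ... | yes _ | no z∉ rewrite count-sym y z Rs | crosses-absent {y = z} {y} {r} ts ρ z∉ | +-identityʳ (count (crosses y z) Hs) = h y z y≢z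
  ... | yes y∈ | yes z∈ with Before-total (toList ts) y∈ z∈ y≢z
  ...   | inj₁ b = both b
  ...   | inj₂ b rewrite count-sym y z Hs | count-sym y z Rs = both b

valid⇒marked : ∀ {n} r (ts : Vec ℕ n) P Hs → Unique (toList ts) → History ts Hs → valid ts P ≡ true →
  (∀ {e} → e ∈ Hs → row e < r) → ∀ {e} → e ∈ entries r ts P → tile e ≡ mbump →
  topLab e ≢ rightLab e × Marked (Hs ++ entries r ts P) e
valid⇒marked {suc n} r ts P Hs un hist ok rows {e} e∈ m
  with ok₁ , ok₂ ← ∧-true (trans (sym (valid-rows ts P)) ok) | ∈-++⁻ (rowEntries r ts (firstRow P)) e∈
... | inj₂ e∈' = proj₁ rec , subst (λ es → Marked es e) (++-assoc Hs Rs _) (proj₂ rec)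
  where
  ρ = firstRow P
  Rs = rowEntries r ts ρ
  rows' : ∀ {e} → e ∈ Hs ++ Rs → row e < suc r
  rows' p with ∈-++⁻ Hs p
  ... | inj₁ q = m≤n⇒m≤1+n (rows q)
  ... | inj₂ q = s≤s (≤-reflexive (rowEntries-row ts ρ q))
  rec = valid⇒marked (suc r) (rowU ts ρ) (restRows P) (Hs ++ Rs) (unique-tail (rowOut-unique ts ρ un))
    (History-step ts ρ Hs un hist ok₁) ok₂ rows' e∈' m
... | inj₁ e∈' with hist (rowEntries-Before ts (firstRow P) e∈')
...   | inj₁ (t<r , _) with () ← trans (sym (cong not (<ᵇ-true t<r)))
        (subst (λ x → okTile x (topLab e) (rightLab e) ≡ true) m
          (all-true⁻ entryOK {e} (trans (sym (rowOK-all r ts (firstRow P))) ok₁) e∈'))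
...   | inj₂ (r<t , c) with e' , e'∈ , q ← count-witness (crosses (topLab e) (rightLab e)) Hs (≤-reflexive (sym c)) =
  Before-unique un (rowEntries-Before ts (firstRow P) e∈') ,
  e' , ∈-++⁺ˡ e'∈ , subst (row e' <_) (sym (rowEntries-row ts (firstRow P) e∈')) (rows e'∈) , q

reduced⇒valid : ∀ {n} r (ts : Vec ℕ n) P Hs → Unique (toList ts) → History ts Hs → (∀ {e} → e ∈ Hs → row e < r) →
  (∀ {y z} → y ∈ toList ts → z ∈ toList ts → y ≢ z → count (crosses y z) (Hs ++ entries r ts P) ≤ 1) →
  (∀ {e} → e ∈ entries r ts P → tile e ≡ mbump → Marked (Hs ++ entries r ts P) e) → valid ts P ≡ true
reduced⇒valid {zero} r [] [] Hs un hist rows red mark = refl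
reduced⇒valid {suc n} r ts P Hs un hist rows red mark = trans (valid-rows ts P) (∧-intro ok₁
  (reduced⇒valid (suc r) (rowU ts ρ) (restRows P) (Hs ++ Rs) (unique-tail (rowOut-unique ts ρ un))
    (History-step ts ρ Hs un hist ok₁) rows'
    (λ {y} {z} y∈ z∈ y≢z → subst (λ es → count (crosses y z) es ≤ 1) (sym (++-assoc Hs Rs _)) (red (rowU-∈ ts ρ y∈) (rowU-∈ ts ρ z∈) y≢z))
    (λ {e} e∈ m → subst (λ es → Marked es e) (sym (++-assoc Hs Rs _)) (mark (∈-++⁺ʳ Rs e∈) m))))
  where
  ρ = firstRow P
  Rs = rowEntries r ts ρ
  Es = entries (suc r) (rowU ts ρ) (restRows P)
  rows' : ∀ {e} → e ∈ Hs ++ Rs → row e < suc r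
  rows' p with ∈-++⁻ Hs p
  ... | inj₁ q = m≤n⇒m≤1+n (rows q)
  ... | inj₂ q = s≤s (≤-reflexive (rowEntries-row ts ρ q))
  entry-ok : ∀ {e} → e ∈ Rs → entryOK e ≡ true
  entry-ok {entry _ bump a b} e∈ = refl
  entry-ok {e@(entry _ cross a b)} e∈ with bf ← rowEntries-Before ts ρ e∈ with hist bf
  ... | inj₁ (a<b , _) = <ᵇ-true a<b
  ... | inj₂ (_ , c) = ⊥-elim (1+n≰n (≤-trans two (red (Before-fst bf) (Before-∈ bf) (Before-unique un bf))))
    where
    self : crosses a b e ≡ true
    self rewrite has-top e | has-right e = refl
    -- One crossing is recorded in `Hs`, the other is the present cell.
    two : 2 ≤ count (crosses a b) (Hs ++ Rs ++ Es)
    two rewrite count-++ (crosses a b) Hs (Rs ++ Es) | c | count-++ (crosses a b) Rs Es =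
      s≤s (≤-trans (count-pos (crosses a b) Rs e∈ self) (m≤m+n _ _))
  entry-ok {e@(entry _ mbump a b)} e∈ with bf ← rowEntries-Before ts ρ e∈ | e' , e'∈ , r< , q ← mark (∈-++⁺ˡ e∈) refl
    with ∈-++⁻ Hs e'∈
  -- A mark needs a crossing strictly above, so a witness in this row or below is impossible.
  ... | inj₂ e'∈' = ⊥-elim (<-irrefl refl (≤-trans (subst (row e' <_) (rowEntries-row ts ρ e∈) r<) (entries-row ts P e'∈')))
  ... | inj₁ e'∈' with hist bf
  ...   | inj₂ (b<a , _) = cong not (<ᵇ-false (<-asym b<a))
  ...   | inj₁ (_ , c) = ⊥-elim (1+n≰n (≤-trans (count-pos (crosses a b) Hs e'∈' q) (≤-reflexive c)))
  ok₁ : rowOK ts ρ ≡ true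
  ok₁ = trans (rowOK-all r ts ρ) (all-true⁺ entryOK Rs entry-ok)

range-∈⁻ : ∀ a m {k} → k ∈ range a m → a ≤ k × k < a + m
range-∈⁻ a (suc m) (here refl) = ≤-refl , subst (a <_) (sym (+-suc a m)) (s≤s (m≤m+n a m))
range-∈⁻ a (suc m) {k} (there p) with l , u ← range-∈⁻ (suc a) m p = <⇒≤ l , subst (k <_) (sym (+-suc a m)) u

range-∈⁺ : ∀ a m {j} → a ≤ j → j < a + m → j ∈ range a m
range-∈⁺ a zero    a≤j j< = ⊥-elim (<-irrefl refl (≤-trans j< (subst (_≤ _) (sym (+-identityʳ a)) a≤j)))
range-∈⁺ a (suc m) {j} a≤j j< with a ≟ j
... | yes refl = here refl
... | no a≢j = there (range-∈⁺ (suc a) m (≤∧≢⇒< a≤j a≢j) (subst (j <_) (+-suc a m) j<))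

cells-∈⁻ : ∀ n {c} → c ∈ cells n → ∃₂ λ i k → c ≡ (suc i , suc k) × suc (i + k) < n
cells-∈⁻ (suc n) {c} c∈ with ∈-++⁻ (map (λ k → 1 , k) (oneTo n)) (subst (c ∈_) (cells-suc n) c∈)
... | inj₁ p with ∈-map⁻ (λ k → 1 , k) p
...   | zero , k∈ , refl with () ← proj₁ (range-∈⁻ 1 n k∈)
...   | suc k , k∈ , refl = 0 , k , refl , proj₂ (range-∈⁻ 1 n k∈)
cells-∈⁻ (suc n) {c} c∈ | inj₂ p with ∈-map⁻ nextRow p
... | c' , c'∈ , refl with i , k , refl , h ← cells-∈⁻ n c'∈ = suc i , k , refl , s≤s h

cells-∈⁺ : ∀ n i k → suc (i + k) < n → (suc i , suc k) ∈ cells n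
cells-∈⁺ (suc n) zero    k h = subst ((1 , suc k) ∈_) (sym (cells-suc n))
  (∈-++⁺ˡ (∈-map⁺ (λ k → 1 , k) (range-∈⁺ 1 n (s≤s z≤n) h)))
cells-∈⁺ (suc n) (suc i) k (s≤s h) = subst ((suc (suc i) , suc k) ∈_) (sym (cells-suc n))
  (∈-++⁺ʳ (map (λ k → 1 , k) (oneTo n)) (∈-map⁺ nextRow (cells-∈⁺ n i k h)))

map-cong-∈ : ∀ {A B : Set} {f g : A → B} xs → (∀ {x} → x ∈ xs → f x ≡ g x) → map f xs ≡ map g xs
map-cong-∈ []       h = refl
map-cong-∈ (x ∷ xs) h = cong₂ _∷_ (h (here refl)) (map-cong-∈ xs (λ p → h (there p)))

entryAt : ∀ {n} → ℕ → Vec ℕ n → PD n → ℕ × ℕ → Entry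
entryAt r ts P (i , k) = entry (r + (i ∸ 1)) (lookupPD P (i ∸ 1) (k ∸ 1)) (topL ts P (i ∸ 1) (k ∸ 1)) (rightL ts P (i ∸ 1) k)

first-entries : ∀ {m} r (ts : Vec ℕ (suc m)) (ρ : Vec Tile m) P →
  map (λ k → entry r (lookupPD (consRow ρ P) 0 k) (topL ts (consRow ρ P) 0 k) (rightL ts (consRow ρ P) 0 (suc k))) (range 0 m)
  ≡ rowEntries r ts ρ
first-entries r (t ∷ ts) []      []      = refl
first-entries {suc m} r (t ∷ ts) (x ∷ ρ) (τ ∷ P) = cong₂ _∷_
  (cong (entry r x t) (cong (λ v → at (toList v) 0) (run-consRow ts ρ P)))
  (trans (trans (cong (map _) (sym (map-suc-range 0 m))) (sym (map-∘ (range 0 m)))) (first-entries r ts ρ P))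

-- Translates statements about cells into statements about labelled entries. Both lists are in
-- row-major order and are split after the first row.
entries-cells : ∀ {n} r (ts : Vec ℕ n) P → map (entryAt r ts P) (cells n) ≡ entries r ts P
entries-cells {zero}  r ts P = refl
entries-cells {suc n} r ts P = begin
  map (entryAt r ts P) (cells (suc n))
    ≡⟨ cong (λ Q → map (entryAt r ts Q) (cells (suc n))) (sym (consRow-rows P)) ⟩
  map (entryAt r ts Q) (cells (suc n))
    ≡⟨ cong (map (entryAt r ts Q)) (cells-suc n) ⟩
  map (entryAt r ts Q) (map (λ k → 1 , k) (oneTo n) ++ map nextRow (cells n))
    ≡⟨ map-++ (entryAt r ts Q) (map (λ k → 1 , k) (oneTo n)) _ ⟩
  map (entryAt r ts Q) (map (λ k → 1 , k) (oneTo n)) ++ map (entryAt r ts Q) (map nextRow (cells n))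
    ≡⟨ cong₂ _++_ row₀ (trans (sym (map-∘ (cells n))) (trans (map-cong-∈ (cells n) next) (entries-cells (suc r) (rowU ts ρ) P'))) ⟩
  rowEntries r ts ρ ++ entries (suc r) (rowU ts ρ) P' ∎
  where
  open ≡-Reasoning
  ρ = firstRow P
  P' = restRows P
  Q = consRow ρ P'
  row₀ : map (entryAt r ts Q) (map (λ k → 1 , k) (oneTo n)) ≡ rowEntries r ts ρ
  row₀ = trans (sym (map-∘ (oneTo n))) (trans (cong (map _) (sym (map-suc-range 0 n))) (trans (sym (map-∘ (range 0 n)))
    (trans (map-cong (λ k → cong (λ r → entry r (lookupPD Q 0 k) (topL ts Q 0 k) (rightL ts Q 0 (suc k))) (+-identityʳ r)) (range 0 n)) (first-entries r ts ρ P'))))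
  next : ∀ {c} → c ∈ cells n → entryAt r ts Q (nextRow c) ≡ entryAt (suc r) (rowU ts ρ) P' c
  next c∈ with i , k , refl , h ← cells-∈⁻ n c∈
    rewrite lookup-consRow-suc ρ P' i k | top-consRow ts ρ P' i k (<⇒≤ h)
          | right-consRow ts ρ P' i (suc k) (subst (λ z → suc z ≤ n) (sym (+-suc i k)) h) | +-suc r i = refl

Increasing-Before : ∀ {n y z} {ts : Vec ℕ n} → Increasing ts → Before y z (toList ts) → y < z
Increasing-Before (a ∷ i) (here z∈) = All.lookup (toList⁺ a) z∈
Increasing-Before (a ∷ i) (there b) = Increasing-Before i b

entries-∈ : ∀ {n r e} (ts : Vec ℕ n) P → e ∈ entries r ts P → topLab e ∈ toList ts × rightLab e ∈ toList ts
entries-∈ {suc n} {r} ts P p with ∈-++⁻ (rowEntries r ts (firstRow P)) p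
... | inj₁ q with b ← rowEntries-Before ts (firstRow P) q = Before-fst b , Before-∈ b
... | inj₂ q with a , b ← entries-∈ (rowU ts (firstRow P)) (restRows P) q = rowU-∈ ts (firstRow P) a , rowU-∈ ts (firstRow P) b

∨-false : ∀ {x y} → x ≡ false → x ∨ y ≡ true → y ≡ true
∨-false refl e = e

not-true : ∀ {x} → not x ≡ true → x ≡ false
not-true {false} e = refl

isMbump-true : ∀ {x} → isMbump x ≡ true → x ≡ mbump
isMbump-true {mbump} e = refl

module Validity (n : ℕ) (F : List Tile) where
  open Trace n F

  Es : List Entry
  Es = entries 1 tops P

  E : ℕ × ℕ → Entry
  E = entryAt 1 tops P

  Es≡ : map E (cells n) ≡ Es
  Es≡ = entries-cells 1 tops P

  1≤∈ : ∀ {j} → j ∈ oneTo n → 1 ≤ j × j ≤ n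
  1≤∈ j∈ with l , u ← range-∈⁻ 1 n j∈ = l , ≤-pred u

  visits-has : ∀ {c j} → c ∈ cells n → j ∈ oneTo n → visits n F j (proj₁ c) (proj₂ c) ≡ has j (E c)
  visits-has c∈ j∈ with i , k , refl , h ← cells-∈⁻ n c∈ | 1≤j , j≤n ← 1≤∈ j∈ = visits≡ _ i k h 1≤j j≤n

  tile-E : ∀ {c} → c ∈ cells n → tileAt n F (proj₁ c) (proj₂ c) ≡ Entry.tile (E c)
  tile-E c∈ with i , k , refl , h ← cells-∈⁻ n c∈ = tileAt≡ n F i k

  crossAt-E : ∀ {c j l} → c ∈ cells n → j ∈ oneTo n → l ∈ oneTo n → crossAt n F j l c ≡ crosses j l (E c)
  crossAt-E c∈ j∈ l∈ rewrite tile-E c∈ | visits-has c∈ j∈ | visits-has c∈ l∈ = refl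

  row-E : ∀ {c} → c ∈ cells n → row (E c) ≡ proj₁ c
  row-E c∈ with i , k , refl , h ← cells-∈⁻ n c∈ = refl

  count-crossAt : ∀ {j l} → j ∈ oneTo n → l ∈ oneTo n → count (crossAt n F j l) (cells n) ≡ count (crosses j l) Es
  count-crossAt {j} {l} j∈ l∈ = trans (count-cong-∈ (cells n) (λ c∈ → crossAt-E c∈ j∈ l∈))
    (trans (sym (count-map (crosses j l) E (cells n))) (cong (count (crosses j l)) Es≡))

  tops-∈ : ∀ {j} → j ∈ toList tops → j ∈ oneTo n
  tops-∈ = subst (_ ∈_) (toList-rangeV 1 n)

  E-∈ : ∀ {c} → c ∈ cells n → E c ∈ Es
  E-∈ {c} c∈ = subst (E c ∈_) Es≡ (∈-map⁺ E c∈)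

  E-∈⁻ : ∀ {e} → e ∈ Es → ∃ λ c → c ∈ cells n × e ≡ E c
  E-∈⁻ e∈ with c , c∈ , e ← ∈-map⁻ E (subst (_ ∈_) (sym Es≡) e∈) = c , c∈ , e

  initial : History tops []
  initial b = inj₁ (Increasing-Before (rangeV-Increasing 1 n) b , refl)

  tops-unique = Increasing⇒Unique (rangeV-Increasing 1 n)

  reduced⇒ : reducedᵇ n F ≡ true → ∀ {y z} → y ∈ toList tops → z ∈ toList tops → y ≢ z → count (crosses y z) Es ≤ 1
  reduced⇒ e {y} {z} y∈ z∈ y≢z with all-true⁻ _ (all-true⁻ _ e (tops-∈ y∈)) (tops-∈ z∈)
  ... | q = ≤-pred (subst (_< 2) (count-crossAt (tops-∈ y∈) (tops-∈ z∈))
    (<ᵇ⇒< _ 2 (subst T (sym (∨-false (≢⇒≡ᵇ-false y≢z) q)) _)))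

  marked⇒ : markOKᵇ n F ≡ true → ∀ {e} → e ∈ Es → Entry.tile e ≡ mbump → Marked Es e
  marked⇒ ok e∈ m with c , c∈ , refl ← E-∈⁻ e∈ with q ← ∨-false (cong not (cong isMbump (trans (tile-E c∈) m))) (all-true⁻ _ ok c∈)
    with j , j∈ , q₁ ← any-true⁻ _ (oneTo n) q
    with l , l∈ , q₂ ← any-true⁻ _ (oneTo n) q₁
    with j≢l , q₃ ← ∧-true {not (j ≡ᵇ l)} q₂
    with vj , q₄ ← ∧-true {visits n F j (proj₁ c) (proj₂ c)} q₃
    with vl , q₅ ← ∧-true {visits n F l (proj₁ c) (proj₂ c)} q₄
    with c' , c'∈ , q₆ ← any-true⁻ _ (cells n) q₅
    with r< , cr ← ∧-true {proj₁ c' <ᵇ proj₁ c} q₆ =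
    E c' , E-∈ c'∈ , subst₂ _<_ (sym (row-E c'∈)) (sym (row-E c∈)) (<ᵇ⇒< (proj₁ c') _ (subst T (sym r<) _)) ,
    which (has-true (E c) (trans (sym (visits-has c∈ j∈)) vj)) (has-true (E c) (trans (sym (visits-has c∈ l∈)) vl))
    where
    cr' = trans (sym (crossAt-E c'∈ j∈ l∈)) cr
    absurd : ∀ {x} → x ≡ j → x ≡ l → ⊥
    absurd refl refl with () ← trans (sym (cong not (≡ᵇ-refl j))) j≢l
    -- The two pipes come without an order; being distinct, they are the top and the right label in
    -- one order or the other.
    which : topLab (E c) ≡ j ⊎ rightLab (E c) ≡ j → topLab (E c) ≡ l ⊎ rightLab (E c) ≡ l →
      crosses (topLab (E c)) (rightLab (E c)) (E c') ≡ true
    which (inj₁ p) (inj₁ p') = ⊥-elim (absurd p p')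
    which (inj₂ p) (inj₂ p') = ⊥-elim (absurd p p')
    which (inj₁ p) (inj₂ p') = subst₂ (λ x y → crosses x y (E c') ≡ true) (sym p) (sym p') cr'
    which (inj₂ p) (inj₁ p') = subst₂ (λ x y → crosses x y (E c') ≡ true) (sym p') (sym p)
      (trans (crosses-sym l j (E c')) cr')

  ⇒reduced : valid tops P ≡ true → reducedᵇ n F ≡ true
  ⇒reduced ok = all-true⁺ _ (oneTo n) (λ {j} j∈ → all-true⁺ _ (oneTo n) (λ {l} l∈ → pairOK j l j∈ l∈))
    where
    pairOK : ∀ j l → j ∈ oneTo n → l ∈ oneTo n → (j ≡ᵇ l) ∨ (count (crossAt n F j l) (cells n) <ᵇ 2) ≡ true
    pairOK j l j∈ l∈ with j ≡ᵇ l in eq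
    ... | true  = refl
    ... | false = <ᵇ-true (subst (_< 2) (sym (count-crossAt j∈ l∈)) (s≤s
      (valid⇒reduced 1 tops P [] tops-unique initial ok (λ _ _ _ → z≤n) j l
        (λ { refl → subst T (trans (sym (≡ᵇ-refl j)) eq) _ }))))

  ⇒marked : valid tops P ≡ true → markOKᵇ n F ≡ true
  ⇒marked ok = all-true⁺ _ (cells n) cellOK
    where
    cellOK : ∀ {c} → c ∈ cells n → not (isMbump (tileAt n F (proj₁ c) (proj₂ c))) ∨
      any (λ j → any (λ l → not (j ≡ᵇ l) ∧ visits n F j (proj₁ c) (proj₂ c) ∧ visits n F l (proj₁ c) (proj₂ c) ∧
        any (λ c' → (proj₁ c' <ᵇ proj₁ c) ∧ crossAt n F j l c') (cells n)) (oneTo n)) (oneTo n) ≡ true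
    cellOK {c} c∈ with isMbump (tileAt n F (proj₁ c) (proj₂ c)) in m
    ... | false = refl
    ... | true with valid⇒marked 1 tops P [] tops-unique initial ok (λ ()) (E-∈ c∈) (trans (sym (tile-E c∈)) (isMbump-true m))
                  | entries-∈ {r = 1} tops P (E-∈ c∈)
    ...   | t≢r , e' , e'∈ , r< , cr | t∈ , r∈ with c' , c'∈ , refl ← E-∈⁻ e'∈ =
      any-true⁺ _ (tops-∈ t∈) (any-true⁺ _ (tops-∈ r∈)
        (∧-intro (cong not (≢⇒≡ᵇ-false t≢r))
          (∧-intro (trans (visits-has c∈ (tops-∈ t∈)) (has-top (E c)))
            (∧-intro (trans (visits-has c∈ (tops-∈ r∈)) (has-right (E c)))
              (any-true⁺ _ c'∈ (∧-intro (<ᵇ-true (subst₂ _<_ (row-E c'∈) (row-E c∈) r<))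
                (trans (crossAt-E c'∈ (tops-∈ t∈) (tops-∈ r∈)) cr)))))))

  valid≡ : reducedᵇ n F ∧ markOKᵇ n F ≡ valid tops P
  valid≡ = ≡true-ext
    (λ e → reduced⇒valid 1 tops P [] tops-unique initial (λ ())
      (λ y∈ z∈ → reduced⇒ (proj₁ (∧-true e)) y∈ z∈) (marked⇒ (proj₂ (∧-true {reducedᵇ n F} e))))
    (λ ok → ∧-intro (⇒reduced ok) (⇒marked ok))

-- Removable pipes

-- Conditions (ii) and (iii) at one cell: f tells whether the tile above is an
-- unmarked bump, v whether the pipe visits the cell.
CellClean : Bool → Tile → Bool → Set
CellClean f x v = (x ≡ cross → v ≡ true → f ≡ false) × (x ≡ mbump → v ≡ false)

module _ (j : ℕ) where

  visit : ℕ → ℕ → Bool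
  visit c r = (c ≡ᵇ j) ∨ (r ≡ᵇ j)

  ColClean : ∀ {m} → Bool → ℕ → Vec ℕ m → Vec Tile m → Set
  ColClean f c []       []      = ⊤
  ColClean f c (r ∷ rs) (x ∷ τ) = CellClean f x (visit c r) × ColClean (isBump x) (botOf x c r) rs τ

  Clean : ∀ {n} → Vec ℕ n → PD n → Set
  Clean []       []      = ⊤
  Clean (t ∷ ts) (τ ∷ P) = ColClean false t (run ts P) τ × Clean ts P

  visit-absent : ∀ {c r u} → j ∉ c ∷ r ∷ u → visit c r ≡ false
  visit-absent {c} {r} j∉
    rewrite ≢⇒≡ᵇ-false {c} {j} (λ { refl → j∉ (here refl) })
          | ≢⇒≡ᵇ-false {r} {j} (λ { refl → j∉ (there (here refl)) }) = refl

  visit-right : ∀ c → visit c j ≡ true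
  visit-right c rewrite ≡ᵇ-refl j with c ≡ᵇ j
  ... | true  = refl
  ... | false = refl

  bot-absent : ∀ x {c r u} → j ∉ c ∷ r ∷ u → j ∉ botOf x c r ∷ u
  bot-absent cross j∉ (here e)  = j∉ (here e)
  bot-absent bump  j∉ (here e)  = j∉ (there (here e))
  bot-absent mbump j∉ (here e)  = j∉ (there (here e))
  bot-absent x     j∉ (there p) = j∉ (there (there p))

  absent-clean : ∀ {m} f c (rs : Vec ℕ m) τ → j ∉ c ∷ toList rs → ColClean f c rs τ
  absent-clean f c []       []      j∉ = tt
  absent-clean f c (r ∷ rs) (x ∷ τ) j∉ rewrite visit-absent j∉ =
    ((λ _ ()) , (λ _ → refl)) , absent-clean (isBump x) (botOf x c r) rs τ (bot-absent x j∉)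

  bumps-clean : ∀ {m} f c (rs : Vec ℕ m) {τ} → CrossBump 0 τ → ColClean f c rs τ
  bumps-clean f c []       []       = tt
  bumps-clean f c (r ∷ rs) (bump p) = ((λ ()) , (λ ())) , bumps-clean true r rs p

  CrossBump-clean : ∀ {m r} (rs : Vec ℕ m) {τ} → CrossBump r τ → ColClean false j rs τ
  CrossBump-clean []       []        = tt
  CrossBump-clean (r ∷ rs) (cross p) = ((λ _ _ → refl) , (λ ())) , CrossBump-clean rs p
  CrossBump-clean (r ∷ rs) (bump p)  = bumps-clean false j (r ∷ rs) (bump p)

  -- Entering at a cross, the pipe goes straight, and (ii) provides the flag. Entering at a bump, it
  -- turns down into the next tile, which can be neither a cross, by (ii), nor a marked bump, by
  -- (iii); this is `descend` or `diagonal`.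
  clean⇒col : ∀ {m f a} c {rs' : Vec ℕ m} {rs} τ → InsAt j a rs' rs → j ∉ c ∷ toList rs' → ColClean f c rs τ →
    ∃₂ λ τ' b → ColIns f a τ' τ b
  clean⇒col c (cross ∷ τ) here j∉ ((p , _) , _) with refl ← p refl (visit-right c) = _ , _ , straight
  clean⇒col c (mbump ∷ τ) here j∉ ((_ , q) , _) with () ← trans (sym (visit-right c)) (q refl)
  clean⇒col c {[]} (bump ∷ []) here j∉ _ = _ , _ , diagonal
  clean⇒col c {r ∷ rs'} (bump ∷ cross ∷ τ) here j∉ (_ , (p , _) , _) rewrite ≡ᵇ-refl j with () ← p refl refl
  clean⇒col c {r ∷ rs'} (bump ∷ mbump ∷ τ) here j∉ (_ , (_ , q) , _) rewrite ≡ᵇ-refl j with () ← q refl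
  clean⇒col c {r ∷ rs'} (bump ∷ bump ∷ τ) here j∉ _ = _ , _ , descend
  clean⇒col c (x ∷ τ) (there {x = r} i) j∉ (_ , cl) with _ , _ , p ← clean⇒col (botOf x c r) τ i (bot-absent x j∉) cl =
    _ , _ , below p

  col⇒clean : ∀ {m f a b} c {rs' : Vec ℕ m} {rs τ' τ} → ColIns f a τ' τ b → InsAt j a rs' rs → j ∉ c ∷ toList rs' →
    ColClean f c rs τ
  col⇒clean c {rs'} {τ' = τ'} straight here j∉ = ((λ _ _ → refl) , (λ ())) , absent-clean false c rs' τ' j∉
  col⇒clean c {r ∷ rs'} {τ' = _ ∷ τ'} descend here j∉ =
    ((λ ()) , (λ ())) , ((λ ()) , (λ ())) , absent-clean true r rs' τ' (λ p → j∉ (there p))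
  col⇒clean c {[]} diagonal here j∉ = ((λ ()) , (λ ())) , tt
  col⇒clean c (below {x = x} p) (there {x = r} i) j∉ rewrite visit-absent j∉ =
    ((λ _ ()) , (λ _ → refl)) , col⇒clean (botOf x c r) p i (bot-absent x j∉)

  Clean-absent : ∀ {n} (ts : Vec ℕ n) P → j ∉ toList ts → Clean ts P
  Clean-absent []       []      j∉ = tt
  Clean-absent (t ∷ ts) (τ ∷ P) j∉ =
    absent-clean false t (run ts P) τ (λ { (here e) → j∉ (here e) ; (there p) → j∉ (there (∈-resp-↭ (run-↭ ts P) p)) }) ,
    Clean-absent ts P (λ p → j∉ (there p))

-- Condition (i) without the clause that the pipe traverses the crosses: starting at the top of its
-- column it passes straight down through the initial crosses, as `visits-crosses` shows.
OwnColumn : ∀ {n} → PD n → ℕ → Set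
OwnColumn []      k       = ⊥
OwnColumn (τ ∷ P) zero    = ∃ λ r → CrossBump r τ
OwnColumn (τ ∷ P) (suc k) = OwnColumn P k

removes-absent : ∀ {j n b t} {ts' : Vec ℕ n} {ts P' P} → Removes j ts' ts P' P b → Increasing ts → Allⱽ (t <_) ts →
  j ∉ t ∷ toList (run ts' P')
removes-absent {ts' = ts'} {P' = P'} p i a (here refl) = <-irrefl refl (proj₁ (removes-All p a))
removes-absent {ts' = ts'} {P' = P'} p i a (there q)   = removes-∉ p i (∈-resp-↭ (run-↭ ts' P') q)

clean⇒removes : ∀ {n} (ts : Vec ℕ (suc n)) P k → Increasing ts → OwnColumn P k → Clean (at (toList ts) k) ts P →
  ∃₂ λ ts' P' → ∃ λ b → Removes (at (toList ts) k) ts' ts P' P b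
clean⇒removes (t ∷ ts) (τ ∷ P) zero    i (r , c) cl = _ , _ , _ , here c
clean⇒removes {suc n} (t ∷ ts) (τ ∷ P) (suc k) (a ∷ i) own (cl , cls)
  with _ , _ , _ , p ← clean⇒removes ts P k i own cls
  with _ , _ , q ← clean⇒col (at (toList ts) k) t τ (removes-run p) (removes-absent p i a) cl = _ , _ , _ , there p q
clean⇒removes {zero} (t ∷ []) (τ ∷ []) (suc k) i () cl

removes⇒clean : ∀ {j n b} {ts' : Vec ℕ n} {ts P' P} → Removes j ts' ts P' P b → Increasing ts → ∀ k → k < suc n →
  at (toList ts) k ≡ j → OwnColumn P k × Clean j ts P
removes⇒clean {j} {ts = _ ∷ ts} {P = _ ∷ P} (here c) (a ∷ i) zero k< e =
  (_ , c) , CrossBump-clean j (run ts P) c , Clean-absent j ts P (λ p → <-irrefl refl (All.lookup (toList⁺ a) p))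
removes⇒clean {ts = _ ∷ ts} (here c) (a ∷ i) (suc k) (s≤s k<) refl =
  ⊥-elim (<-irrefl refl (All.lookup (toList⁺ a) (at-∈ (toList ts) k (subst (k <_) (sym (length-toList ts)) k<))))
removes⇒clean (there p q) (a ∷ i) zero k< refl = ⊥-elim (<-irrefl refl (proj₁ (removes-All p a)))
removes⇒clean {j} (there p q) (a ∷ i) (suc k) (s≤s k<) e with own , cl ← removes⇒clean p i k k< e =
  own , col⇒clean j _ q (removes-run p) (removes-absent p i a) , cl

flagV : ∀ {m} → Bool → Vec Tile m → ℕ → Bool
flagV f τ zero    = f
flagV f τ (suc i) = isBump (lookupV τ i)

flag : ∀ {n} → PD n → ℕ → ℕ → Bool
flag P zero    k = false
flag P (suc i) k = isBump (lookupPD P i k)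

ColClean-cell : ∀ j {m} f c (rs : Vec ℕ m) τ → ColClean j f c rs τ → ∀ i → i < m →
  CellClean (flagV f τ i) (lookupV τ i) (visit j (carry c rs τ i) (at (toList rs) i))
ColClean-cell j f c (r ∷ rs) (x ∷ τ) (p , cl) zero    i< = p
ColClean-cell j f c (r ∷ rs) (x ∷ τ) (p , cl) (suc i) (s≤s i<) with ColClean-cell j (isBump x) (botOf x c r) rs τ cl i i<
... | q with i
...   | zero  = q
...   | suc _ = q

cell-ColClean : ∀ j {m} f c (rs : Vec ℕ m) τ →
  (∀ i → i < m → CellClean (flagV f τ i) (lookupV τ i) (visit j (carry c rs τ i) (at (toList rs) i))) → ColClean j f c rs τ
cell-ColClean j f c []       []      h = tt
cell-ColClean j f c (r ∷ rs) (x ∷ τ) h = h 0 (s≤s z≤n) , cell-ColClean j (isBump x) (botOf x c r) rs τ h'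
  where
  h' : ∀ i → i < _ → CellClean (flagV (isBump x) τ i) (lookupV τ i) (visit j (carry (botOf x c r) rs τ i) (at (toList rs) i))
  h' zero    i< = h 1 (s≤s i<)
  h' (suc i) i< = h (suc (suc i)) (s≤s i<)

Clean-cell : ∀ j {n} (ts : Vec ℕ n) P → Clean j ts P → ∀ i k → suc (i + k) < n →
  CellClean (flag P i k) (lookupPD P i k) (visit j (topL ts P i k) (rightL ts P i (suc k)))
Clean-cell j (t ∷ ts) (τ ∷ P) (cl , cls) i zero (s≤s h) with ColClean-cell j false t (run ts P) τ cl i (subst (_< _) (+-identityʳ i) h)
... | q with i
...   | zero  = q
...   | suc _ = q
Clean-cell j {suc n} (t ∷ ts) (τ ∷ P) (cl , cls) i (suc k) (s≤s h) with Clean-cell j ts P cls i k (subst (_< n) (+-suc i k) h)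
... | q with i
...   | zero  = q
...   | suc _ = q

cell-Clean : ∀ j {n} (ts : Vec ℕ n) P → (∀ i k → suc (i + k) < n →
  CellClean (flag P i k) (lookupPD P i k) (visit j (topL ts P i k) (rightL ts P i (suc k)))) → Clean j ts P
cell-Clean j []       []      h = tt
cell-Clean j {suc n} (t ∷ ts) (τ ∷ P) h = cell-ColClean j false t (run ts P) τ first , cell-Clean j ts P others
  where
  first : ∀ i → i < n → CellClean (flagV false τ i) (lookupV τ i) (visit j (carry t (run ts P) τ i) (at (toList (run ts P)) i))
  first zero    i< = h 0 0 (s≤s i<)
  first (suc i) i< = h (suc i) 0 (s≤s (subst (_< n) (sym (+-identityʳ (suc i))) i<))
  others : ∀ i k → suc (i + k) < n → CellClean (flag P i k) (lookupPD P i k) (visit j (topL ts P i k) (rightL ts P i (suc k)))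
  others zero    k i< = h 0 (suc k) (s≤s i<)
  others (suc i) k i< = h (suc i) (suc k) (s≤s (subst (_< n) (sym (+-suc (suc i) k)) i<))

-- Lookups on and beyond the diagonal return `bump`, so the second half can be stated for all rows
-- without a bound.
CrossesThenBumps : (ℕ → Tile) → ℕ → Set
CrossesThenBumps g r = (∀ i → i < r → g i ≡ cross) × (∀ i → r ≤ i → g i ≡ bump)

CrossBump-lookup : ∀ {m r} {τ : Vec Tile m} → CrossBump r τ → CrossesThenBumps (lookupV τ) r
CrossBump-lookup [] = (λ i ()) , (λ i _ → refl)
CrossBump-lookup (cross c) with f , g ← CrossBump-lookup c =
  (λ { zero _ → refl ; (suc i) (s≤s h) → f i h }) , (λ { (suc i) (s≤s h) → g i h })
CrossBump-lookup (bump c) with f , g ← CrossBump-lookup c =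
  (λ i ()) , (λ { zero _ → refl ; (suc i) _ → g i z≤n })

lookup-CrossBump : ∀ {m} r (τ : Vec Tile m) → CrossesThenBumps (lookupV τ) r → CrossBump r τ
lookup-CrossBump zero    []          _ = []
lookup-CrossBump (suc r) []          (f , g) with () ← f 0 (s≤s z≤n)
lookup-CrossBump zero    (x ∷ τ)     (f , g) with refl ← g 0 z≤n = bump (lookup-CrossBump 0 τ ((λ i ()) , λ i _ → g (suc i) z≤n))
lookup-CrossBump (suc r) (x ∷ τ)     (f , g) with refl ← f 0 (s≤s z≤n) =
  cross (lookup-CrossBump r τ ((λ i h → f (suc i) (s≤s h)) , (λ i h → g (suc i) (s≤s h))))

OwnColumn⇒ : ∀ {n} (P : PD n) k → OwnColumn P k → ∃ λ r → CrossesThenBumps (λ i → lookupPD P i k) r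
OwnColumn⇒ (τ ∷ P) zero    (r , c) = r , CrossBump-lookup c
OwnColumn⇒ (τ ∷ P) (suc k) o = OwnColumn⇒ P k o

⇒OwnColumn : ∀ {n} (P : PD n) k r → k < n → CrossesThenBumps (λ i → lookupPD P i k) r → OwnColumn P k
⇒OwnColumn (τ ∷ P) zero    r k< c = r , lookup-CrossBump r τ c
⇒OwnColumn (τ ∷ P) (suc k) r (s≤s k<) c = ⇒OwnColumn P k r k< c

isBump-true : ∀ {x} → isBump x ≡ true → x ≡ bump
isBump-true {bump} e = refl

all-bumps : ∀ (g : ℕ → Tile × Bool) a l → all (λ tb → isBump (proj₁ tb)) (map g (range a l)) ≡ true →
  ∀ i → i < l → proj₁ (g (a + i)) ≡ bump
all-bumps g a (suc l) e zero    i< rewrite +-identityʳ a = isBump-true (proj₁ (∧-true e))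
all-bumps g a (suc l) e (suc i) (s≤s i<) rewrite +-suc a i = all-bumps g (suc a) l (proj₂ (∧-true {isBump (proj₁ (g a))} e)) i i<

bumps-all : ∀ (g : ℕ → Tile × Bool) a l → (∀ i → proj₁ (g (a + i)) ≡ bump) →
  all (λ tb → isBump (proj₁ tb)) (map g (range a l)) ≡ true
bumps-all g a zero    h = refl
bumps-all g a (suc l) h = ∧-intro (cong isBump (trans (cong (λ z → proj₁ (g z)) (sym (+-identityʳ a))) (h 0)))
  (bumps-all g (suc a) l (λ i → trans (cong (λ z → proj₁ (g z)) (sym (+-suc a i))) (h (suc i))))

pattern⇒ : ∀ (g : ℕ → Tile × Bool) a l → colPattern (map g (range a l)) ≡ true →
  ∃ λ r → (∀ i → i < r → proj₁ (g (a + i)) ≡ cross) × (∀ i → r ≤ i → i < l → proj₁ (g (a + i)) ≡ bump)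
pattern⇒ g a zero    e = 0 , (λ i ()) , (λ i _ ())
pattern⇒ g a (suc l) e with g a in eq
... | cross , true with r , f , h ← pattern⇒ g (suc a) l e = suc r ,
  (λ { zero _ → trans (cong (λ z → proj₁ (g z)) (+-identityʳ a)) (cong proj₁ eq)
     ; (suc i) (s≤s q) → trans (cong (λ z → proj₁ (g z)) (+-suc a i)) (f i q) }) ,
  (λ { (suc i) (s≤s q) (s≤s q') → trans (cong (λ z → proj₁ (g z)) (+-suc a i)) (h i q q') })
... | bump , b = 0 , (λ i ()) ,
  (λ { zero _ _ → trans (cong (λ z → proj₁ (g z)) (+-identityʳ a)) (cong proj₁ eq)
     ; (suc i) _ (s≤s q') → trans (cong (λ z → proj₁ (g z)) (+-suc a i)) (all-bumps g (suc a) l e i q') })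

colPattern-bump : ∀ x v r → x ≡ bump → colPattern ((x , v) ∷ r) ≡ all (λ tb → isBump (proj₁ tb)) r
colPattern-bump bump v r refl = refl

⇒pattern : ∀ (g : ℕ → Tile × Bool) a l r → (∀ i → i < r → i < l → g (a + i) ≡ (cross , true)) →
  (∀ i → r ≤ i → proj₁ (g (a + i)) ≡ bump) → colPattern (map g (range a l)) ≡ true
⇒pattern g a zero    r       f h = refl
⇒pattern g a (suc l) zero    f h =
  trans (colPattern-bump _ (proj₂ (g a)) _ (trans (cong (λ z → proj₁ (g z)) (sym (+-identityʳ a))) (h 0 z≤n)))
    (bumps-all g (suc a) l (λ i → trans (cong (λ z → proj₁ (g z)) (sym (+-suc a i))) (h (suc i) z≤n)))
⇒pattern g a (suc l) (suc r) f h rewrite trans (cong g (sym (+-identityʳ a))) (f 0 (s≤s z≤n) (s≤s z≤n)) =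
  ⇒pattern g (suc a) l r (λ i q q' → trans (cong g (sym (+-suc a i))) (f (suc i) (s≤s q) (s≤s q')))
    (λ i q → trans (cong (λ z → proj₁ (g z)) (sym (+-suc a i))) (h (suc i) (s≤s q)))

module Removability (n : ℕ) (F : List Tile) where
  open Trace n F
  open Validity n F using (1≤∈)

  module _ (k : ℕ) (k<n : k < n) where

    j : ℕ
    j = suc k

    column : ℕ → Tile × Bool
    column i = tileAt n F i j , visits n F j i j

    top-crosses : ∀ {r} → CrossesThenBumps (λ i → lookupPD P i k) r → ∀ i → i < r → i + k < n → top i k ≡ j
    top-crosses c zero    i< h = top-zero k k<n
    top-crosses c (suc i) i< h rewrite bot≡ i k h | tileAt≡ n F i k | proj₁ c i (<⇒≤ i<) = top-crosses c i (<⇒≤ i<) (<⇒≤ h)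

    visits-crosses : ∀ {r} → CrossesThenBumps (λ i → lookupPD P i k) r → ∀ i → i < r → visits n F j (suc i) j ≡ true
    visits-crosses c i i< with suc (i + k) <? n
    ... | yes h rewrite visits≡ j i k h (s≤s z≤n) k<n | top-crosses c i i< (<⇒≤ h) | ≡ᵇ-refl k = refl
    ... | no h with () ← trans (sym (proj₁ c i i<)) (lookupPD-outside P i k (≮⇒≥ h))

    crossCond markCond : ℕ × ℕ → Bool
    crossCond c = not (isCross (tileAt n F (proj₁ c) (proj₂ c)) ∧ visits n F j (proj₁ c) (proj₂ c)) ∨
      (proj₁ c ≡ᵇ 1) ∨ not (isBump (tileAt n F (proj₁ c ∸ 1) (proj₂ c)))
    markCond c = not (isMbump (tileAt n F (proj₁ c) (proj₂ c)) ∧ visits n F j (proj₁ c) (proj₂ c))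

    clean⇒cond : ∀ i k' → suc (i + k') < n →
      CellClean (flag P i k') (lookupPD P i k') (visit j (top i k') (right i (suc k'))) →
      crossCond (suc i , suc k') ≡ true × markCond (suc i , suc k') ≡ true
    clean⇒cond i k' h (p , q) rewrite tileAt≡ n F i k' | visits≡ j i k' h (s≤s z≤n) k<n
      with lookupPD P i k' | (top i k' ≡ᵇ j) ∨ (right i (suc k') ≡ᵇ j)
    ... | bump  | _     = refl , refl
    ... | cross | false = refl , refl
    ... | mbump | false = refl , refl
    ... | mbump | true with () ← q refl
    clean⇒cond zero    k' h (p , q) | cross | true = refl , refl
    clean⇒cond (suc i) k' h (p , q) | cross | true rewrite tileAt≡ n F i k' | p refl refl = refl , refl

    cond⇒clean : ∀ i k' → suc (i + k') < n → crossCond (suc i , suc k') ≡ true → markCond (suc i , suc k') ≡ true →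
      CellClean (flag P i k') (lookupPD P i k') (visit j (top i k') (right i (suc k')))
    cond⇒clean i k' h p q rewrite tileAt≡ n F i k' | visits≡ j i k' h (s≤s z≤n) k<n
      with lookupPD P i k' | (top i k' ≡ᵇ j) ∨ (right i (suc k') ≡ᵇ j)
    ... | bump  | _     = (λ ()) , (λ ())
    ... | cross | false = (λ _ ()) , (λ ())
    ... | mbump | false = (λ ()) , (λ _ → refl)
    cond⇒clean zero    k' h p q | cross | true = (λ _ _ → refl) , (λ ())
    cond⇒clean (suc i) k' h p q | cross | true rewrite tileAt≡ n F i k' = (λ _ _ → not-true p) , (λ ())

    clean⇔ : (Clean j tops P → all crossCond (cells n) ≡ true × all markCond (cells n) ≡ true) ×
      (all crossCond (cells n) ≡ true → all markCond (cells n) ≡ true → Clean j tops P)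
    clean⇔ = (λ cl → all-true⁺ crossCond (cells n) (λ c∈ → proj₁ (conds cl c∈)) , all-true⁺ markCond (cells n) (λ c∈ → proj₂ (conds cl c∈))) ,
      (λ p q → cell-Clean j tops P (λ i k' h → cond⇒clean i k' h
        (all-true⁻ crossCond p (cells-∈⁺ n i k' h)) (all-true⁻ markCond q (cells-∈⁺ n i k' h))))
      where
      conds : Clean j tops P → ∀ {c} → c ∈ cells n → crossCond c ≡ true × markCond c ≡ true
      conds cl c∈ with i , k' , refl , h ← cells-∈⁻ n c∈ = clean⇒cond i k' h (Clean-cell j tops P cl i k' h)

    own⇒pattern : OwnColumn P k → colPattern (map column (oneTo (n ∸ k))) ≡ true
    own⇒pattern o with r , c ← OwnColumn⇒ P k o = ⇒pattern column 1 (n ∸ k) r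
      (λ i q _ → cong₂ _,_ (trans (tileAt≡ n F i k) (proj₁ c i q)) (visits-crosses c i q))
      (λ i q → trans (tileAt≡ n F i k) (proj₂ c i q))

    pattern⇒own : colPattern (map column (oneTo (n ∸ k))) ≡ true → OwnColumn P k
    pattern⇒own e with r , f , g ← pattern⇒ column 1 (n ∸ k) e = ⇒OwnColumn P k r k<n
      ((λ i q → trans (sym (tileAt≡ n F i k)) (f i q)) , bumps)
      where
      bumps : ∀ i → r ≤ i → lookupPD P i k ≡ bump
      bumps i q with i <? n ∸ k
      ... | yes h = trans (sym (tileAt≡ n F i k)) (g i q h)
      -- The column tested by (i) has n - k cells, diagonal included; the rows below it lie outside
      -- the staircase.
      ... | no h = lookupPD-outside P i k (m≤n⇒m≤1+n (≤-trans (m≤n+m∸n n k) (≤-trans (+-monoʳ-≤ k (≮⇒≥ h)) (≤-reflexive (+-comm k i)))))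

    tops-k : at (toList tops) k ≡ j
    tops-k = trans (cong (λ u → at u k) (toList-rangeV 1 n)) (at-range 1 n k k<n)

removable-suc : ∀ n F k → k < n → removableᵇ n F (suc k) ≡ removable (suc k) (rangeV 1 n) (toPD n F)
removable-suc (suc n) F k k<n = ≡true-ext to from
  where
  open Trace (suc n) F
  open Removability (suc n) F
  increasing = rangeV-Increasing 1 (suc n)
  to : removableᵇ (suc n) F (suc k) ≡ true → removable (suc k) tops P ≡ true
  to e with e₁ , e' ← ∧-true {colPattern (map (column k k<n) (oneTo (suc n ∸ k)))} e
    with e₂ , e₃ ← ∧-true {all (crossCond k k<n) (cells (suc n))} e'
    with _ , _ , _ , p ← clean⇒removes tops P k increasing (pattern⇒own k k<n e₁)
           (subst (λ j → Clean j tops P) (sym (tops-k k k<n)) (proj₂ (clean⇔ k k<n) e₂ e₃)) =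
    subst (λ j → removable j tops P ≡ true) (tops-k k k<n) (⇒removable increasing p)
  from : removable (suc k) tops P ≡ true → removableᵇ (suc n) F (suc k) ≡ true
  from e with _ , _ , _ , p ← removable⇒ (suc k) tops P e
    with own , cl ← removes⇒clean p increasing k k<n (tops-k k k<n)
    with e₂ , e₃ ← proj₁ (clean⇔ k k<n) cl = ∧-intro (own⇒pattern k k<n own) (∧-intro e₂ e₃)

removable≡ : ∀ n F {j} → j ∈ oneTo n → removableᵇ n F j ≡ removable j (rangeV 1 n) (toPD n F)
removable≡ n F {zero}  j∈ with () ← proj₁ (range-∈⁻ 1 n j∈)
removable≡ n F {suc k} j∈ = removable-suc n F k (≤-pred (proj₂ (range-∈⁻ 1 n j∈)))

noneRemovable-any : ∀ {n} L (ts : Vec ℕ n) P → noneRemovable L ts P ≡ not (any (λ l → removable l ts P) L)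
noneRemovable-any []      ts P = refl
noneRemovable-any (l ∷ L) ts P with removable l ts P
... | true  = refl
... | false = noneRemovable-any L ts P

-- The two tests run through the same labels, one in the order 1, ..., n and the other in the order
-- of `w`.
core≡ : ∀ n F w → w ↭ oneTo n → isCoreᵇ n F ≡ noneRemovable w (rangeV 1 n) (toPD n F)
core≡ n F w w↭ = trans (cong not (≡true-ext to from)) (sym (noneRemovable-any w (rangeV 1 n) (toPD n F)))
  where
  to : any (removableᵇ n F) (oneTo n) ≡ true → any (λ l → removable l (rangeV 1 n) (toPD n F)) w ≡ true
  to e with j , j∈ , r ← any-true⁻ (removableᵇ n F) (oneTo n) e =
    any-true⁺ _ (∈-resp-↭ (↭-sym w↭) j∈) (trans (sym (removable≡ n F j∈)) r)
  from : any (λ l → removable l (rangeV 1 n) (toPD n F)) w ≡ true → any (removableᵇ n F) (oneTo n) ≡ true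
  from e with j , j∈ , r ← any-true⁻ _ w e =
    any-true⁺ _ (∈-resp-↭ w↭ j∈) (trans (removable≡ n F (∈-resp-↭ w↭ j∈)) r)

-- Counting core pipe dreams

mbt-row : ∀ n F → n ≤ length F → mbt F ≡ marksV (rowFrom n F) + mbt (drop n F)
mbt-row zero    F           h = refl
mbt-row (suc n) (cross ∷ F) (s≤s h) = mbt-row n F h
mbt-row (suc n) (bump ∷ F)  (s≤s h) = mbt-row n F h
mbt-row (suc n) (mbump ∷ F) (s≤s h) = cong suc (mbt-row n F h)

mbt≡ : ∀ n F → length F ≡ tri n → mbt F ≡ marks (toPD n F)
mbt≡ zero    [] e = refl
mbt≡ (suc n) F  e = trans (mbt-row n F (subst (n ≤_) (sym e) (m≤m+n n (tri n))))
  (trans (cong (marksV (rowFrom n F) +_) (mbt≡ n (drop n F) (length-drop-+ n (tri n) F e)))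
    (sym (marks-consRow (rowFrom n F) (toPD n (drop n F)))))

dCoeff-count : ∀ w k → w ↭ oneTo (length w) → dCoeff w k ≡
  ℤ+ count (λ P → isPDof (rangeV 1 (length w)) w k P ∧ noneRemovable w (rangeV 1 (length w)) P) (allPD (length w))
dCoeff-count w k w↭ = cong ℤ+_ (trans (count-cong-∈ (fillings n) (λ F∈ → same F∈))
  (sym (count-map (λ P → isPDof (rangeV 1 n) w k P ∧ noneRemovable w (rangeV 1 n) P) (toPD n) (fillings n))))
  where
  n = length w
  regroup : ∀ a b c d e → (a ∧ (b ∧ c)) ∧ d ∧ e ≡ ((b ∧ c) ∧ a ∧ e) ∧ d
  regroup true  true  true  true  true  = refl
  regroup true  true  true  true  false = refl
  regroup true  true  true  false true  = refl
  regroup true  true  true  false false = refl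
  regroup true  true  false d     e     = refl
  regroup true  false c     d     e     = refl
  regroup false true  true  d     e     = refl
  regroup false true  false d     e     = refl
  regroup false false c     d     e     = refl
  same : ∀ {F} → F ∈ fillings n → isMRPDᵇ w F ∧ isCoreᵇ n F ∧ (mbt F ≡ᵇ k) ≡
    isPDof (rangeV 1 n) w k (toPD n F) ∧ noneRemovable w (rangeV 1 n) (toPD n F)
  same {F} F∈
    rewrite sym (Validity.valid≡ n F) | sym (Trace.labels≡ n F) | sym (core≡ n F w w↭)
          | sym (mbt≡ n F (trans (All.lookup (tileLists-length (length (cells n))) F∈) (length-cells n))) =
    regroup (listEqᵇ (labels n F) w) (reducedᵇ n F) (markOKᵇ n F) (isCoreᵇ n F) (mbt F ≡ᵇ k)

theorem3p6 : (w : List ℕ) → w ↭ oneTo (length w) → Avoids1423 w →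
    (k : ℕ) → cCoeff w k ≡ dCoeff w k
theorem3p6 w w↭ av k = trans (cCoeff-count (length w) w k w↭ av) (sym (dCoeff-count w k w↭))
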